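{- The function $\mathrm{3SATC}:\mathbb B^*\to\mathbb B$ is NP-complete (with respect to polynomial-time Karp reductions).
   Context: Let $\mathbb B=\{\mathsf T,\mathsf F\}$. For $k\in\mathbb N$ let $\mathrm{nd}(k)=\binom{2k}{1}+\binom{2k}{2}+\binom{2k}{3}$. Let $v_1,v_2,\dots$ be propositional variables. Fix a family of bijections $\alpha_k:[1,\mathrm{nd}(k)]\to\{L\subseteq\{v_1,\neg v_1,\dots,v_k,\neg v_k\}\mid 1\le|L|\le3\}$ ($k\in\mathbb N$) such that $\alpha_i^{ -1}(\alpha_{i+1}(j))=j$ for all $i\in\mathbb N$, $j\in[1,\mathrm{nd}(i)]$, and such that the function $\alpha$ on positive integers defined by $\alpha(i)=\alpha_{\min\{j\mid i\in[1,\mathrm{nd}(j)]\}}(i)$ is polynomial-time computable. For each $n\in\mathbb N$ define $\mathrm{3SATC}_n:\mathbb B^n\to\mathbb B$: if $n=\mathrm{nd}(k)$ for some $k$, then $\mathrm{3SATC}_n(b_1,\dots,b_n)=\mathsf T$ iff the formula $\bigwedge_{i\in[1,n],\,b_i=\mathsf T}\bigvee\alpha_k(i)$ is satisfiable (where $\bigvee L$ is the disjunction of the literals in $L$); if $\mathrm{nd}(k)<n<\mathrm{nd}(k+1)$, then $\mathrm{3SATC}_n(b_1,\dots,b_n)=\mathrm{3SATC}_{\mathrm{nd}(k)}(b_1,\dots,b_{\mathrm{nd}(k)})$. $\mathrm{3SATC}:\mathbb B^*\to\mathbb B$ is the function with $\mathrm{3SATC}(w)=\mathrm{3SATC}_n(w)$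 for $w\in\mathbb B^n$. -}

module Defs where

open import Data.Nat using (ℕ; zero; suc; _+_; _*_; _^_; _≤_; _<_; _≤ᵇ_; _/_; _%_)
open import Data.Nat.Combinatorics using (_C_)
open import Data.Bool using (Bool; true; false; if_then_else_; not)
open import Data.List using (List; []; _∷_; _++_; length; map; concatMap; take)
open import Data.Vec using (Vec; lookup) renaming ([] to []ᵥ; _∷_ to _∷ᵥ_)
open import Data.Fin using (Fin; toℕ; remQuot)
import Data.Fin as F
open import Data.Fin.Subset using (Subset; Side; inside; outside; _∈_; ∣_∣)
open import Data.Product using (Σ; ∃; _×_; _,_; proj₁; proj₂)
open import Relation.Binary.PropositionalEquality using (_≡_)
open import Function.Definitions using (Injective)

Sym : ℕ → Set
Sym g = Fin (3 + g)

blank : ∀ {g} → Sym g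
blank = F.zero

encBit : ∀ {g} → Bool → Sym g
encBit false = F.suc F.zero
encBit true  = F.suc (F.suc F.zero)

data Move : Set where
  moveL moveR stay : Move

record TM : Set where
  field
    nQ      : ℕ
    nΓ      : ℕ
    start   : Fin nQ
    halting : Fin nQ → Bool
    δ       : Fin nQ → Sym nΓ → Fin nQ × Sym nΓ × Move

open TM public

-- configuration: state, cells left of the head (nearest first),
-- cells from the head rightwards; missing cells are blank.
record Config (M : TM) : Set where
  constructor cfg
  field
    state : Fin (nQ M)
    left  : List (Sym (nΓ M))
    right : List (Sym (nΓ M))

open Config public

step : (M : TM) → Config M → Config M
step M (cfg q l r) with halting M q
... | true  = cfg q l r
... | false = go (δ M q (hd r))
  where
  hd : List (Sym (nΓ M)) → Sym (nΓ M)
  hd []      = blank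
  hd (a ∷ _) = a
  tl : List (Sym (nΓ M)) → List (Sym (nΓ M))
  tl []       = []
  tl (_ ∷ xs) = xs
  go : Fin (nQ M) × Sym (nΓ M) × Move → Config M
  mvL : Fin (nQ M) → List (Sym (nΓ M)) → List (Sym (nΓ M)) → Config M
  mvL q' []       r' = cfg q' [] (blank ∷ r')
  mvL q' (x ∷ l') r' = cfg q' l' (x ∷ r')
  go (q' , w , moveL) = mvL q' l (w ∷ tl r)
  go (q' , w , moveR) = cfg q' (w ∷ l) (tl r)
  go (q' , w , stay)  = cfg q' l (w ∷ tl r)

run : (M : TM) → ℕ → Config M → Config M
run M zero    c = c
run M (suc t) c = run M t (step M c)

initial : (M : TM) → List Bool → Config M
initial M x = cfg (start M) [] (map encBit x)

decodeOut : ∀ {g} → List (Sym g) → List Bool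
decodeOut [] = []
decodeOut (F.zero ∷ _) = []
decodeOut (F.suc F.zero ∷ xs) = false ∷ decodeOut xs
decodeOut (F.suc (F.suc F.zero) ∷ xs) = true ∷ decodeOut xs
decodeOut (F.suc (F.suc (F.suc _)) ∷ _) = []

ComputesIn : TM → (List Bool → List Bool) → (ℕ → ℕ) → Set
ComputesIn M f T = ∀ x → Σ ℕ λ t → t ≤ T (length x)
  × halting M (state (run M t (initial M x))) ≡ true
  × decodeOut (right (run M t (initial M x))) ≡ f x

polyBound : ℕ → ℕ → ℕ
polyBound c n = c * n ^ c + c

PolyTime : (List Bool → List Bool) → Set
PolyTime f = Σ TM λ M → Σ ℕ λ c → ComputesIn M f (polyBound c)

Lang : Set₁
Lang = List Bool → Set

double : List Bool → List Bool
double [] = []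
double (b ∷ bs) = b ∷ b ∷ double bs

pair : List Bool → List Bool → List Bool
pair x w = double x ++ (true ∷ false ∷ []) ++ w

InNP : Lang → Set
InNP L = Σ (List Bool → Bool) λ v → PolyTime (λ y → v y ∷ [])
  × Σ ℕ λ c → ∀ x →
      (L x → Σ (List Bool) λ w → length w ≤ polyBound c (length x) × v (pair x w) ≡ true)
    × (Σ (List Bool) (λ w → length w ≤ polyBound c (length x) × v (pair x w) ≡ true) → L x)

_≤ₚ_ : Lang → Lang → Set
L ≤ₚ L' = Σ (List Bool → List Bool) λ f → PolyTime f
  × (∀ x → (L x → L' (f x)) × (L' (f x) → L x))

NPComplete : Lang → Set₁
NPComplete L = InNP L × (∀ (L' : Lang) → InNP L' → L' ≤ₚ L)

nd : ℕ → ℕ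
nd k = ((2 * k) C 1) + ((2 * k) C 2) + ((2 * k) C 3)

-- Literals over v_1..v_k are indexed by Fin (k * 2): index var * 2 + pol
-- denotes v_{var+1} if pol = 0 and ¬ v_{var+1} if pol = 1
-- (ordering v_1, ¬v_1, v_2, ¬v_2, ...).  A clause (set of literals)
-- is a Subset (k * 2).
Clause : ℕ → Set
Clause k = Subset (k * 2)

litVal : ∀ {k} → Vec Bool k → Fin (k * 2) → Bool
litVal {k} σ p with remQuot {k} 2 p
... | (v , F.zero)   = lookup σ v
... | (v , F.suc _)  = not (lookup σ v)

ClauseSat : ∀ {k} → Vec Bool k → Clause k → Set
ClauseSat {k} σ s = Σ (Fin (k * 2)) λ p → p ∈ s × litVal σ p ≡ true

members : ∀ {n} → Subset n → List ℕ
members []ᵥ = []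
members (inside ∷ᵥ s)  = 0 ∷ map suc (members s)
members (outside ∷ᵥ s) = map suc (members s)

-- standard binary (most significant bit first, no leading zeros, 0 ↦ ε)
binAux : ℕ → ℕ → List Bool
binAux zero     n = []
binAux (suc f) zero = []
binAux (suc f) (suc n) = binAux f (suc n / 2) ++ (not (suc n % 2 ≤ᵇ 0) ∷ [])

bin : ℕ → List Bool
bin n = binAux n n

encNats : List ℕ → List Bool
encNats = concatMap (λ m → double (bin m) ++ (true ∷ false ∷ []))

encClause : ∀ {k} → Clause k → List Bool
encClause s = encNats (members s)

AlphaFamily : ((k : ℕ) → Fin (nd k) → Clause k) → Set
AlphaFamily α =
    (∀ k (j : Fin (nd k)) → 1 ≤ ∣ α k j ∣ × ∣ α k j ∣ ≤ 3)
  × (∀ k → Injective _≡_ _≡_ (α k))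
  × (∀ k (s : Clause k) → 1 ≤ ∣ s ∣ → ∣ s ∣ ≤ 3 → Σ (Fin (nd k)) λ j → α k j ≡ s)
  × (∀ k (j : Fin (nd k)) (j' : Fin (nd (suc k))) → toℕ j ≡ toℕ j' →
       members (α (suc k) j') ≡ members (α k j))
    -- the function i ↦ α_{min{k | i ≤ nd k}}(i) is polynomial-time computable
  × Σ (List Bool → List Bool) (λ g → PolyTime g ×
      (∀ k (j : Fin (nd k)) → (∀ k' → k' < k → nd k' ≤ toℕ j) →
         g (bin (suc (toℕ j))) ≡ encClause {k} (α k j)))

-- greatest k ≤ n with nd k ≤ n (since nd k > k for k ≥ 1, this is the
-- unique k with nd k ≤ n < nd (k + 1))
lvlAux : ℕ → ℕ → ℕ
lvlAux zero    n = zero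
lvlAux (suc f) n = if nd (suc f) ≤ᵇ n then suc f else lvlAux f n

level : ℕ → ℕ
level n = lvlAux n n

bitAt : List Bool → ℕ → Bool
bitAt [] _ = false
bitAt (b ∷ _) zero = b
bitAt (_ ∷ bs) (suc i) = bitAt bs i

ThreeSATC : ((k : ℕ) → Fin (nd k) → Clause k) → Lang
ThreeSATC α w = Σ (Vec Bool k) λ σ → ∀ (i : Fin (nd k)) →
    bitAt w (toℕ i) ≡ true → ClauseSat {k} σ (α k i)
  where
  k = level (length w)

{-# OPTIONS --safe #-}

-- Membership: the certificate is an assignment to v₁, …, v_k, where k is determined
-- by nd k ≤ n < nd (k + 1), and the clauses at the set positions are read off α.
--
-- Hardness (Cook–Levin): a run of the verifier is described by atoms "at time t the
-- machine is in state q", "… reads s in state q" and "… the i-th cell to the left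
-- (right) of the head holds s". In these head-relative coordinates every cell of the
-- next configuration is a constant or a copy of one old cell, selected by the state
-- and the symbol read, so Horn clauses with at most three literals suffice. No
-- uniqueness constraints are needed: the actual run is contained in every model, by
-- induction on t for the cells with i + t ≤ T, and is itself a model. Bit j of the
-- instance of 3SATC tells whether α(j) contains some clause of the formula.
--
-- Polynomial-time computability is established for programs on four stacks, which a
-- Turing machine keeps on four tracks of its tape. Serialised trees on one stack
-- represent structured data, and functions on these are closed under composition,
-- pairing, case distinction, iteration with polynomially bounded values, and calls to
-- a given Turing machine.
module Submission where

open import Defs
open import Data.Nat
  using (ℕ; zero; suc; _+_; _*_; _^_; _∸_; _≤_; _<_; _≤ᵇ_; _/_; _%_; z≤n; s≤s; _≤?_; _<?_; pred)
open import Data.Nat.Properties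
open import Data.Nat.DivMod using (m*n/n≡m; m*n%n≡0; [m+kn]%n≡m%n; +-distrib-/-∣ʳ; m/n<m)
open import Data.Nat.Divisibility using (divides)
open import Data.List.Membership.Propositional.Properties using (∈-++⁺ˡ; ∈-++⁺ʳ; ∈-++⁻; ∈-map⁺; ∈-map⁻; ∈-allFin)
open import Data.List.Relation.Unary.Any.Properties using (reverse⁺; reverse⁻)
open import Data.Nat.Tactic.RingSolver using (solve-∀)
open import Data.Nat.Combinatorics using (_C_; nCk+nC[k+1]≡[n+1]C[k+1]; nC1≡n)
import Data.Bool
open import Data.Bool using (Bool; true; false; if_then_else_; not; _∧_; _∨_)
open import Data.Bool.ListAction using (any; all)
open import Data.Maybe using (Maybe; just; nothing)
import Data.Maybe
open import Data.List
  using (List; []; _∷_; _++_; length; map; reverse; _ʳ++_; _∷ʳ_; downFrom; foldl; allFin)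
open import Data.List.Properties
open import Data.List.Relation.Unary.All using (All; []; _∷_)
import Data.List.Relation.Unary.All as All
open import Data.List.Relation.Unary.Any using (here; there)
open import Data.List.Membership.Propositional renaming (_∈_ to _∈ₗ_)
import Data.Vec
open import Data.Vec using (Vec; lookup; _[_]≔_; replicate; toList; fromList; here; there) renaming ([] to []ᵥ; _∷_ to _∷ᵥ_)
open import Data.Vec.Properties using (lookup∘update; lookup∘update′; length-toList; lookup∘tabulate; toList∘fromList)
open import Data.Fin using (Fin; toℕ; fromℕ<; remQuot; combine; splitAt; join)
import Data.Fin as F
import Data.Fin.Properties as FP
import Data.Fin.Subset
open import Data.Fin.Subset using (Subset; inside; outside; _∈_; ∣_∣; ⁅_⁆; _∪_)
import Data.Fin.Subset.Properties as SP
open import Data.Product using (Σ; _×_; _,_; proj₁; proj₂)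
open import Data.Sum using (_⊎_; inj₁; inj₂; [_,_]′)
open import Data.Unit using (⊤; tt)
open import Data.Empty using (⊥-elim)
open import Function using (_∘_; id; case_of_)
open import Relation.Nullary using (¬_; Dec; yes; no; does)
open import Relation.Nullary.Decidable using (dec-true)
open import Relation.Binary.PropositionalEquality

-- The guess of a certificate cell is the only clause that is not Horn. A model may make several of
-- its alternatives true; picking any true one at each cell yields a certificate whose run lies
-- inside the model. A copied cell depends on state, scanned symbol and old cell, which would need
-- four literals; an atom for the pair of state and scanned symbol brings this down to three. Halted
-- configurations repeat themselves, so acceptance is tested at one fixed time. On the computational
-- side the obstacle is that iterating a polynomial-time step can make values explode. Folds
-- therefore demand that the accumulator grows by an amount that does not depend on the accumulator.
-- Sizes of results come for free: every push costs a step, so running time bounds output size. The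
-- clauses of `α` are produced by an unknown machine as binary words, so literals are compared as
-- words and never converted back to numbers by the programs.

≤-by : ∀ {m n} k → m + k ≡ n → m ≤ n
≤-by {m} k refl = m≤m+n m k

-- Polynomially bounded monotone functions

record Pol : Set where
  constructor mkPol
  field
    fn   : ℕ → ℕ
    mono : ∀ {m n} → m ≤ n → fn m ≤ fn n
    coef : ℕ
    deg  : ℕ
    bd   : ∀ n → fn n ≤ coef * suc n ^ deg
open Pol

K : ℕ → Pol
K c = mkPol (λ _ → c) (λ _ → ≤-refl) c 0 (λ n → ≤-reflexive (sym (*-identityʳ c)))

X : Pol
X = mkPol id id 1 1 λ n → ≤-trans (n≤1+n n) (≤-reflexive (solve-eq n))
  where
  solve-eq : ∀ n → suc n ≡ 1 * (suc n * 1)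
  solve-eq = solve-∀

infixl 6 _⊕_
infixl 7 _⊗_

-- Degrees are added rather than maximised: the base `suc n` is positive, so its powers are monotone
-- in the exponent. `fn` remains the exact function, so costs of programs unfold to plain
-- arithmetic.
_⊕_ : Pol → Pol → Pol
fn (p ⊕ q) n = fn p n + fn q n
mono (p ⊕ q) h = +-mono-≤ (mono p h) (mono q h)
coef (p ⊕ q) = coef p + coef q
deg (p ⊕ q) = deg p + deg q
bd (p ⊕ q) n = begin
  fn p n + fn q n
    ≤⟨ +-mono-≤ (bd p n) (bd q n) ⟩
  coef p * suc n ^ deg p + coef q * suc n ^ deg q
    ≤⟨ +-mono-≤ (*-monoʳ-≤ (coef p) (^-monoʳ-≤ (suc n) (m≤m+n (deg p) (deg q))))
                (*-monoʳ-≤ (coef q) (^-monoʳ-≤ (suc n) (m≤n+m (deg q) (deg p)))) ⟩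
  coef p * suc n ^ (deg p + deg q) + coef q * suc n ^ (deg p + deg q)
    ≡⟨ *-distribʳ-+ (suc n ^ (deg p + deg q)) (coef p) (coef q) ⟨
  (coef p + coef q) * suc n ^ (deg p + deg q) ∎
  where open ≤-Reasoning

_⊗_ : Pol → Pol → Pol
fn (p ⊗ q) n = fn p n * fn q n
mono (p ⊗ q) h = *-mono-≤ (mono p h) (mono q h)
coef (p ⊗ q) = coef p * coef q
deg (p ⊗ q) = deg p + deg q
bd (p ⊗ q) n = begin
  fn p n * fn q n
    ≤⟨ *-mono-≤ (bd p n) (bd q n) ⟩
  (coef p * suc n ^ deg p) * (coef q * suc n ^ deg q)
    ≡⟨ [m*n]*[o*p]≡[m*o]*[n*p] (coef p) (suc n ^ deg p) (coef q) (suc n ^ deg q) ⟩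
  (coef p * coef q) * (suc n ^ deg p * suc n ^ deg q)
    ≡⟨ cong ((coef p * coef q) *_) (^-distribˡ-+-* (suc n) (deg p) (deg q)) ⟨
  (coef p * coef q) * suc n ^ (deg p + deg q) ∎
  where open ≤-Reasoning

^-distribʳ-* : ∀ m n o → (m * n) ^ o ≡ m ^ o * n ^ o
^-distribʳ-* m n zero = refl
^-distribʳ-* m n (suc o) rewrite ^-distribʳ-* m n o =
  [m*n]*[o*p]≡[m*o]*[n*p] m n (m ^ o) (n ^ o)

1≤suc^ : ∀ m n → 1 ≤ suc m ^ n
1≤suc^ m n = m^n>0 (suc m) n

_⊚_ : Pol → Pol → Pol
fn (p ⊚ q) n = fn p (fn q n)
mono (p ⊚ q) h = mono p (mono q h)
coef (p ⊚ q) = coef p * suc (coef q) ^ deg p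
deg (p ⊚ q) = deg q * deg p
bd (p ⊚ q) n = begin
  fn p (fn q n)
    ≤⟨ bd p (fn q n) ⟩
  coef p * suc (fn q n) ^ deg p
    ≤⟨ *-monoʳ-≤ (coef p) (^-monoˡ-≤ (deg p) (+-mono-≤ (1≤suc^ n (deg q)) (bd q n))) ⟩
  coef p * (suc (coef q) * suc n ^ deg q) ^ deg p
    ≡⟨ cong (coef p *_) (^-distribʳ-* (suc (coef q)) (suc n ^ deg q) (deg p)) ⟩
  coef p * (suc (coef q) ^ deg p * (suc n ^ deg q) ^ deg p)
    ≡⟨ cong (λ z → coef p * (suc (coef q) ^ deg p * z)) (^-*-assoc (suc n) (deg q) (deg p)) ⟩
  coef p * (suc (coef q) ^ deg p * suc n ^ (deg q * deg p))
    ≡⟨ *-assoc (coef p) _ _ ⟨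
  coef p * suc (coef q) ^ deg p * suc n ^ (deg q * deg p) ∎
  where open ≤-Reasoning

polyBound-Pol : ℕ → Pol
fn (polyBound-Pol c) = polyBound c
mono (polyBound-Pol c) h = +-monoˡ-≤ c (*-monoʳ-≤ c (^-monoˡ-≤ c h))
coef (polyBound-Pol c) = c + c
deg (polyBound-Pol c) = c
bd (polyBound-Pol c) n = begin
  c * n ^ c + c
    ≤⟨ +-mono-≤ (*-monoʳ-≤ c (^-monoˡ-≤ c (n≤1+n n)))
                (≤-trans (≤-reflexive (sym (*-identityʳ c))) (*-monoʳ-≤ c (1≤suc^ n c))) ⟩
  c * suc n ^ c + c * suc n ^ c
    ≡⟨ *-distribʳ-+ (suc n ^ c) c c ⟨
  (c + c) * suc n ^ c ∎
  where open ≤-Reasoning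

-- A single `c` must act as coefficient, exponent and additive constant. Since `suc (suc n)` is at
-- most twice `suc n`, the factor `2 ^ b` absorbs the shift of the base; at 0, where the power may
-- vanish, the additive `c` pays.
toPolyBound : (p : Pol) → Σ ℕ λ c → ∀ n → fn p n ≤ polyBound c n
toPolyBound p = c , λ n → ≤-trans (bd p n) (bound n)
  where
  a = coef p
  b = deg p
  c = a * 2 ^ b + b
  open ≤-Reasoning
  bound : ∀ n → a * suc n ^ b ≤ polyBound c n
  bound zero = begin
    a * 1 ^ b         ≤⟨ *-monoʳ-≤ a (^-monoˡ-≤ b {1} {2} (s≤s z≤n)) ⟩
    a * 2 ^ b         ≤⟨ m≤m+n _ b ⟩
    c                 ≤⟨ m≤n+m c (c * 0 ^ c) ⟩
    c * 0 ^ c + c     ∎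
  bound (suc n) = begin
    a * suc (suc n) ^ b
      ≤⟨ *-monoʳ-≤ a (^-monoˡ-≤ b (s≤s (≤-trans (s≤s (m≤m+n n (n + 0))) (≤-reflexive (sym (+-suc n (n + 0))))))) ⟩
    a * (2 * suc n) ^ b
      ≡⟨ cong (a *_) (^-distribʳ-* 2 (suc n) b) ⟩
    a * (2 ^ b * suc n ^ b)
      ≡⟨ *-assoc a (2 ^ b) (suc n ^ b) ⟨
    a * 2 ^ b * suc n ^ b
      ≤⟨ *-mono-≤ (m≤m+n (a * 2 ^ b) b) (^-monoʳ-≤ (suc n) (m≤n+m b (a * 2 ^ b))) ⟩
    c * suc n ^ c
      ≤⟨ m≤m+n _ c ⟩
    c * suc n ^ c + c ∎

-- Finite types

-- One round trip makes the coding injective, which is all that states, symbols and atoms require;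
-- `size` is then an upper bound on the number of elements.
record Finite (A : Set) : Set where
  field
    size    : ℕ
    to      : A → Fin size
    from    : Fin size → A
    from-to : ∀ a → from (to a) ≡ a

open Finite

module _ {A : Set} (F : Finite A) where
  to-injective : ∀ {a b} → to F a ≡ to F b → a ≡ b
  to-injective {a} {b} e = trans (sym (from-to F a)) (trans (cong (from F) e) (from-to F b))

  finite-≟ : (a b : A) → Dec (a ≡ b)
  finite-≟ a b with to F a FP.≟ to F b
  ... | yes e = yes (to-injective e)
  ... | no ¬e = no λ { refl → ¬e refl }

opaque

  retract : ∀ {A B} → Finite B → (f : A → B) (g : B → A) → (∀ a → g (f a) ≡ a) → Finite A
  size (retract F f g gf) = size F
  to (retract F f g gf) a = to F (f a)
  from (retract F f g gf) i = g (from F i)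
  from-to (retract F f g gf) a = trans (cong g (from-to F (f a))) (gf a)

  fin-Fin : ∀ n → Finite (Fin n)
  fin-Fin n = record { size = n ; to = id ; from = id ; from-to = λ _ → refl }

  fin-⊤ : Finite ⊤
  fin-⊤ = retract (fin-Fin 1) (λ _ → F.zero) (λ _ → tt) (λ _ → refl)

  fin-⊎ : ∀ {A B} → Finite A → Finite B → Finite (A ⊎ B)
  fin-⊎ {A} {B} F G = retract (fin-Fin (size F + size G)) f g gf
    where
    f′ : A ⊎ B → Fin (size F) ⊎ Fin (size G)
    f′ (inj₁ a) = inj₁ (to F a)
    f′ (inj₂ b) = inj₂ (to G b)
    f : A ⊎ B → Fin (size F + size G)
    f x = join _ _ (f′ x)
    g′ : Fin (size F) ⊎ Fin (size G) → A ⊎ B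
    g′ (inj₁ i) = inj₁ (from F i)
    g′ (inj₂ j) = inj₂ (from G j)
    g : Fin (size F + size G) → A ⊎ B
    g i = g′ (splitAt (size F) i)
    gf : ∀ x → g (f x) ≡ x
    gf x rewrite FP.splitAt-join (size F) (size G) (f′ x) with x
    ... | inj₁ a = cong inj₁ (from-to F a)
    ... | inj₂ b = cong inj₂ (from-to G b)

  fin-× : ∀ {A B} → Finite A → Finite B → Finite (A × B)
  fin-× {A} {B} F G = retract (fin-Fin (size F * size G)) f g gf
    where
    f : A × B → Fin (size F * size G)
    f (a , b) = combine (to F a) (to G b)
    g′ : Fin (size F) × Fin (size G) → A × B
    g′ (i , j) = from F i , from G j
    g : Fin (size F * size G) → A × B
    g i = g′ (remQuot (size G) i)
    gf : ∀ x → g (f x) ≡ x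
    gf (a , b) = trans (cong g′ (FP.remQuot-combine (to F a) (to G b)))
                       (cong₂ _,_ (from-to F a) (from-to G b))

  fin-Maybe : ∀ {A} → Finite A → Finite (Maybe A)
  fin-Maybe {A} F = retract (fin-⊎ fin-⊤ F) f g gf
    where
    f : Maybe A → ⊤ ⊎ A
    f nothing = inj₁ tt
    f (just a) = inj₂ a
    g : ⊤ ⊎ A → Maybe A
    g (inj₁ _) = nothing
    g (inj₂ a) = just a
    gf : ∀ x → g (f x) ≡ x
    gf nothing = refl
    gf (just a) = refl

  fin-Vec : ∀ {A} → Finite A → ∀ n → Finite (Vec A n)
  fin-Vec F zero = retract fin-⊤ (λ _ → tt) (λ _ → []ᵥ) λ { []ᵥ → refl }
  fin-Vec F (suc n) = retract (fin-× F (fin-Vec F n))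
    (λ { (a ∷ᵥ v) → a , v }) (λ { (a , v) → a ∷ᵥ v }) λ { (a ∷ᵥ v) → refl }

  fin-ΣFin : ∀ n (P : Fin n → Set) → (∀ i → Finite (P i)) → Finite (Σ (Fin n) P)
  fin-ΣFin zero P F = retract (fin-Fin 0) proj₁ (λ ()) λ { (() , _) }
  fin-ΣFin (suc n) P F = retract (fin-⊎ (F F.zero) (fin-ΣFin n (P ∘ F.suc) (F ∘ F.suc))) f g gf
    where
    f : Σ (Fin (suc n)) P → P F.zero ⊎ Σ (Fin n) (P ∘ F.suc)
    f (F.zero , p) = inj₁ p
    f (F.suc i , p) = inj₂ (i , p)
    g : P F.zero ⊎ Σ (Fin n) (P ∘ F.suc) → Σ (Fin (suc n)) P
    g (inj₁ p) = F.zero , p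
    g (inj₂ (i , p)) = F.suc i , p
    gf : ∀ x → g (f x) ≡ x
    gf (F.zero , p) = refl
    gf (F.suc i , p) = refl

  -- In a sequential composition the continuation, and with it the set of its states, depends on the
  -- exit taken by the first fragment; hence dependent sums.
  fin-Σ : ∀ {A} (P : A → Set) → Finite A → (∀ a → Finite (P a)) → Finite (Σ A P)
  fin-Σ {A} P F G = retract (fin-ΣFin (size F) (P ∘ from F) (G ∘ from F)) f g gf
    where
    f : Σ A P → Σ (Fin (size F)) (P ∘ from F)
    f (a , p) = to F a , subst P (sym (from-to F a)) p
    g : Σ (Fin (size F)) (P ∘ from F) → Σ A P
    g (i , p) = from F i , p
    transport : ∀ {a b} (e : b ≡ a) (p : P a) → (b , subst P (sym e) p) ≡ (a , p)
    transport refl p = refl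
    gf : ∀ x → g (f x) ≡ x
    gf (a , p) = transport (from-to F a) p

-- Turing machine fragments

Tape : ℕ → Set
Tape g = List (Sym g) × List (Sym g)

hd : ∀ {g} → List (Sym g) → Sym g
hd [] = blank
hd (s ∷ _) = s

tl : {A : Set} → List A → List A
tl [] = []
tl (_ ∷ r) = r

move : ∀ {g} → Sym g → Move → Tape g → Tape g
move w moveL ([] , r) = [] , blank ∷ w ∷ tl r
move w moveL (s ∷ l , r) = l , s ∷ w ∷ tl r
move w moveR (l , r) = w ∷ l , tl r
move w stay (l , r) = l , w ∷ tl r

-- The functions local to `step` reduce only when the shapes of both tape halves and the move are
-- known, which forces the exhaustive split; `move` restates their common effect outside `step`.
step-running : ∀ M q l r {q′ w m} → halting M q ≡ false → δ M q (hd r) ≡ (q′ , w , m) →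
  step M (cfg q l r) ≡ cfg q′ (proj₁ (move w m (l , r))) (proj₂ (move w m (l , r)))
step-running M q [] [] {m = moveL} h e rewrite h | e = refl
step-running M q [] [] {m = moveR} h e rewrite h | e = refl
step-running M q [] [] {m = stay} h e rewrite h | e = refl
step-running M q (x ∷ l) [] {m = moveL} h e rewrite h | e = refl
step-running M q (x ∷ l) [] {m = moveR} h e rewrite h | e = refl
step-running M q (x ∷ l) [] {m = stay} h e rewrite h | e = refl
step-running M q [] (y ∷ r) {m = moveL} h e rewrite h | e = refl
step-running M q [] (y ∷ r) {m = moveR} h e rewrite h | e = refl
step-running M q [] (y ∷ r) {m = stay} h e rewrite h | e = refl
step-running M q (x ∷ l) (y ∷ r) {m = moveL} h e rewrite h | e = refl
step-running M q (x ∷ l) (y ∷ r) {m = moveR} h e rewrite h | e = refl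
step-running M q (x ∷ l) (y ∷ r) {m = stay} h e rewrite h | e = refl

step-halted : ∀ M c → halting M (state c) ≡ true → step M c ≡ c
step-halted M (cfg q l r) h rewrite h = refl

run-halted : ∀ M t c → halting M (state c) ≡ true → run M t c ≡ c
run-halted M zero c h = refl
run-halted M (suc t) c h rewrite step-halted M c h = run-halted M t c h

run-+ : ∀ M s t c → run M (s + t) c ≡ run M t (run M s c)
run-+ M zero t c = refl
run-+ M (suc s) t c = run-+ M s t (step M c)

-- A fragment is a machine that leaves through one of the exits in E.
record Frag (g : ℕ) (E : Set) : Set₁ where
  field
    Q     : Set
    fin   : Finite Q
    entry : Q
    next  : Q → Sym g → (Q ⊎ E) × Sym g × Move

open Frag

data Run {g E} (P : Frag g E) : Q P → Tape g → ℕ → E → Tape g → Set where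
  exit : ∀ {q tp e w m} → next P q (hd (proj₂ tp)) ≡ (inj₂ e , w , m) →
    Run P q tp 1 e (move w m tp)
  cont : ∀ {q tp n e q′ w m tp′} → next P q (hd (proj₂ tp)) ≡ (inj₁ q′ , w , m) →
    Run P q′ (move w m tp) n e tp′ → Run P q tp (suc n) e tp′

retF : ∀ {g E} → E → Frag g E
Q (retF e) = ⊤
fin (retF e) = fin-⊤
entry (retF e) = tt
next (retF e) _ s = inj₂ e , s , stay

module _ {g} {E E′ : Set} (P : Frag g E) (finE : Finite E) (k : E → Frag g E′) where

  BindQ : Set
  BindQ = Q P ⊎ Σ E (λ e → Q (k e))

  bind₁ : (Q P ⊎ E) × Sym g × Move → (BindQ ⊎ E′) × Sym g × Move
  bind₁ (inj₁ q , w , m) = inj₁ (inj₁ q) , w , m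
  bind₁ (inj₂ e , w , m) = inj₁ (inj₂ (e , entry (k e))) , w , m

  bind₂ : ∀ e → (Q (k e) ⊎ E′) × Sym g × Move → (BindQ ⊎ E′) × Sym g × Move
  bind₂ e (inj₁ q , w , m) = inj₁ (inj₂ (e , q)) , w , m
  bind₂ e (inj₂ e′ , w , m) = inj₂ e′ , w , m

  bindF : Frag g E′
  Q bindF = BindQ
  fin bindF = fin-⊎ (fin P) (fin-Σ _ finE (fin ∘ k))
  entry bindF = inj₁ (entry P)
  next bindF (inj₁ q) s = bind₁ (next P q s)
  next bindF (inj₂ (e , q)) s = bind₂ e (next (k e) q s)

  run-bind₂ : ∀ {e q tp n e′ tp′} → Run (k e) q tp n e′ tp′ → Run bindF (inj₂ (e , q)) tp n e′ tp′
  run-bind₂ (exit eq) = exit (cong (bind₂ _) eq)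
  run-bind₂ (cont eq r) = cont (cong (bind₂ _) eq) (run-bind₂ r)

  -- The exiting transition of `P` is redirected to the entry of `k e`, so the transfer of control
  -- takes no step of its own and the times add up exactly.
  run-bind : ∀ {q tp n e tp′ m e′ tp″} → Run P q tp n e tp′ →
    Run (k e) (entry (k e)) tp′ m e′ tp″ → Run bindF (inj₁ q) tp (n + m) e′ tp″
  run-bind (exit eq) r₂ = cont (cong bind₁ eq) (run-bind₂ r₂)
  run-bind (cont eq r₁) r₂ = cont (cong bind₁ eq) (run-bind r₁ r₂)

module _ {g} (P : Frag g Bool) where

  loop₁ : (Q P ⊎ Bool) × Sym g × Move → (Q P ⊎ ⊤) × Sym g × Move
  loop₁ (inj₁ q , w , m) = inj₁ q , w , m
  loop₁ (inj₂ true , w , m) = inj₁ (entry P) , w , m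
  loop₁ (inj₂ false , w , m) = inj₂ tt , w , m

  loopF : Frag g ⊤
  Q loopF = Q P
  fin loopF = fin P
  entry loopF = entry P
  next loopF q s = loop₁ (next P q s)

  run-loop-exit : ∀ {q tp n tp′} → Run P q tp n false tp′ → Run loopF q tp n tt tp′
  run-loop-exit (exit eq) = exit (cong loop₁ eq)
  run-loop-exit (cont eq r) = cont (cong loop₁ eq) (run-loop-exit r)

  run-loop-again : ∀ {q tp n tp′ m tp″} → Run P q tp n true tp′ →
    Run loopF (entry P) tp′ m tt tp″ → Run loopF q tp (n + m) tt tp″
  run-loop-again (exit eq) r₂ = cont (cong loop₁ eq) r₂
  run-loop-again (cont eq r₁) r₂ = cont (cong loop₁ eq) (run-loop-again r₁ r₂)

module _ {g} (P : Frag g ⊤) where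

  private
    F⊥ = fin-Maybe (fin P)

    tm-halting : Maybe (Q P) → Bool
    tm-halting nothing = true
    tm-halting (just _) = false

    tm-out : (Q P ⊎ ⊤) × Sym g × Move → Fin (size F⊥) × Sym g × Move
    tm-out (inj₁ q , w , m) = to F⊥ (just q) , w , m
    tm-out (inj₂ _ , w , m) = to F⊥ nothing , w , m

    tm-next : Maybe (Q P) → Sym g → Fin (size F⊥) × Sym g × Move
    tm-next nothing s = to F⊥ nothing , s , stay
    tm-next (just q) s = tm-out (next P q s)

  -- The additional state `nothing` is the halting one. It is entered by the exiting transition
  -- itself, so the time of a `Run` is preserved.
  toTM : TM
  nQ toTM = size F⊥
  nΓ toTM = g
  start toTM = to F⊥ (just (entry P))
  halting toTM i = tm-halting (from F⊥ i)
  δ toTM i s = tm-next (from F⊥ i) s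

  toTM-run : ∀ {q tp n tp′} → Run P q tp n tt tp′ →
    Σ (Fin (nQ toTM)) λ h → halting toTM h ≡ true ×
      run toTM n (cfg (to F⊥ (just q)) (proj₁ tp) (proj₂ tp)) ≡ cfg h (proj₁ tp′) (proj₂ tp′)
  toTM-run {q} {l , r} (exit eq) =
    to F⊥ nothing , cong tm-halting (from-to F⊥ nothing) ,
    step-running toTM (to F⊥ (just q)) l r (cong tm-halting (from-to F⊥ (just q)))
      (trans (cong (λ z → tm-next z (hd r)) (from-to F⊥ (just q))) (cong tm-out eq))
  toTM-run {q} {l , r} (cont {n = n} eq rn) with toTM-run rn
  ... | h , hh , e = h , hh , trans (cong (run toTM n) (step-running toTM (to F⊥ (just q)) l r
      (cong tm-halting (from-to F⊥ (just q)))
      (trans (cong (λ z → tm-next z (hd r)) (from-to F⊥ (just q))) (cong tm-out eq)))) e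

-- Tree-encoded data

data D : Set where
  nil : D
  _·_ : D → D → D

sz : D → ℕ
sz nil = 1
sz (x · y) = suc (sz x + sz y)

data Ty : Set where
  nat bool : Ty
  list     : Ty → Ty
  _⊠_      : Ty → Ty → Ty

infixr 6 _⊠_

⟦_⟧ : Ty → Set
⟦ nat ⟧ = ℕ
⟦ bool ⟧ = Bool
⟦ list a ⟧ = List ⟦ a ⟧
⟦ a ⊠ b ⟧ = ⟦ a ⟧ × ⟦ b ⟧

-- Naturals are unary: value and size agree up to a linear factor, so a loop controlled by a `nat`
-- makes at most as many rounds as the size of its input.
toD : ∀ a → ⟦ a ⟧ → D
toD nat zero = nil
toD nat (suc n) = nil · toD nat n
toD bool false = nil
toD bool true = nil · nil
toD (list a) [] = nil
toD (list a) (x ∷ xs) = toD a x · toD (list a) xs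
toD (a ⊠ b) (x , y) = toD a x · toD b y

size′ : ∀ a → ⟦ a ⟧ → ℕ
size′ a x = sz (toD a x)

iter : {A : Set} → (A → A) → ℕ → A → A
iter f zero x = x
iter f (suc n) x = iter f n (f x)

caseL : {A B C : Set} → (B → C) → ((A × List A) × B → C) → List A × B → C
caseL z s ([] , y) = z y
caseL z s (x ∷ xs , y) = s ((x , xs) , y)

caseN : {B C : Set} → (B → C) → (ℕ × B → C) → ℕ × B → C
caseN z s (zero , y) = z y
caseN z s (suc n , y) = s (n , y)

bits : Ty
bits = list bool

size-bits : ∀ x → length x ≤ size′ bits x
size-bits [] = z≤n
size-bits (b ∷ x) = s≤s (≤-trans (size-bits x) (m≤n+m _ (size′ bool b)))

bits-size : ∀ x → size′ bits x ≤ 4 * length x + 1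
bits-size [] = ≤-refl
bits-size (b ∷ x) = ≤-trans (s≤s (+-mono-≤ (bit b) (bits-size x))) (≤-reflexive (eq (length x)))
  where
  bit : ∀ b → size′ bool b ≤ 3
  bit false = s≤s z≤n
  bit true = ≤-refl
  eq : ∀ n → suc (3 + (4 * n + 1)) ≡ 4 * suc n + 1
  eq = solve-∀

-- The functions computed by the verifier and the reduction

1≤sz : ∀ d → 1 ≤ sz d
1≤sz nil = s≤s z≤n
1≤sz (d · e) = s≤s z≤n

size-bool : ∀ b → size′ bool b ≤ 3
size-bool false = s≤s z≤n
size-bool true = ≤-refl

size-nat : ∀ n → size′ nat n ≡ 2 * n + 1
size-nat zero = refl
size-nat (suc n) = trans (cong (2 +_) (size-nat n)) (eq n)
  where
  eq : ∀ n → 2 + (2 * n + 1) ≡ 2 * suc n + 1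
  eq = solve-∀

size-++ : ∀ a xs ys → size′ (list a) (xs ++ ys) ≤ size′ (list a) ys + size′ (list a) xs
size-++ a [] ys = m≤m+n _ 1
size-++ a (x ∷ xs) ys = ≤-trans (s≤s (+-monoʳ-≤ (size′ a x) (size-++ a xs ys)))
  (≤-reflexive (eq (size′ a x) (size′ (list a) ys) (size′ (list a) xs)))
  where
  eq : ∀ x ys xs → suc (x + (ys + xs)) ≡ ys + suc (x + xs)
  eq = solve-∀

foldl-const : ∀ {A B : Set} (s : A → A) (xs : List B) y → foldl (λ y _ → s y) y xs ≡ iter s (length xs) y
foldl-const s [] y = refl
foldl-const s (x ∷ xs) y = foldl-const s xs (s y)

countStep : ℕ × List ℕ → ℕ × List ℕ
countStep (i , l) = suc i , i ∷ l

countStep-iter : ∀ n i → iter countStep n (i , downFrom i) ≡ (n + i , downFrom (n + i))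
countStep-iter zero i = refl
countStep-iter (suc n) i = trans (countStep-iter n (suc i)) (cong (λ k → k , downFrom k) (+-suc n i))

sumTo : (ℕ → ℕ) → ℕ → ℕ
sumTo f zero = 0
sumTo f (suc n) = f n + sumTo f n

-- A left fold, because that is the form of recursion realised by `pt-fold`. The order of the
-- results is reversed, but the arguments on clauses and literals use membership only.
gather : {A B : Set} → (A → List B) → List A → List B
gather h xs = foldl (λ acc x → h x ++ acc) [] xs

-- `downFrom n` starts with the largest index, so consing along it leaves the value at 0 in front.
tabulateDown : {A : Set} → (ℕ → A) → ℕ → List A
tabulateDown f n = foldl (λ acc i → f i ∷ acc) [] (downFrom n)

isZero : ℕ → Bool
isZero zero = true
isZero (suc _) = false

leq : ℕ → ℕ → Bool
leq m n = isZero (m ∸ n)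

headBit : List Bool → Bool
headBit [] = false
headBit (b ∷ _) = b

eqBool : Bool → Bool → Bool
eqBool a b = if a then b else not b

null : {A : Set} → List A → Bool
null [] = true
null (_ ∷ _) = false

eqStep : Bool × List Bool → Bool → Bool × List Bool
eqStep (ok , []) x = false , []
eqStep (ok , y ∷ ys) x = (if ok then eqBool x y else false) , ys

eqBits : List Bool → List Bool → Bool
eqBits xs ys = (λ s → if proj₁ s then null (proj₂ s) else false) (foldl eqStep (true , ys) xs)

memb : List Bool → List (List Bool) → Bool
memb x l = any (eqBits x) l

-- Counts units in pairs: the completed pairs and a flag for an unpaired unit. Counting up to a
-- unary number therefore yields its half and its parity together.
halfStep : ℕ × Bool → ℕ × Bool
halfStep (h , o) = if o then (suc h , false) else (h , true)

halfOdd : ℕ → ℕ × Bool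
halfOdd n = iter halfStep n (0 , false)

binStep : ℕ × List Bool → ℕ × List Bool
binStep (zero , acc) = zero , acc
binStep (suc n , acc) = proj₁ (halfOdd (suc n)) , proj₂ (halfOdd (suc n)) ∷ acc

-- `n` rounds are at least as many as there are binary digits, and `binStep` idles once the quotient
-- is 0.
fastBin : ℕ → List Bool
fastBin n = proj₂ (iter binStep n (n , []))

-- Splits a concatenation of words, each doubled and followed by 10; the list of
-- words and the words themselves come out reversed.
PState : Set
PState = (List Bool × List Bool) × List (List Bool)

parseStep : PState → Bool → PState
parseStep (([] , cur) , out) b = (b ∷ [] , cur) , out
parseStep ((a ∷ _ , cur) , out) b =
  if (if a then not b else false) then (([] , []) , cur ∷ out) else (([] , a ∷ cur) , out)

parse : List Bool → List (List Bool)
parse y = proj₂ (foldl parseStep (([] , []) , []) y)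

triangle tetrahedral : ℕ → ℕ
triangle = sumTo id
tetrahedral = sumTo triangle

-- By Pascal's rule the binomial coefficients over 2 and 3 are iterated sums of the identity, and
-- these are computed by folds.
nd′ : ℕ → ℕ
nd′ k = (k + k) + triangle (k + k) + tetrahedral (k + k)

-- Correctness of the Boolean tests and of membership in folded lists

≡true∧ : ∀ {a b} → a ∧ b ≡ true → a ≡ true × b ≡ true
≡true∧ {true} {true} _ = refl , refl

∧≡true : ∀ {a b} → a ≡ true → b ≡ true → a ∧ b ≡ true
∧≡true refl refl = refl

any-true : ∀ {A : Set} {p : A → Bool} xs → any p xs ≡ true → Σ A λ x → x ∈ₗ xs × p x ≡ true
any-true {p = p} (x ∷ xs) e with p x in px
... | true = x , here refl , px
... | false with any-true xs e
... | y , y∈ , py = y , there y∈ , py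

true-any : ∀ {A : Set} {p : A → Bool} {x xs} → x ∈ₗ xs → p x ≡ true → any p xs ≡ true
true-any {p = p} {x} (here refl) e rewrite e = refl
true-any {p = p} {xs = y ∷ _} (there m) e with p y
... | true = refl
... | false = true-any m e

all-true : ∀ {A : Set} {p : A → Bool} xs → all p xs ≡ true → ∀ {x} → x ∈ₗ xs → p x ≡ true
all-true (y ∷ xs) e (here refl) = proj₁ (≡true∧ e)
all-true {p = p} (y ∷ xs) e (there m) = all-true xs (proj₂ (≡true∧ {p y} e)) m

true-all : ∀ {A : Set} {p : A → Bool} xs → (∀ {x} → x ∈ₗ xs → p x ≡ true) → all p xs ≡ true
true-all [] h = refl
true-all (x ∷ xs) h = ∧≡true (h (here refl)) (true-all xs (h ∘ there))

isZero-true : ∀ n → isZero n ≡ true → n ≡ 0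
isZero-true zero _ = refl

leq-true : ∀ m n → leq m n ≡ true → m ≤ n
leq-true m n e = m∸n≡0⇒m≤n (isZero-true (m ∸ n) e)

true-leq : ∀ {m n} → m ≤ n → leq m n ≡ true
true-leq h rewrite m≤n⇒m∸n≡0 h = refl

eqBool-refl : ∀ b → eqBool b b ≡ true
eqBool-refl false = refl
eqBool-refl true = refl

eqBool-true : ∀ a b → eqBool a b ≡ true → a ≡ b
eqBool-true false false _ = refl
eqBool-true true true _ = refl

eqStep-false : ∀ xs ys → proj₁ (foldl eqStep (false , ys) xs) ≡ false
eqStep-false [] ys = refl
eqStep-false (x ∷ xs) [] = eqStep-false xs []
eqStep-false (x ∷ xs) (y ∷ ys) = eqStep-false xs ys

eqBits-true : ∀ xs ys → eqBits xs ys ≡ true → xs ≡ ys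
eqBits-true [] [] _ = refl
eqBits-true (x ∷ xs) [] e rewrite eqStep-false xs [] with e
... | ()
eqBits-true (x ∷ xs) (y ∷ ys) e with eqBool x y in xy
... | true = cong₂ _∷_ (eqBool-true x y xy) (eqBits-true xs ys e)
... | false rewrite eqStep-false xs ys with e
... | ()

eqBits-refl : ∀ xs → eqBits xs xs ≡ true
eqBits-refl [] = refl
eqBits-refl (x ∷ xs) rewrite eqBool-refl x = eqBits-refl xs

memb-true : ∀ x l → memb x l ≡ true → x ∈ₗ l
memb-true x l e with any-true l e
... | y , y∈ , xy rewrite eqBits-true x y xy = y∈

true-memb : ∀ {x l} → x ∈ₗ l → memb x l ≡ true
true-memb {x} m = true-any m (eqBits-refl x)

module _ {A B : Set} (h : A → List B) where
  gather-acc : ∀ xs acc {z} → z ∈ₗ acc → z ∈ₗ foldl (λ acc x → h x ++ acc) acc xs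
  gather-acc [] acc m = m
  gather-acc (x ∷ xs) acc m = gather-acc xs _ (∈-++⁺ʳ (h x) m)

  gather-in : ∀ xs acc {x z} → x ∈ₗ xs → z ∈ₗ h x → z ∈ₗ foldl (λ acc x → h x ++ acc) acc xs
  gather-in (x ∷ xs) acc (here refl) m = gather-acc xs _ (∈-++⁺ˡ m)
  gather-in (x ∷ xs) acc (there i) m = gather-in xs _ i m

  gather-out : ∀ xs acc {z} → z ∈ₗ foldl (λ acc x → h x ++ acc) acc xs →
    (Σ A λ x → x ∈ₗ xs × z ∈ₗ h x) ⊎ z ∈ₗ acc
  gather-out [] acc m = inj₂ m
  gather-out (x ∷ xs) acc m with gather-out xs _ m
  ... | inj₁ (y , y∈ , z∈) = inj₁ (y , there y∈ , z∈)
  ... | inj₂ m′ with ∈-++⁻ (h x) m′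
  ... | inj₁ z∈ = inj₁ (x , here refl , z∈)
  ... | inj₂ z∈ = inj₂ z∈

  ∈-gather : ∀ {xs x z} → x ∈ₗ xs → z ∈ₗ h x → z ∈ₗ gather h xs
  ∈-gather {xs} = gather-in xs []

  gather-elim : ∀ {C : Set} xs {z} → z ∈ₗ gather h xs → (∀ x → x ∈ₗ xs → z ∈ₗ h x → C) → C
  gather-elim xs m k with gather-out xs [] m
  ... | inj₁ (x , x∈ , z∈) = k x x∈ z∈

  gather-∈ : ∀ xs {z} → z ∈ₗ gather h xs → Σ A λ x → x ∈ₗ xs × z ∈ₗ h x
  gather-∈ xs m = gather-elim xs m λ x x∈ z∈ → x , x∈ , z∈

bitAt-shift : ∀ (f : ℕ → Bool) n k acc → bitAt (foldl (λ acc i → f i ∷ acc) acc (downFrom n)) (n + k) ≡ bitAt acc k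
bitAt-shift f zero k acc = refl
bitAt-shift f (suc n) k acc = trans (cong (bitAt (foldl (λ acc i → f i ∷ acc) (f n ∷ acc) (downFrom n))) (sym (+-suc n k))) (bitAt-shift f n (suc k) (f n ∷ acc))

bitAt-tabulate : ∀ (f : ℕ → Bool) n acc i → i < n → bitAt (foldl (λ acc i → f i ∷ acc) acc (downFrom n)) i ≡ f i
bitAt-tabulate f (suc n) acc i i<n with m≤n⇒m<n∨m≡n (≤-pred i<n)
... | inj₁ h = bitAt-tabulate f n (f n ∷ acc) i h
... | inj₂ refl = trans (cong (bitAt (foldl (λ acc i → f i ∷ acc) (f n ∷ acc) (downFrom n))) (sym (+-identityʳ n))) (bitAt-shift f n 0 (f n ∷ acc))

length-tabulateDown : ∀ {A : Set} (f : ℕ → A) n → length (tabulateDown f n) ≡ n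
length-tabulateDown {A} f n = trans (go n []) (+-identityʳ n)
  where
  go : ∀ n acc → length (foldl (λ acc i → f i ∷ acc) acc (downFrom n)) ≡ n + length acc
  go zero acc = refl
  go (suc n) acc = trans (go n (f n ∷ acc)) (+-suc n (length acc))

-- Binary notation and parsing

bitValue : Bool → ℕ
bitValue b = if b then 1 else 0

half-value : ℕ × Bool → ℕ
half-value (h , o) = bitValue o + h * 2

halfStep-value : ∀ s → half-value (halfStep s) ≡ suc (half-value s)
halfStep-value (h , false) = refl
halfStep-value (h , true) = refl

half-value-iter : ∀ n s → half-value (iter halfStep n s) ≡ n + half-value s
half-value-iter zero s = refl
half-value-iter (suc n) s = trans (half-value-iter n (halfStep s)) (trans (cong (n +_) (halfStep-value s)) (+-suc n _))

half-value-/2 : ∀ h o → (half-value (h , o) / 2 , not (half-value (h , o) % 2 ≤ᵇ 0)) ≡ (h , o)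
half-value-/2 h false = cong₂ _,_ (m*n/n≡m h 2) (cong (λ k → not (k ≤ᵇ 0)) (m*n%n≡0 h 2))
half-value-/2 h true = cong₂ _,_ (trans (+-distrib-/-∣ʳ 1 {h * 2} {2} (divides h refl)) (m*n/n≡m h 2))
  (cong (λ k → not (k ≤ᵇ 0)) ([m+kn]%n≡m%n 1 h 2))

halfOdd-value : ∀ n → half-value (halfOdd n) ≡ n
halfOdd-value n = trans (half-value-iter n (0 , false)) (+-identityʳ n)

halfOdd-≡ : ∀ n → halfOdd n ≡ (n / 2 , not (n % 2 ≤ᵇ 0))
halfOdd-≡ n = trans (sym (half-value-/2 (proj₁ (halfOdd n)) (proj₂ (halfOdd n))))
  (cong (λ k → k / 2 , not (k % 2 ≤ᵇ 0)) (halfOdd-value n))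

halfOdd-≤ : ∀ n → proj₁ (halfOdd n) ≤ n
halfOdd-≤ n = ≤-trans (≤-trans (≤-trans (m≤m*n _ 2) (m≤n+m _ (bitValue (proj₂ (halfOdd n))))) ≤-refl) (≤-reflexive (halfOdd-value n))

fastBin-≡ : ∀ n → fastBin n ≡ bin n
fastBin-≡ n = trans (go n n []) (++-identityʳ (bin n))
  where
  stuck : ∀ f acc → iter binStep f (0 , acc) ≡ (0 , acc)
  stuck zero acc = refl
  stuck (suc f) acc = stuck f acc
  go : ∀ f n acc → proj₂ (iter binStep f (n , acc)) ≡ binAux f n ++ acc
  go zero n acc = refl
  go (suc f) zero acc = cong proj₂ (stuck f acc)
  go (suc f) (suc n) acc = trans (cong (λ s → proj₂ (iter binStep f (proj₁ s , proj₂ s ∷ acc))) (halfOdd-≡ (suc n)))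
    (trans (go f (suc n / 2) _) (sym (++-assoc (binAux f (suc n / 2)) _ acc)))

-- A left inverse of `bin`; it yields the injectivity of `rbin`.
binValue : List Bool → ℕ
binValue = foldl (λ v b → bitValue b + v * 2) 0

binValue-bin : ∀ n → binValue (bin n) ≡ n
binValue-bin n = go n n ≤-refl
  where
  go : ∀ f n → n ≤ f → binValue (binAux f n) ≡ n
  go zero zero h = refl
  go (suc f) zero h = refl
  go (suc f) (suc n) (s≤s h) = trans (foldl-++ _ 0 (binAux f (suc n / 2)) _)
    (trans (cong (λ v → bitValue (not (suc n % 2 ≤ᵇ 0)) + v * 2)
      (go f (suc n / 2) (≤-trans (≤-pred (m/n<m (suc n) 2 (s≤s (s≤s z≤n)))) h)))
    (trans (cong half-value (sym (halfOdd-≡ (suc n)))) (halfOdd-value (suc n))))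

-- `parse` delivers each word reversed, so indices of literals are compared in reversed binary
-- throughout.
rbin : ℕ → List Bool
rbin n = reverse (bin n)

rbin-injective : ∀ {m n} → rbin m ≡ rbin n → m ≡ n
rbin-injective {m} {n} e = trans (sym (binValue-bin m)) (trans (cong binValue (reverse-injective {x = bin m} {y = bin n} e)) (binValue-bin n))

-- Bits are consumed in pairs, and a pair of equal bits is never the separator 10, so a doubled word
-- goes into `cur` as a whole.
parse-double : ∀ w {cur out} rest →
  foldl parseStep (([] , cur) , out) (double w ++ rest) ≡ foldl parseStep (([] , w ʳ++ cur) , out) rest
parse-double [] rest = refl
parse-double (false ∷ w) rest = parse-double w rest
parse-double (true ∷ w) rest = parse-double w rest

parse-word : ∀ w {out} rest → foldl parseStep (([] , []) , out) ((double w ++ true ∷ false ∷ []) ++ rest)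
  ≡ foldl parseStep (([] , []) , reverse w ∷ out) rest
parse-word w rest = trans (cong (foldl parseStep _) (++-assoc (double w) _ rest)) (parse-double w _)

parse-encNats : ∀ ms → parse (encNats ms) ≡ reverse (map rbin ms)
parse-encNats ms = cong proj₂ (go ms [])
  where
  go : ∀ ms out → foldl parseStep (([] , []) , out) (encNats ms) ≡ (([] , []) , map rbin ms ʳ++ out)
  go [] out = refl
  go (m ∷ ms) out = trans (parse-word (bin m) (encNats ms)) (go ms (rbin m ∷ out))

-- The parser only ever adds to the front of its output. A word completed before the certificate
-- begins is therefore still the last entry at the end: no certificate, however malformed, can alter
-- the instance it accompanies.
parse-suffix : ∀ y s → Σ (List (List Bool)) λ more → proj₂ (foldl parseStep s y) ≡ more ++ proj₂ s
parse-suffix [] s = [] , refl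
parse-suffix (b ∷ y) (([] , cur) , out) = parse-suffix y _
parse-suffix (b ∷ y) ((a ∷ _ , cur) , out) with (if a then not b else false)
... | false = parse-suffix y _
... | true with parse-suffix y (([] , []) , cur ∷ out)
... | more , e = more ++ cur ∷ [] , trans e (sym (++-assoc more (cur ∷ []) out))

∈-downFrom : ∀ {i n} → i < n → i ∈ₗ downFrom n
∈-downFrom {n = suc n} h with m≤n⇒m<n∨m≡n (≤-pred h)
... | inj₁ i<n = there (∈-downFrom i<n)
... | inj₂ refl = here refl

downFrom-∈ : ∀ {i} n → i ∈ₗ downFrom n → i < n
downFrom-∈ (suc n) (here refl) = ≤-refl
downFrom-∈ (suc n) (there m) = ≤-trans (downFrom-∈ n m) (n≤1+n n)

-- The numbers `nd k` and the level of an instance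

C2 : ∀ m → m C 2 ≡ triangle m
C2 zero = refl
C2 (suc m) = trans (sym (nCk+nC[k+1]≡[n+1]C[k+1] m 1)) (cong₂ _+_ (nC1≡n m) (C2 m))

C3 : ∀ m → m C 3 ≡ tetrahedral m
C3 zero = refl
C3 (suc m) = trans (sym (nCk+nC[k+1]≡[n+1]C[k+1] m 2)) (cong₂ _+_ (C2 m) (C3 m))

nd-≡ : ∀ k → nd k ≡ nd′ k
nd-≡ k rewrite +-identityʳ k = cong₂ _+_ (cong₂ _+_ (nC1≡n (k + k)) (C2 (k + k))) (C3 (k + k))

sumTo-mono : ∀ f {m n} → m ≤ n → sumTo f m ≤ sumTo f n
sumTo-mono f {n = n} z≤n = z≤n
sumTo-mono f {suc m} {suc n} (s≤s h) with m≤n⇒m<n∨m≡n h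
... | inj₂ refl = ≤-refl
... | inj₁ m<n = ≤-trans (sumTo-mono f m<n) (m≤n+m _ (f n))

-- Strictness comes from the linear term alone; for the other two terms weak monotonicity of sums is
-- enough.
nd-< : ∀ {k l} → k < l → nd k < nd l
nd-< {k} {l} k<l rewrite nd-≡ k | nd-≡ l =
  +-mono-≤ (+-mono-≤ (+-mono-≤ k<l (<⇒≤ k<l)) (sumTo-mono id k+k≤)) (sumTo-mono triangle k+k≤)
  where
  k+k≤ : k + k ≤ l + l
  k+k≤ = +-mono-≤ (<⇒≤ k<l) (<⇒≤ k<l)

nd-≤ : ∀ {k l} → k ≤ l → nd k ≤ nd l
nd-≤ h with m≤n⇒m<n∨m≡n h
... | inj₁ k<l = <⇒≤ (nd-< k<l)
... | inj₂ refl = ≤-refl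

k≤nd : ∀ k → k ≤ nd k
k≤nd k rewrite nd-≡ k = ≤-trans (m≤m+n k k) (≤-trans (m≤m+n _ _) (m≤m+n _ (tetrahedral (k + k))))

nd-cancel-< : ∀ {k l} → nd k < nd l → k < l
nd-cancel-< {k} {l} h with k <? l
... | yes k<l = k<l
... | no k≮l = ⊥-elim (<⇒≱ h (nd-≤ (≮⇒≥ k≮l)))

≤ᵇ-true : ∀ {m n} → m ≤ n → (m ≤ᵇ n) ≡ true
≤ᵇ-true {m} {n} h with m ≤ᵇ n | ≤⇒≤ᵇ h
... | true | _ = refl

≤ᵇ-dec : ∀ m n → (m ≤ n × (m ≤ᵇ n) ≡ true) ⊎ (n < m × (m ≤ᵇ n) ≡ false)
≤ᵇ-dec m n with m ≤ᵇ n in e | m ≤? n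
... | true | yes h = inj₁ (h , refl)
... | true | no ¬h = ⊥-elim (¬h (≤ᵇ⇒≤ m n (subst Data.Bool.T (sym e) tt)))
... | false | yes h = case trans (sym e) (≤ᵇ-true h) of λ ()
... | false | no ¬h = inj₂ (≰⇒> ¬h , refl)

lvlAux-spec : ∀ f n → nd (lvlAux f n) ≤ n × (∀ l → lvlAux f n < l → l ≤ f → n < nd l)
lvlAux-spec zero n = z≤n , λ l l> l≤ → ⊥-elim (<⇒≱ l> l≤)
lvlAux-spec (suc f) n with ≤ᵇ-dec (nd (suc f)) n
... | inj₁ (h , e) rewrite e = h , λ l l> l≤ → ⊥-elim (<⇒≱ l> l≤)
... | inj₂ (h , e) rewrite e = proj₁ (lvlAux-spec f n) , λ l l> l≤ → above l l> (m≤n⇒m<n∨m≡n l≤)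
  where
  above : ∀ l → lvlAux f n < l → l < suc f ⊎ l ≡ suc f → n < nd l
  above l l> (inj₁ l<) = proj₂ (lvlAux-spec f n) l l> (≤-pred l<)
  above l l> (inj₂ refl) = h

level-spec : ∀ n → nd (level n) ≤ n × n < nd (suc (level n))
level-spec n with lvlAux-spec n n
... | lo , hi with suc (level n) ≤? n
... | yes h = lo , hi _ ≤-refl h
-- Here the next level lies outside the search range of `lvlAux`, but it already exceeds `n`, and
-- `nd` dominates the identity.
... | no h = lo , ≤-trans (≰⇒> h) (k≤nd (suc (level n)))

level-unique : ∀ k n → nd k ≤ n → n < nd (suc k) → level n ≡ k
level-unique k n lo hi with level-spec n
... | lo′ , hi′ = ≤-antisym (≤-pred (nd-cancel-< (≤-trans (s≤s lo′) hi))) (≤-pred (nd-cancel-< (≤-trans (s≤s lo) hi′)))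

ParseTy : Ty
ParseTy = (bits ⊠ bits) ⊠ list bits

opaque
  first-slack : ∀ g x c o → suc (suc (suc (x + 1) + c) + o) + (3 + g) ≡ suc (suc (1 + c) + o) + (4 + (g + x))
  first-slack = solve-∀

  close-slack : ∀ c o a as k → suc (3 + suc (c + o)) + (2 + (a + as) + k) ≡ suc (suc (suc (a + as) + c) + o) + (4 + k)
  close-slack = solve-∀

  next-slack : ∀ c o a as k → suc (suc (1 + suc (a + c)) + o) + (3 + as + k) ≡ suc (suc (suc (a + as) + c) + o) + (4 + k)
  next-slack = solve-∀

-- The additive growth that `pt-fold` asks for. A step mostly shifts material between components;
-- the numbers handed to `≤-by` are the slack left in each branch.
parseStep-size : ∀ g s x → size′ ParseTy (parseStep s x) ≤ size′ ParseTy s + (4 + (size′ nat g + size′ bool x))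
parseStep-size g (([] , cur) , out) x =
  ≤-by (3 + size′ nat g) (first-slack (size′ nat g) (size′ bool x) (size′ bits cur) (size′ (list bits) out))
parseStep-size g ((a ∷ as , cur) , out) x = branch (if a then not x else false)
  where
  k = size′ nat g + size′ bool x
  branch : ∀ c → size′ ParseTy (if c then (([] , []) , cur ∷ out) else (([] , a ∷ cur) , out))
    ≤ size′ ParseTy ((a ∷ as , cur) , out) + (4 + k)
  branch true = ≤-by (2 + (size′ bool a + size′ bits as) + k)
    (close-slack (size′ bits cur) (size′ (list bits) out) (size′ bool a) (size′ bits as) k)
  branch false = ≤-by (3 + size′ bits as + k)
    (next-slack (size′ bits cur) (size′ (list bits) out) (size′ bool a) (size′ bits as) k)

-- Clauses and literals

∈-members : ∀ {n} {s : Subset n} {p} → p ∈ s → toℕ p ∈ₗ members s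
∈-members {s = inside ∷ᵥ s} here = here refl
∈-members {s = inside ∷ᵥ s} (there m) = there (∈-map⁺ suc (∈-members m))
∈-members {s = outside ∷ᵥ s} (there m) = ∈-map⁺ suc (∈-members m)

members-∈ : ∀ {n} (s : Subset n) {m} → m ∈ₗ members s → Σ (Fin n) λ p → p ∈ s × toℕ p ≡ m
members-∈ (inside ∷ᵥ s) (here refl) = F.zero , here , refl
members-∈ (inside ∷ᵥ s) (there m) with ∈-map⁻ suc m
... | y , y∈ , refl with members-∈ s y∈
... | p , p∈ , refl = F.suc p , there p∈ , refl
members-∈ (outside ∷ᵥ s) m with ∈-map⁻ suc m
... | y , y∈ , refl with members-∈ s y∈
... | p , p∈ , refl = F.suc p , there p∈ , refl

literal : ∀ {k} → Fin k → Bool → Fin (k * 2)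
literal v negated = combine v (if negated then F.suc F.zero else F.zero)

toℕ-literal : ∀ {k} (v : Fin k) b → toℕ (literal v b) ≡ 2 * toℕ v + bitValue b
toℕ-literal v false = FP.toℕ-combine v F.zero
toℕ-literal v true = FP.toℕ-combine v (F.suc F.zero)

litVal-literal : ∀ {k} (σ : Vec Bool k) v b → litVal σ (literal v b) ≡ eqBool (lookup σ v) (not b)
litVal-literal {k} σ v false rewrite FP.remQuot-combine {k} {2} v F.zero with lookup σ v
... | true = refl
... | false = refl
litVal-literal {k} σ v true rewrite FP.remQuot-combine {k} {2} v (F.suc F.zero) with lookup σ v
... | true = refl
... | false = refl

literal-surjective : ∀ {k} (p : Fin (k * 2)) → Σ (Fin k) λ v → Σ Bool λ b → p ≡ literal v b
literal-surjective {k} p = go _ _ (FP.combine-remQuot {k} 2 p)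
  where
  go : ∀ v (b : Fin 2) → combine v b ≡ p → Σ (Fin k) λ v → Σ Bool λ b → p ≡ literal v b
  go v F.zero e = v , false , sym e
  go v (F.suc F.zero) e = v , true , sym e

TrueLit : ∀ {k} → Vec Bool k → ℕ → Set
TrueLit {k} σ m = Σ (Fin (k * 2)) λ p → toℕ p ≡ m × litVal σ p ≡ true

bitAt-toList : ∀ {k} (σ : Vec Bool k) v → bitAt (toList σ) (toℕ v) ≡ lookup σ v
bitAt-toList (b ∷ᵥ σ) F.zero = refl
bitAt-toList (b ∷ᵥ σ) (F.suc v) = bitAt-toList σ v

Sat : ((k : ℕ) → Fin (nd k) → Clause k) → ℕ → List Bool → Set
Sat α k w = Σ (Vec Bool k) λ σ → ∀ (i : Fin (nd k)) → bitAt w (toℕ i) ≡ true → ClauseSat {k} σ (α k i)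

-- Of the two literals of `v`, the one made true by `a` has as its polarity bit the negation of the
-- value of `v`. Checking a clause thus becomes the search for a common word of two lists.
trueLit : List Bool → ℕ → List Bool
trueLit a v = rbin (2 * v + bitValue (not (bitAt a v)))

trueLits : List Bool → List (List Bool)
trueLits a = gather (λ v → trueLit a v ∷ []) (downFrom (length a))

∈-trueLits : ∀ {k} (σ : Vec Bool k) {m} → TrueLit σ m → rbin m ∈ₗ trueLits (toList σ)
∈-trueLits {k} σ (p , refl , e) with literal-surjective {k} p
... | v , b , refl = ∈-gather (λ v → trueLit (toList σ) v ∷ []) {downFrom (length (toList σ))} {toℕ v}
  (∈-downFrom (subst (toℕ v <_) (sym (length-toList σ)) (FP.toℕ<n v))) (here (cong rbin index))
  where
  sign : ∀ a b → eqBool a (not b) ≡ true → b ≡ not a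
  sign false true _ = refl
  sign true false _ = refl
  index : toℕ (literal v b) ≡ 2 * toℕ v + bitValue (not (bitAt (toList σ) (toℕ v)))
  index = trans (toℕ-literal v b) (cong (λ c → 2 * toℕ v + bitValue c)
    (trans (sign (lookup σ v) b (trans (sym (litVal-literal σ v b)) e)) (cong not (sym (bitAt-toList σ v)))))

trueLits-∈ : ∀ {k} (σ : Vec Bool k) {m} → rbin m ∈ₗ trueLits (toList σ) → TrueLit σ m
trueLits-∈ {k} σ {m} h with gather-∈ (λ v → trueLit (toList σ) v ∷ []) (downFrom (length (toList σ))) h
... | n , n∈ , here e = literal v b , trans (toℕ-literal v b) (trans (cong₂ (λ i c → 2 * i + bitValue (not c)) toℕ-v (sym σv)) (sym (rbin-injective {m} e))) ,
  trans (litVal-literal σ v b) (eqBool′ (lookup σ v))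
  where
  n< : n < k
  n< = subst (n <_) (length-toList σ) (downFrom-∈ _ n∈)
  v = fromℕ< n<
  b = not (lookup σ v)
  toℕ-v : toℕ v ≡ n
  toℕ-v = FP.toℕ-fromℕ< n<
  σv : bitAt (toList σ) n ≡ lookup σ v
  σv = trans (cong (bitAt (toList σ)) (sym toℕ-v)) (bitAt-toList σ v)
  eqBool′ : ∀ c → eqBool c (not (not c)) ≡ true
  eqBool′ true = refl
  eqBool′ false = refl

-- Reading a 3-CNF formula as an instance of 3SATC

-- A literal of a formula is a sign (true for a negated variable) and a variable.
Holds : (ℕ → Bool) → Bool × ℕ → Set
Holds β (b , v) = β v ≡ not b

ClauseHolds : (ℕ → Bool) → List (Bool × ℕ) → Set
ClauseHolds β c = Σ (Bool × ℕ) λ l → l ∈ₗ c × Holds β l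

litIndex : Bool × ℕ → ℕ
litIndex (b , v) = 2 * v + bitValue b

∣p∪q∣≤∣p∣+∣q∣ : ∀ {n} (p q : Subset n) → ∣ p ∪ q ∣ ≤ ∣ p ∣ + ∣ q ∣
∣p∪q∣≤∣p∣+∣q∣ []ᵥ []ᵥ = z≤n
∣p∪q∣≤∣p∣+∣q∣ (outside ∷ᵥ p) (outside ∷ᵥ q) = ∣p∪q∣≤∣p∣+∣q∣ p q
∣p∪q∣≤∣p∣+∣q∣ (outside ∷ᵥ p) (inside ∷ᵥ q) = ≤-trans (s≤s (∣p∪q∣≤∣p∣+∣q∣ p q)) (≤-reflexive (sym (+-suc ∣ p ∣ ∣ q ∣)))
∣p∪q∣≤∣p∣+∣q∣ (inside ∷ᵥ p) (outside ∷ᵥ q) = s≤s (∣p∪q∣≤∣p∣+∣q∣ p q)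
∣p∪q∣≤∣p∣+∣q∣ (inside ∷ᵥ p) (inside ∷ᵥ q) = s≤s (≤-trans (∣p∪q∣≤∣p∣+∣q∣ p q) (+-monoʳ-≤ ∣ p ∣ (n≤1+n ∣ q ∣)))

module _ {k : ℕ} where

  -- As a union of singletons it merges repeated literals: its cardinality is at most the length of
  -- `c`, and positive when `c` is nonempty, so lists of one to three literals yield sets in the
  -- range of `α`.
  fromClause : (c : List (Bool × ℕ)) → All (λ l → proj₂ l < k) c → Clause k
  fromClause [] _ = Data.Fin.Subset.⊥
  fromClause ((b , v) ∷ c) (v< ∷ h) = ⁅ literal (fromℕ< v<) b ⁆ ∪ fromClause c h

  fromClause-size : ∀ c h → ∣ fromClause c h ∣ ≤ length c
  fromClause-size [] _ = ≤-reflexive (SP.∣⊥∣≡0 (k * 2))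
  fromClause-size ((b , v) ∷ c) (v< ∷ h) = ≤-trans (∣p∪q∣≤∣p∣+∣q∣ ⁅ literal (fromℕ< v<) b ⁆ (fromClause c h))
    (+-mono-≤ (≤-reflexive (SP.∣⁅x⁆∣≡1 (literal (fromℕ< v<) b))) (fromClause-size c h))

  fromClause-nonempty : ∀ c h → 1 ≤ length c → 1 ≤ ∣ fromClause c h ∣
  fromClause-nonempty ((b , v) ∷ c) (v< ∷ h) _ = ≤-trans (≤-reflexive (sym (SP.∣⁅x⁆∣≡1 (literal (fromℕ< v<) b))))
    (SP.∣p∣≤∣p∪q∣ ⁅ literal (fromℕ< v<) b ⁆ (fromClause c h))

  toℕ-literal-fromℕ< : ∀ {v} (v< : v < k) b → toℕ (literal (fromℕ< v<) b) ≡ litIndex (b , v)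
  toℕ-literal-fromℕ< v< b = trans (toℕ-literal (fromℕ< v<) b) (cong (λ i → 2 * i + bitValue b) (FP.toℕ-fromℕ< v<))

  fromClause-∋ : ∀ c h {l} → l ∈ₗ c → litIndex l ∈ₗ members (fromClause c h)
  fromClause-∋ ((b , v) ∷ c) (v< ∷ h) (here refl) = subst (_∈ₗ members (fromClause ((b , v) ∷ c) (v< ∷ h)))
    (toℕ-literal-fromℕ< v< b) (∈-members (SP.x∈p∪q⁺ (inj₁ (SP.x∈⁅x⁆ (literal (fromℕ< v<) b)))))
  fromClause-∋ ((b , v) ∷ c) (v< ∷ h) (there m) with members-∈ (fromClause c h) (fromClause-∋ c h m)
  ... | p , p∈ , e = subst (_∈ₗ members (fromClause ((b , v) ∷ c) (v< ∷ h))) e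
    (∈-members (SP.x∈p∪q⁺ {p = ⁅ literal (fromℕ< v<) b ⁆} (inj₂ p∈)))

  fromClause-∈ : ∀ c h {p} → p ∈ fromClause c h → Σ (Bool × ℕ) λ l → l ∈ₗ c × toℕ p ≡ litIndex l
  fromClause-∈ [] _ m = ⊥-elim (SP.∉⊥ m)
  fromClause-∈ ((b , v) ∷ c) (v< ∷ h) m with SP.x∈p∪q⁻ ⁅ literal (fromℕ< v<) b ⁆ (fromClause c h) m
  ... | inj₁ e = (b , v) , here refl , trans (cong toℕ (SP.x∈⁅y⁆⇒x≡y _ e)) (toℕ-literal-fromℕ< v< b)
  ... | inj₂ m′ with fromClause-∈ c h m′
  ... | l , l∈ , e = l , there l∈ , e

  Holds-litVal : ∀ (σ : Vec Bool k) {b v} → v < k → Holds (bitAt (toList σ)) (b , v) →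
    ∀ p → toℕ p ≡ litIndex (b , v) → litVal σ p ≡ true
  Holds-litVal σ {b} {v} v< e p p≡ rewrite FP.toℕ-injective (trans p≡ (sym (toℕ-literal-fromℕ< v< b))) =
    trans (litVal-literal σ (fromℕ< v<) b) (trans (cong (λ c → eqBool c (not b)) σv) (eqBool-refl (not b)))
    where
    σv : lookup σ (fromℕ< v<) ≡ not b
    σv = trans (sym (bitAt-toList σ (fromℕ< v<))) (trans (cong (bitAt (toList σ)) (FP.toℕ-fromℕ< v<)) e)

  litVal-Holds : ∀ (σ : Vec Bool k) {b v} → v < k →
    ∀ p → toℕ p ≡ litIndex (b , v) → litVal σ p ≡ true → Holds (bitAt (toList σ)) (b , v)
  litVal-Holds σ {b} {v} v< p p≡ e rewrite FP.toℕ-injective (trans p≡ (sym (toℕ-literal-fromℕ< v< b))) =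
    trans (sym (trans (sym (bitAt-toList σ (fromℕ< v<))) (cong (bitAt (toList σ)) (FP.toℕ-fromℕ< v<))))
      (eqBool-true _ _ (trans (sym (litVal-literal σ (fromℕ< v<) b)) e))

-- The tableau of a machine, in head-relative coordinates

nth : ∀ {g} → List (Sym g) → ℕ → Sym g
nth [] _ = blank
nth (s ∷ _) zero = s
nth (_ ∷ l) (suc i) = nth l i

nth-tl : ∀ {g} (l : List (Sym g)) i → nth (tl l) i ≡ nth l (suc i)
nth-tl [] i = refl
nth-tl (_ ∷ l) i = refl

hd-nth : ∀ {g} (l : List (Sym g)) → hd l ≡ nth l 0
hd-nth [] = refl
hd-nth (_ ∷ l) = refl

-- (false , n) is the fixed position n; (true , n) is n + i, relative to the index i
-- at which a clause schema is instantiated.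
Pos : Set
Pos = Bool × ℕ

posAt : Pos → ℕ → ℕ
posAt (rel , n) i = if rel then n + i else n

data Side : Set where
  leftOf rightOf : Side

-- The target positions 0, 1 and 2 + i cover all tape positions.
data Target : Set where
  at0 at1 at2+ : Target

targetPos : Target → Pos
targetPos at0 = false , 0
targetPos at1 = false , 1
targetPos at2+ = true , 2

-- The bound on `k` keeps the index of the schema within the range over which schemata are
-- instantiated.
target : ∀ i → Σ Target λ p → Σ ℕ λ k → posAt (targetPos p) k ≡ i × k ≤ i
target zero = at0 , 0 , refl , z≤n
target (suc zero) = at1 , 0 , refl , z≤n
target (suc (suc i)) = at2+ , i , refl , ≤-trans (n≤1+n i) (n≤1+n (suc i))

nth-input : ∀ {g} x y i → i < length x → nth {g} (map encBit (x ++ y)) i ≡ encBit (bitAt x i)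
nth-input (b ∷ x) y zero h = refl
nth-input (b ∷ x) y (suc i) (s≤s h) = nth-input x y i h

TLit : Set
TLit = Bool × ℕ × Pos × ℕ

module Tableau (V : TM) where

  Γ : Set
  Γ = Sym (nΓ V)

  cellAt : Config V → Side → ℕ → Γ
  cellAt c leftOf i = nth (left c) i
  cellAt c rightOf i = nth (right c) i

  data Source : Set where
    const : Γ → Source
    cell  : Side → Pos → Source

  shift unshift : Target → Pos
  shift at0 = false , 1
  shift at1 = false , 2
  shift at2+ = true , 3
  unshift at0 = false , 0
  unshift at1 = false , 0
  unshift at2+ = true , 1

  -- A left move is what singles out two positions: afterwards the right half begins with the former
  -- nearest left cell and the written symbol, and is a uniform shift only from position 2 on.
  moveSource : Γ → Move → Side → Target → Source
  moveSource w stay leftOf p = cell leftOf (targetPos p)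
  moveSource w stay rightOf at0 = const w
  moveSource w stay rightOf at1 = cell rightOf (false , 1)
  moveSource w stay rightOf at2+ = cell rightOf (true , 2)
  moveSource w moveR leftOf at0 = const w
  moveSource w moveR leftOf at1 = cell leftOf (unshift at1)
  moveSource w moveR leftOf at2+ = cell leftOf (unshift at2+)
  moveSource w moveR rightOf p = cell rightOf (shift p)
  moveSource w moveL leftOf p = cell leftOf (shift p)
  moveSource w moveL rightOf at0 = cell leftOf (false , 0)
  moveSource w moveL rightOf at1 = const w
  moveSource w moveL rightOf at2+ = cell rightOf (unshift at2+)

  -- Where the symbol at a position comes from in a step from state q reading a.
  source : Fin (nQ V) → Γ → Side → Target → Source
  source q a s p = if halting V q then cell s (targetPos p)
    else moveSource (proj₁ (proj₂ (δ V q a))) (proj₂ (proj₂ (δ V q a))) s p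

  stateAfter : Fin (nQ V) → Γ → Fin (nQ V)
  stateAfter q a = if halting V q then q else proj₁ (δ V q a)

  sourceVal : Config V → Source → ℕ → Γ
  sourceVal c (const w) i = w
  sourceVal c (cell s p) i = cellAt c s (posAt p i)

  moveSource-correct : ∀ q q′ w m l r s p i →
    cellAt (cfg q′ (proj₁ (move w m (l , r))) (proj₂ (move w m (l , r)))) s (posAt (targetPos p) i)
      ≡ sourceVal (cfg q l r) (moveSource w m s p) i
  moveSource-correct q q′ w stay l r leftOf p i = refl
  moveSource-correct q q′ w stay l r rightOf at0 i = refl
  moveSource-correct q q′ w stay l r rightOf at1 i = nth-tl r 0
  moveSource-correct q q′ w stay l r rightOf at2+ i = nth-tl r (suc i)
  moveSource-correct q q′ w moveR l r leftOf at0 i = refl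
  moveSource-correct q q′ w moveR l r leftOf at1 i = refl
  moveSource-correct q q′ w moveR l r leftOf at2+ i = refl
  moveSource-correct q q′ w moveR l r rightOf at0 i = nth-tl r 0
  moveSource-correct q q′ w moveR l r rightOf at1 i = nth-tl r 1
  moveSource-correct q q′ w moveR l r rightOf at2+ i = nth-tl r (suc (suc i))
  moveSource-correct q q′ w moveL [] r leftOf p i = refl
  moveSource-correct q q′ w moveL (_ ∷ l) r leftOf at0 i = refl
  moveSource-correct q q′ w moveL (_ ∷ l) r leftOf at1 i = refl
  moveSource-correct q q′ w moveL (_ ∷ l) r leftOf at2+ i = refl
  moveSource-correct q q′ w moveL [] r rightOf at0 i = refl
  moveSource-correct q q′ w moveL [] r rightOf at1 i = refl
  moveSource-correct q q′ w moveL [] r rightOf at2+ i = nth-tl r i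
  moveSource-correct q q′ w moveL (_ ∷ l) r rightOf at0 i = refl
  moveSource-correct q q′ w moveL (_ ∷ l) r rightOf at1 i = refl
  moveSource-correct q q′ w moveL (_ ∷ l) r rightOf at2+ i = nth-tl r i

  scanned : Config V → Γ
  scanned c = hd (right c)

  source-correct : ∀ c s p i → cellAt (step V c) s (posAt (targetPos p) i)
    ≡ sourceVal c (source (state c) (scanned c) s p) i
  source-correct (cfg q l r) s p i = by-halting (halting V q) refl
    where
    by-halting : ∀ b → halting V q ≡ b → cellAt (step V (cfg q l r)) s (posAt (targetPos p) i)
      ≡ sourceVal (cfg q l r) (source q (hd r) s p) i
    by-halting true h = trans (cong (λ c → cellAt c s (posAt (targetPos p) i)) (step-halted V (cfg q l r) h))
      (cong (λ b → sourceVal (cfg q l r) (if b then cell s (targetPos p) else moveSource (proj₁ (proj₂ (δ V q (hd r)))) (proj₂ (proj₂ (δ V q (hd r)))) s p) i) (sym h))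
    by-halting false h = trans (cong (λ c → cellAt c s (posAt (targetPos p) i)) (step-running V q l r h refl))
      (trans (moveSource-correct q (proj₁ (δ V q (hd r))) (proj₁ (proj₂ (δ V q (hd r)))) (proj₂ (proj₂ (δ V q (hd r)))) l r s p i)
        (cong (λ b → sourceVal (cfg q l r) (if b then cell s (targetPos p) else moveSource (proj₁ (proj₂ (δ V q (hd r)))) (proj₂ (proj₂ (δ V q (hd r)))) s p) i) (sym h)))

  stateAfter-correct : ∀ c → state (step V c) ≡ stateAfter (state c) (scanned c)
  stateAfter-correct (cfg q l r) = by-halting (halting V q) refl
    where
    by-halting : ∀ b → halting V q ≡ b → state (step V (cfg q l r)) ≡ stateAfter q (hd r)
    by-halting true h = trans (cong state (step-halted V (cfg q l r) h)) (cong (λ b → if b then q else _) (sym h))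
    by-halting false h = trans (cong state (step-running V q l r h refl)) (cong (λ b → if b then q else _) (sym h))

  -- Information travels at most one cell outwards per step back in time. This makes the triangle of
  -- cells with `i + t ≤ T` closed under taking sources.
  source-near : ∀ q a s p {s′ p′} i → source q a s p ≡ cell s′ p′ → posAt p′ i ≤ suc (posAt (targetPos p) i)
  source-near q a s p i e with halting V q | proj₁ (proj₂ (δ V q a)) | proj₂ (proj₂ (δ V q a))
  source-near q a s p i refl | true | w | m = n≤1+n _
  source-near q a leftOf p i refl | false | w | stay = n≤1+n _
  source-near q a rightOf at1 i refl | false | w | stay = n≤1+n _
  source-near q a rightOf at2+ i refl | false | w | stay = n≤1+n _
  source-near q a leftOf at1 i refl | false | w | moveR = z≤n
  source-near q a leftOf at2+ i refl | false | w | moveR = ≤-trans (n≤1+n _) (n≤1+n _)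
  source-near q a rightOf at0 i refl | false | w | moveR = ≤-refl
  source-near q a rightOf at1 i refl | false | w | moveR = ≤-refl
  source-near q a rightOf at2+ i refl | false | w | moveR = ≤-refl
  source-near q a leftOf at0 i refl | false | w | moveL = ≤-refl
  source-near q a leftOf at1 i refl | false | w | moveL = ≤-refl
  source-near q a leftOf at2+ i refl | false | w | moveL = ≤-refl
  source-near q a rightOf at0 i refl | false | w | moveL = z≤n
  source-near q a rightOf at2+ i refl | false | w | moveL = ≤-trans (n≤1+n _) (n≤1+n _)

  -- `aRead` stands for the conjunction of a state and a scanned symbol. With it a copying clause
  -- has two premises and one conclusion, hence three literals.
  data Atom : Set where
    aCell  : Side → Γ → Atom
    aState : Fin (nQ V) → Atom
    aRead  : Fin (nQ V) → Γ → Atom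

  fin-Atom : Finite Atom
  fin-Atom = retract (fin-⊎ (fin-× (fin-Fin 2) (fin-Fin (3 + nΓ V))) (fin-⊎ (fin-Fin (nQ V)) (fin-× (fin-Fin (nQ V)) (fin-Fin (3 + nΓ V)))))
    f h hf
    where
    f : Atom → (Fin 2 × Γ) ⊎ (Fin (nQ V) ⊎ (Fin (nQ V) × Γ))
    f (aCell leftOf a) = inj₁ (F.zero , a)
    f (aCell rightOf a) = inj₁ (F.suc F.zero , a)
    f (aState q) = inj₂ (inj₁ q)
    f (aRead q a) = inj₂ (inj₂ (q , a))
    h : (Fin 2 × Γ) ⊎ (Fin (nQ V) ⊎ (Fin (nQ V) × Γ)) → Atom
    h (inj₁ (F.zero , a)) = aCell leftOf a
    h (inj₁ (F.suc _ , a)) = aCell rightOf a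
    h (inj₂ (inj₁ q)) = aState q
    h (inj₂ (inj₂ (q , a))) = aRead q a
    hf : ∀ z → h (f z) ≡ z
    hf (aCell leftOf a) = refl
    hf (aCell rightOf a) = refl
    hf (aState q) = refl
    hf (aRead q a) = refl

  zn : ℕ
  zn = size fin-Atom

  zc : Atom → ℕ
  zc z = toℕ (to fin-Atom z)

  -- The number of a nested `combine` of time, position and atom; it is decoded by `remQuot`.
  vr : ℕ → ℕ → ℕ → ℕ → ℕ
  vr N t i z = zn * (N * t + i) + z

  Lit : Set
  Lit = Bool × ℕ

  pos neg : ℕ → ℕ → ℕ → Atom → Lit
  pos N t i z = false , vr N t i (zc z)
  neg N t i z = true , vr N t i (zc z)

  accepting : Γ
  accepting = encBit true

  -- T bounds the number of steps; the input is px followed by at most W further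
  -- bits; positions and times are less than N.
  module Formula (T W : ℕ) (px : List Bool) where

    N a : ℕ
    -- The largest position mentioned is `3 + T`, the source next to the target `2 + T`; the largest
    -- time is `suc T`.
    N = 4 + T
    a = length px

    P n : ℕ → ℕ → Atom → Lit
    P = pos N
    n = neg N

    -- This relation separates logic from computation: soundness and completeness argue about it,
    -- and the computed list `clauses` is shown to have the same members. The input is fixed below
    -- `a`; from `a` up to `a + W` a cell is a bit or blank, with blanks spreading to the right;
    -- from `a + W` on all is blank.
    data IsClause : List Lit → Set where
      reads   : ∀ {t} → t ≤ T → ∀ q s → IsClause (n t 0 (aState q) ∷ n t 0 (aCell rightOf s) ∷ P t 0 (aRead q s) ∷ [])
      states  : ∀ {t} → t ≤ T → ∀ q s → IsClause (n t 0 (aRead q s) ∷ P (suc t) 0 (aState (stateAfter q s)) ∷ [])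
      writes  : ∀ {t i} → t ≤ T → i ≤ T → ∀ q s d p {w} → source q s d p ≡ const w →
        IsClause (n t 0 (aRead q s) ∷ P (suc t) (posAt (targetPos p) i) (aCell d w) ∷ [])
      copies  : ∀ {t i} → t ≤ T → i ≤ T → ∀ q s d p {d′ p′} → source q s d p ≡ cell d′ p′ → ∀ w →
        IsClause (n t 0 (aRead q s) ∷ n t (posAt p′ i) (aCell d′ w) ∷ P (suc t) (posAt (targetPos p) i) (aCell d w) ∷ [])
      starts  : IsClause (P 0 0 (aState (start V)) ∷ [])
      lefts   : ∀ {i} → i ≤ T → IsClause (P 0 i (aCell leftOf blank) ∷ [])
      inputs  : ∀ {i} → i ≤ T → i < a → IsClause (P 0 i (aCell rightOf (encBit (bitAt px i))) ∷ [])
      guesses : ∀ {i} → i ≤ T → a ≤ i → i < a + W →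
        IsClause (P 0 i (aCell rightOf (encBit false)) ∷ P 0 i (aCell rightOf (encBit true)) ∷ P 0 i (aCell rightOf blank) ∷ [])
      blanks  : ∀ {i} → i ≤ T → a ≤ i → i < a + W →
        IsClause (n 0 i (aCell rightOf blank) ∷ P 0 (suc i) (aCell rightOf blank) ∷ [])
      ends    : ∀ {i} → i ≤ T → a + W ≤ i → IsClause (P 0 i (aCell rightOf blank) ∷ [])
      rejects : ∀ {s} → ¬ s ≡ accepting → IsClause (n T 0 (aCell rightOf s) ∷ [])

    index : ∀ {t i} → t < N → i < N → Atom → Fin ((N * N) * zn)
    index t< i< z = combine (combine (fromℕ< t<) (fromℕ< i<)) (to fin-Atom z)

    toℕ-index : ∀ {t i} (t< : t < N) (i< : i < N) z → toℕ (index t< i< z) ≡ vr N t i (zc z)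
    toℕ-index t< i< z = trans (FP.toℕ-combine _ (to fin-Atom z)) (cong (λ k → zn * k + zc z)
      (trans (FP.toℕ-combine (fromℕ< t<) (fromℕ< i<)) (cong₂ (λ t i → N * t + i) (FP.toℕ-fromℕ< t<) (FP.toℕ-fromℕ< i<))))

    0<N : 0 < N
    0<N = s≤s z≤n

    ≤T⇒<N : ∀ {t} → t ≤ T → t < N
    ≤T⇒<N h = s≤s (≤-trans h (m≤n+m T 3))

    ≤T⇒suc<N : ∀ {t} → t ≤ T → suc t < N
    ≤T⇒suc<N h = s≤s (s≤s (≤-trans h (m≤n+m T 2)))

    target<N : ∀ p {i} → i ≤ T → posAt (targetPos p) i < N
    target<N at0 h = s≤s z≤n
    target<N at1 h = s≤s (s≤s z≤n)
    target<N at2+ h = s≤s (s≤s (s≤s (≤-trans h (n≤1+n T))))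

    source<N : ∀ q s d p {d′ p′ i} → i ≤ T → source q s d p ≡ cell d′ p′ → posAt p′ i < N
    source<N q s d p {i = i} h e = ≤-trans (s≤s (source-near q s d p i e)) (bound p)
      where
      bound : ∀ p → suc (suc (posAt (targetPos p) i)) ≤ N
      bound at0 = s≤s (s≤s z≤n)
      bound at1 = s≤s (s≤s (s≤s z≤n))
      bound at2+ = s≤s (s≤s (s≤s (s≤s h)))

    vr< : ∀ {t i} → t < N → i < N → ∀ z → vr N t i (zc z) < (N * N) * zn
    vr< t< i< z = subst (_< (N * N) * zn) (toℕ-index t< i< z) (FP.toℕ<n (index t< i< z))

    IsClause-small : ∀ {c} → IsClause c → 1 ≤ length c × length c ≤ 3 × All (λ l → proj₂ l < (N * N) * zn) c
    IsClause-small (reads t≤ q s) = s≤s z≤n , ≤-refl ,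
      vr< (≤T⇒<N t≤) 0<N _ ∷ vr< (≤T⇒<N t≤) 0<N _ ∷ vr< (≤T⇒<N t≤) 0<N _ ∷ []
    IsClause-small (states t≤ q s) = s≤s z≤n , s≤s (s≤s z≤n) ,
      vr< (≤T⇒<N t≤) 0<N _ ∷ vr< (≤T⇒suc<N t≤) 0<N _ ∷ []
    IsClause-small (writes t≤ i≤ q s d p e) = s≤s z≤n , s≤s (s≤s z≤n) ,
      vr< (≤T⇒<N t≤) 0<N _ ∷ vr< (≤T⇒suc<N t≤) (target<N p i≤) _ ∷ []
    IsClause-small (copies t≤ i≤ q s d p e w) = s≤s z≤n , ≤-refl ,
      vr< (≤T⇒<N t≤) 0<N _ ∷ vr< (≤T⇒<N t≤) (source<N q s d p i≤ e) _ ∷ vr< (≤T⇒suc<N t≤) (target<N p i≤) _ ∷ []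
    IsClause-small starts = s≤s z≤n , s≤s z≤n , vr< 0<N 0<N _ ∷ []
    IsClause-small (lefts i≤) = s≤s z≤n , s≤s z≤n , vr< 0<N (≤T⇒<N i≤) _ ∷ []
    IsClause-small (inputs i≤ _) = s≤s z≤n , s≤s z≤n , vr< 0<N (≤T⇒<N i≤) _ ∷ []
    IsClause-small (guesses i≤ _ _) = s≤s z≤n , ≤-refl ,
      vr< 0<N (≤T⇒<N i≤) _ ∷ vr< 0<N (≤T⇒<N i≤) _ ∷ vr< 0<N (≤T⇒<N i≤) _ ∷ []
    IsClause-small (blanks i≤ _ _) = s≤s z≤n , s≤s (s≤s z≤n) ,
      vr< 0<N (≤T⇒<N i≤) _ ∷ vr< 0<N (≤T⇒suc<N i≤) _ ∷ []
    IsClause-small (ends i≤ _) = s≤s z≤n , s≤s z≤n , vr< 0<N (≤T⇒<N i≤) _ ∷ []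
    IsClause-small (rejects _) = s≤s z≤n , s≤s z≤n , vr< (≤T⇒<N ≤-refl) 0<N _ ∷ []

    -- A certificate extracted from a model

    module Sound (β : ℕ → Bool) (sat : ∀ {c} → IsClause c → ClauseHolds β c) where

      True : ℕ → ℕ → Atom → Set
      True t i z = β (vr N t i (zc z)) ≡ true

      absurd : ∀ {v} {A : Set} → β v ≡ true → β v ≡ false → A
      absurd p q with trans (sym p) q
      ... | ()

      unit₁ : ∀ {v} → ClauseHolds β ((false , v) ∷ []) → β v ≡ true
      unit₁ (_ , here refl , h) = h

      horn₁ : ∀ {u v} → ClauseHolds β ((true , u) ∷ (false , v) ∷ []) → β u ≡ true → β v ≡ true
      horn₁ (_ , here refl , h) p = absurd p h
      horn₁ (_ , there (here refl) , h) p = h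

      horn₂ : ∀ {u v w} → ClauseHolds β ((true , u) ∷ (true , v) ∷ (false , w) ∷ []) → β u ≡ true → β v ≡ true → β w ≡ true
      horn₂ (_ , here refl , h) p q = absurd p h
      horn₂ (_ , there (here refl) , h) p q = absurd q h
      horn₂ (_ , there (there (here refl)) , h) p q = h

      Tracks : ℕ → Config V → Set
      Tracks t c = True t 0 (aState (state c)) × (∀ d i → i + t ≤ T → True t i (aCell d (cellAt c d i)))

      tracks-step : ∀ t c → suc t ≤ T → Tracks t c → Tracks (suc t) (step V c)
      tracks-step t c t< (st , cells) = state′ , cells′
        where
        t≤ : t ≤ T
        t≤ = ≤-trans (n≤1+n t) t<
        read : True t 0 (aRead (state c) (scanned c))
        read = horn₂ (sat (reads t≤ (state c) (scanned c))) st
          (subst (λ s → True t 0 (aCell rightOf s)) (sym (hd-nth (right c))) (cells rightOf 0 t≤))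
        state′ : True (suc t) 0 (aState (state (step V c)))
        state′ = subst (λ q → True (suc t) 0 (aState q)) (sym (stateAfter-correct c)) (horn₁ (sat (states t≤ (state c) (scanned c))) read)
        at : ∀ d p i → posAt (targetPos p) i + suc t ≤ T → i ≤ T →
          True (suc t) (posAt (targetPos p) i) (aCell d (cellAt (step V c) d (posAt (targetPos p) i)))
        at d p i h i≤ rewrite source-correct c d p i with source (state c) (scanned c) d p in e
        ... | const w = horn₁ (sat (writes t≤ i≤ (state c) (scanned c) d p e)) read
        ... | cell d′ p′ = horn₂ (sat (copies t≤ i≤ (state c) (scanned c) d p e (cellAt c d′ (posAt p′ i)))) read
          (cells d′ (posAt p′ i) (≤-trans (+-monoˡ-≤ t (source-near (state c) (scanned c) d p i e))
            (≤-trans (≤-reflexive (sym (+-suc _ t))) h)))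
        cells′ : ∀ d i → i + suc t ≤ T → True (suc t) i (aCell d (cellAt (step V c) d i))
        cells′ d i h with target i
        ... | p , k , refl , k≤ = at d p k h (≤-trans k≤ (≤-trans (m≤m+n _ (suc t)) h))

      tracks-run : ∀ s t c → s + t ≤ T → Tracks t c → Tracks (s + t) (run V s c)
      tracks-run zero t c h tr = tr
      tracks-run (suc s) t c h tr = subst (λ k → Tracks k (run V s (step V c))) (+-suc s t)
        (tracks-run s (suc t) (step V c) (≤-trans (≤-reflexive (+-suc s t)) h)
          (tracks-step t c (≤-trans (s≤s (m≤n+m t s)) h) tr))

      -- Several of the three alternatives may be true at a cell. They are tried in the order blank,
      -- true, false, and the first blank ends the word; whichever is chosen is true in the model.
      witness : ℕ → ℕ → List Bool
      witness zero i = []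
      witness (suc f) i = if β (vr N 0 i (zc (aCell rightOf blank))) then []
        else β (vr N 0 i (zc (aCell rightOf (encBit true)))) ∷ witness f (suc i)

      witness-length : ∀ f i → length (witness f i) ≤ f
      witness-length zero i = z≤n
      witness-length (suc f) i with β (vr N 0 i (zc (aCell rightOf blank)))
      ... | true = z≤n
      ... | false = s≤s (witness-length f (suc i))

      -- Below `a + W` a blank is passed on by `blanks`; from there on `ends` asserts it outright.
      blank-on : ∀ k i → a ≤ i → True 0 i (aCell rightOf blank) → k + i ≤ T → True 0 (k + i) (aCell rightOf blank)
      blank-on zero i a≤ b h = b
      blank-on (suc k) i a≤ b h with k + i <? a + W
      ... | yes lt = horn₁ (sat (blanks (≤-trans (n≤1+n _) h) (≤-trans a≤ (m≤n+m i k)) lt))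
        (blank-on k i a≤ b (≤-trans (n≤1+n _) h))
      ... | no ge = unit₁ (sat (ends h (≤-trans (≮⇒≥ ge) (n≤1+n _))))

      guess-true : ∀ {u v w} → ClauseHolds β ((false , u) ∷ (false , v) ∷ (false , w) ∷ []) →
        β w ≡ false → β v ≡ false → β u ≡ true
      guess-true (_ , here refl , h) p q = h
      guess-true (_ , there (here refl) , h) p q = absurd h q
      guess-true (_ , there (there (here refl)) , h) p q = absurd h p

      -- Here `f` guessing cells remain, starting at position `i`, and `k` is the offset from `i`.
      -- Past the end of the word `nth` returns the blank, in agreement with `blank-on`.
      witness-cells : ∀ f i k → a ≤ i → i + f ≡ a + W → k + i ≤ T →
        True 0 (k + i) (aCell rightOf (nth (map encBit (witness f i)) k))
      witness-cells zero i k a≤ e h = unit₁ (sat (ends h (≤-trans (≤-reflexive (trans (sym e) (+-identityʳ i))) (m≤n+m i k))))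
      witness-cells (suc f) i k a≤ e h with β (vr N 0 i (zc (aCell rightOf blank))) in b
      ... | true = blank-on k i a≤ b h
      witness-cells (suc f) i (suc k) a≤ e h | false = subst (λ j → True 0 j (aCell rightOf (nth (map encBit (witness f (suc i))) k)))
        (+-suc k i) (witness-cells f (suc i) k (≤-trans a≤ (n≤1+n i)) (trans (sym (+-suc i f)) e) (≤-trans (≤-reflexive (+-suc k i)) h))
      witness-cells (suc f) i zero a≤ e h | false with β (vr N 0 i (zc (aCell rightOf (encBit true)))) in o
      ... | true = o
      ... | false = guess-true (sat (guesses h a≤ (≤-trans (≤-trans (≤-reflexive (+-comm 1 i)) (+-monoʳ-≤ i (s≤s z≤n))) (≤-reflexive e)))) b o

      w : List Bool
      w = witness W a

      nth-witness : ∀ x y k → nth {nΓ V} (map encBit (x ++ y)) (k + length x) ≡ nth (map encBit y) k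
      nth-witness [] y k = cong (nth (map encBit y)) (+-identityʳ k)
      nth-witness (b ∷ x) y k = trans (cong (nth (map encBit (b ∷ x ++ y))) (+-suc k (length x))) (nth-witness x y k)

      tracks-start : Tracks 0 (initial V (px ++ w))
      tracks-start = unit₁ (sat starts) , cells
        where
        cells : ∀ d i → i + 0 ≤ T → True 0 i (aCell d (cellAt (initial V (px ++ w)) d i))
        cells leftOf i h = unit₁ (sat (lefts (≤-trans (m≤m+n i 0) h)))
        cells rightOf i h with i <? a
        ... | yes lt = subst (λ s → True 0 i (aCell rightOf s)) (sym (nth-input px w i lt)) (unit₁ (sat (inputs (≤-trans (m≤m+n i 0) h) lt)))
        ... | no ge = subst (λ j → True 0 j (aCell rightOf (nth (map encBit (px ++ w)) j))) (m∸n+n≡m (≮⇒≥ ge))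
          (subst (λ s → True 0 (i ∸ a + a) (aCell rightOf s)) (sym (nth-witness px w (i ∸ a)))
            (witness-cells W a (i ∸ a) ≤-refl refl (≤-trans (≤-reflexive (m∸n+n≡m (≮⇒≥ ge))) (≤-trans (m≤m+n i 0) h))))

      -- Position 0 stays in the tracked triangle up to time `T`, so the atom of the symbol really
      -- scanned is true, whereas `rejects` forbids every symbol but the accepting one.
      ends-accepting : scanned (run V T (initial V (px ++ w))) ≡ accepting
      ends-accepting with scanned (run V T (initial V (px ++ w))) FP.≟ accepting
      ... | yes e = e
      ... | no ¬e with sat (rejects ¬e)
      ... | _ , here refl , h = absurd (subst (λ s → True T 0 (aCell rightOf s)) (sym (hd-nth (right (run V T (initial V (px ++ w))))))
        (subst (λ k → True k 0 (aCell rightOf (nth (right (run V T (initial V (px ++ w)))) 0))) (+-identityʳ T)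
          (proj₂ (tracks-run T 0 _ (≤-reflexive (+-identityʳ T)) tracks-start) rightOf 0 (≤-reflexive (+-identityʳ T))))) h

    -- The run as a model

    module Complete (w : List Bool) (w≤ : length w ≤ W)
        (ok : scanned (run V T (initial V (px ++ w))) ≡ accepting) where

      conf : ℕ → Config V
      conf t = run V t (initial V (px ++ w))

      run-suc : ∀ t c → run V (suc t) c ≡ step V (run V t c)
      run-suc zero c = refl
      run-suc (suc t) c = run-suc t (step V c)

      value : ℕ → ℕ → Atom → Bool
      value t i (aCell d s) = does (cellAt (conf t) d i FP.≟ s)
      value t i (aState q) = does (state (conf t) FP.≟ q)
      value t i (aRead q s) = does (state (conf t) FP.≟ q) ∧ does (scanned (conf t) FP.≟ s)

      does-true : {A : Set} (d : Dec A) → does d ≡ true → A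
      does-true (yes a) _ = a

      valueAt : Fin N × Fin N → Fin zn → Bool
      valueAt (t , i) z = value (toℕ t) (toℕ i) (from fin-Atom z)

      valueAt′ : Fin (N * N) × Fin zn → Bool
      valueAt′ (ti , z) = valueAt (remQuot N ti) z

      decode : Fin ((N * N) * zn) → Bool
      decode v = valueAt′ (remQuot zn v)

      -- Numbers from `(N * N) * zn` on get a default value; by `IsClause-small` they occur in no
      -- clause.
      β : ℕ → Bool
      β v with v <? (N * N) * zn
      ... | yes v< = decode (fromℕ< v<)
      ... | no _ = false

      β-vr : ∀ {t i} → t < N → i < N → ∀ z → β (vr N t i (zc z)) ≡ value t i z
      β-vr {t} {i} t< i< z with vr N t i (zc z) <? (N * N) * zn
      ... | no ¬v< = ⊥-elim (¬v< (vr< t< i< z))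
      ... | yes v< = trans (cong decode (FP.toℕ-injective (trans (FP.toℕ-fromℕ< v<) (sym (toℕ-index t< i< z))))) decode-index
        where
        decode-index : decode (index t< i< z) ≡ value t i z
        decode-index = trans (cong valueAt′ (FP.remQuot-combine (combine (fromℕ< t<) (fromℕ< i<)) (to fin-Atom z)))
          (trans (cong (λ ti → valueAt ti (to fin-Atom z)) (FP.remQuot-combine (fromℕ< t<) (fromℕ< i<)))
            (cong₂ (λ ti z → value (proj₁ ti) (proj₂ ti) z) (cong₂ _,_ (FP.toℕ-fromℕ< t<) (FP.toℕ-fromℕ< i<)) (from-to fin-Atom z)))

      holds : ∀ {t i} b → t < N → i < N → ∀ z → value t i z ≡ not b → Holds β (b , vr N t i (zc z))
      holds b t< i< z h = trans (β-vr t< i< z) h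

      read-true : ∀ {t q s} → value t 0 (aRead q s) ≡ true → state (conf t) ≡ q × scanned (conf t) ≡ s
      read-true {t} {q} {s} e with ≡true∧ {does (state (conf t) FP.≟ q)} e
      ... | e₁ , e₂ = does-true (state (conf t) FP.≟ q) e₁ , does-true (scanned (conf t) FP.≟ s) e₂

      cell-after : ∀ t q s d p i → value t 0 (aRead q s) ≡ true →
        cellAt (conf (suc t)) d (posAt (targetPos p) i) ≡ sourceVal (conf t) (source q s d p) i
      cell-after t q s d p i e with read-true {t} e
      ... | refl , refl = trans (cong (λ c → cellAt c d (posAt (targetPos p) i)) (run-suc t (initial V (px ++ w)))) (source-correct (conf t) d p i)

      nth-beyond : ∀ (y : List Bool) i → length y ≤ i → nth {nΓ V} (map encBit y) i ≡ blank
      nth-beyond [] i h = refl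
      nth-beyond (b ∷ y) (suc i) (s≤s h) = nth-beyond y i h

      nth-bit : ∀ (y : List Bool) i → nth {nΓ V} (map encBit y) i ≡ encBit false ⊎
        (nth {nΓ V} (map encBit y) i ≡ encBit true ⊎ nth {nΓ V} (map encBit y) i ≡ blank)
      nth-bit [] i = inj₂ (inj₂ refl)
      nth-bit (false ∷ y) zero = inj₁ refl
      nth-bit (true ∷ y) zero = inj₂ (inj₁ refl)
      nth-bit (b ∷ y) (suc i) = nth-bit y i

      nth-blank : ∀ (y : List Bool) i → nth {nΓ V} (map encBit y) i ≡ blank → nth {nΓ V} (map encBit y) (suc i) ≡ blank
      nth-blank [] i e = refl
      nth-blank (false ∷ y) zero ()
      nth-blank (true ∷ y) zero ()
      nth-blank (b ∷ y) (suc i) e = nth-blank y i e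

      length-input : length (px ++ w) ≤ a + W
      length-input = ≤-trans (≤-reflexive (length-++ px)) (+-monoʳ-≤ a w≤)

      satisfied : ∀ {c} → IsClause c → ClauseHolds β c
      satisfied (reads {t} t≤ q s) with value t 0 (aState q) in e₁ | value t 0 (aCell rightOf s) in e₂
      ... | false | _ = _ , here refl , holds true (≤T⇒<N t≤) 0<N (aState q) e₁
      ... | true | false = _ , there (here refl) , holds true (≤T⇒<N t≤) 0<N (aCell rightOf s) e₂
      ... | true | true = _ , there (there (here refl)) , holds false (≤T⇒<N t≤) 0<N (aRead q s)
        (∧≡true e₁ (dec-true (scanned (conf t) FP.≟ s) (trans (hd-nth (right (conf t))) (does-true (nth (right (conf t)) 0 FP.≟ s) e₂))))
      satisfied (states {t} t≤ q s) with value t 0 (aRead q s) in e₁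
      ... | false = _ , here refl , holds true (≤T⇒<N t≤) 0<N (aRead q s) e₁
      ... | true = _ , there (here refl) , holds false (≤T⇒suc<N t≤) 0<N (aState (stateAfter q s)) (dec-true (_ FP.≟ _) moved)
        where
        moved : state (conf (suc t)) ≡ stateAfter q s
        moved with read-true {t} e₁
        ... | refl , refl = trans (cong state (run-suc t (initial V (px ++ w)))) (stateAfter-correct (conf t))
      satisfied (writes {t} {i} t≤ i≤ q s d p {w = s′} e) with value t 0 (aRead q s) in e₁
      ... | false = _ , here refl , holds true (≤T⇒<N t≤) 0<N (aRead q s) e₁
      ... | true = _ , there (here refl) , holds false (≤T⇒suc<N t≤) (target<N p i≤) (aCell d s′) (dec-true (_ FP.≟ _)
        (trans (cell-after t q s d p i e₁) (cong (λ z → sourceVal (conf t) z i) e)))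
      satisfied (copies {t} {i} t≤ i≤ q s d p {d′} {p′} e s′) with value t 0 (aRead q s) in e₁ | value t (posAt p′ i) (aCell d′ s′) in e₂
      ... | false | _ = _ , here refl , holds true (≤T⇒<N t≤) 0<N (aRead q s) e₁
      ... | true | false = _ , there (here refl) , holds true (≤T⇒<N t≤) (source<N q s d p i≤ e) (aCell d′ s′) e₂
      ... | true | true = _ , there (there (here refl)) , holds false (≤T⇒suc<N t≤) (target<N p i≤) (aCell d s′) (dec-true (_ FP.≟ _)
        (trans (cell-after t q s d p i e₁) (trans (cong (λ z → sourceVal (conf t) z i) e) (does-true (_ FP.≟ _) e₂))))
      satisfied starts = _ , here refl , holds false 0<N 0<N (aState (start V)) (dec-true (start V FP.≟ start V) refl)
      satisfied (lefts {i} i≤) = _ , here refl , holds false 0<N (≤T⇒<N i≤) (aCell leftOf blank) (dec-true (cellAt (conf 0) leftOf i FP.≟ blank) refl)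
      satisfied (inputs {i} i≤ i<) = _ , here refl , holds false 0<N (≤T⇒<N i≤) (aCell rightOf (encBit (bitAt px i)))
        (dec-true (_ FP.≟ _) (nth-input px w i i<))
      satisfied (guesses {i} i≤ _ _) with nth-bit (px ++ w) i
      ... | inj₁ e = _ , here refl , holds false 0<N (≤T⇒<N i≤) (aCell rightOf (encBit false)) (dec-true (_ FP.≟ _) e)
      ... | inj₂ (inj₁ e) = _ , there (here refl) , holds false 0<N (≤T⇒<N i≤) (aCell rightOf (encBit true)) (dec-true (_ FP.≟ _) e)
      ... | inj₂ (inj₂ e) = _ , there (there (here refl)) , holds false 0<N (≤T⇒<N i≤) (aCell rightOf blank) (dec-true (_ FP.≟ _) e)
      satisfied (blanks {i} i≤ _ _) with value 0 i (aCell rightOf blank) in e₁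
      ... | false = _ , here refl , holds true 0<N (≤T⇒<N i≤) (aCell rightOf blank) e₁
      ... | true = _ , there (here refl) , holds false 0<N (≤T⇒suc<N i≤) (aCell rightOf blank)
        (dec-true (_ FP.≟ _) (nth-blank (px ++ w) i (does-true (_ FP.≟ _) e₁)))
      satisfied (ends {i} i≤ h) = _ , here refl , holds false 0<N (≤T⇒<N i≤) (aCell rightOf blank)
        (dec-true (_ FP.≟ _) (nth-beyond (px ++ w) i (≤-trans length-input h)))
      satisfied (rejects {s} ¬e) with value T 0 (aCell rightOf s) in e₁
      ... | false = _ , here refl , holds true (≤T⇒<N ≤-refl) 0<N (aCell rightOf s) e₁
      ... | true = ⊥-elim (¬e (trans (sym (does-true (_ FP.≟ _) e₁)) (trans (sym (hd-nth (right (conf T)))) ok)))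

  -- The clauses as a list

  sides : List Side
  sides = leftOf ∷ rightOf ∷ []

  ∈-sides : ∀ d → d ∈ₗ sides
  ∈-sides leftOf = here refl
  ∈-sides rightOf = there (here refl)

  targets : List Target
  targets = at0 ∷ at1 ∷ at2+ ∷ []

  ∈-targets : ∀ p → p ∈ₗ targets
  ∈-targets at0 = here refl
  ∈-targets at1 = there (here refl)
  ∈-targets at2+ = there (there (here refl))

  origin : Pos
  origin = false , 0

  -- Schemata list their literals backwards because gather reverses its argument.
  readSchema stateSchema : Fin (nQ V) → Γ → List TLit
  readSchema q s = (false , 0 , origin , zc (aRead q s)) ∷ (true , 0 , origin , zc (aCell rightOf s)) ∷ (true , 0 , origin , zc (aState q)) ∷ []
  stateSchema q s = (false , 1 , origin , zc (aState (stateAfter q s))) ∷ (true , 0 , origin , zc (aRead q s)) ∷ []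

  writeSchema : Fin (nQ V) → Γ → Side → Target → Γ → List TLit
  writeSchema q s d p w = (false , 1 , targetPos p , zc (aCell d w)) ∷ (true , 0 , origin , zc (aRead q s)) ∷ []

  copySchema : Fin (nQ V) → Γ → Side → Target → Side → Pos → Γ → List TLit
  copySchema q s d p d′ p′ w = (false , 1 , targetPos p , zc (aCell d w)) ∷ (true , 0 , p′ , zc (aCell d′ w)) ∷ (true , 0 , origin , zc (aRead q s)) ∷ []

  moveSchemata : Fin (nQ V) → Γ → Side → Target → Source → List (List TLit)
  moveSchemata q s d p (const w) = writeSchema q s d p w ∷ []
  moveSchemata q s d p (cell d′ p′) = gather (λ w → copySchema q s d p d′ p′ w ∷ []) (allFin (3 + nΓ V))

  schemataFor : Fin (nQ V) → Γ → List (List TLit)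
  schemataFor q s = readSchema q s ∷ stateSchema q s ∷ gather (λ d → gather (λ p → moveSchemata q s d p (source q s d p)) targets) sides

  -- Depends on `V` only, so the reduction carries it as a constant and merely instantiates times
  -- and positions.
  schemata : List (List TLit)
  schemata = gather (λ q → gather (schemataFor q) (allFin (3 + nΓ V))) (allFin (nQ V))

  instLit : ℕ → ℕ → ℕ → TLit → Lit
  instLit T t i (b , dt , p , z) = b , vr (4 + T) (dt + t) (posAt p i) z

  instClause : ℕ → ℕ → ℕ → List TLit → List Lit
  instClause T t i c = gather (λ l → instLit T t i l ∷ []) c

  stepClauses : ℕ → List (List Lit)
  stepClauses T = gather (λ t → gather (λ i → gather (λ c → instClause T t i c ∷ []) schemata) (downFrom (suc T))) (downFrom (suc T))

  initClause : ℕ → ℕ → List Bool → ℕ → List (List Lit)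
  initClause T W px i = (pos (4 + T) 0 i (aCell leftOf blank) ∷ []) ∷
    (if leq (suc i) (length px)
      then ((false , vr (4 + T) 0 i (if bitAt px i then zc (aCell rightOf (encBit true)) else zc (aCell rightOf (encBit false)))) ∷ []) ∷ []
      else if leq (suc i) (length px + W)
      then (pos (4 + T) 0 i (aCell rightOf (encBit false)) ∷ pos (4 + T) 0 i (aCell rightOf (encBit true)) ∷ pos (4 + T) 0 i (aCell rightOf blank) ∷ []) ∷
           (neg (4 + T) 0 i (aCell rightOf blank) ∷ pos (4 + T) 0 (suc i) (aCell rightOf blank) ∷ []) ∷ []
      else (pos (4 + T) 0 i (aCell rightOf blank) ∷ []) ∷ [])

  rejectCodes : List ℕ
  rejectCodes = gather (λ s → if does (s FP.≟ accepting) then [] else zc (aCell rightOf s) ∷ []) (allFin (3 + nΓ V))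

  endClauses : ℕ → List (List Lit)
  endClauses T = gather (λ z → ((true , vr (4 + T) T 0 z) ∷ []) ∷ []) rejectCodes

  clauses : ℕ → ℕ → List Bool → List (List Lit)
  clauses T W px = stepClauses T ++ (gather (initClause T W px) (downFrom (suc T)) ++
    ((pos (4 + T) 0 0 (aState (start V)) ∷ []) ∷ endClauses T))

  module _ (T W : ℕ) (px : List Bool) where
    open Formula T W px

    -- Codes of atoms are constants for the reduction, which therefore selects one of two codes
    -- instead of encoding a computed symbol.
    bitCode : ∀ b → (if b then zc (aCell rightOf (encBit true)) else zc (aCell rightOf (encBit false))) ≡ zc (aCell rightOf (encBit b))
    bitCode true = refl
    bitCode false = refl

    ∈-reject : ∀ {s} → ¬ s ≡ accepting → zc (aCell rightOf s) ∈ₗ (if does (s FP.≟ accepting) then [] else zc (aCell rightOf s) ∷ [])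
    ∈-reject {s} ¬e with s FP.≟ accepting
    ... | yes e = ⊥-elim (¬e e)
    ... | no _ = here refl

    reject-∈ : ∀ s {z} → z ∈ₗ (if does (s FP.≟ accepting) then [] else zc (aCell rightOf s) ∷ []) → z ≡ zc (aCell rightOf s) × ¬ s ≡ accepting
    reject-∈ s m with s FP.≟ accepting
    reject-∈ s () | yes _
    reject-∈ s (here refl) | no ¬e = refl , ¬e

    ∈-stepClauses : ∀ {t i c} → t ≤ T → i ≤ T → c ∈ₗ schemata → instClause T t i c ∈ₗ clauses T W px
    ∈-stepClauses {t} {i} {c} t≤ i≤ m = ∈-++⁺ˡ (∈-gather _ (∈-downFrom (s≤s t≤)) (∈-gather _ (∈-downFrom (s≤s i≤)) (∈-gather _ m (here refl))))

    ∈-schemata : ∀ q s {c} → c ∈ₗ schemataFor q s → c ∈ₗ schemata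
    ∈-schemata q s m = ∈-gather _ (∈-allFin q) (∈-gather (schemataFor q) (∈-allFin s) m)

    ∈-moves : ∀ q s d p {c} → c ∈ₗ moveSchemata q s d p (source q s d p) → c ∈ₗ schemata
    ∈-moves q s d p m = ∈-schemata q s (there (there (∈-gather (λ d → gather (λ p → moveSchemata q s d p (source q s d p)) targets) (∈-sides d)
      (∈-gather (λ p → moveSchemata q s d p (source q s d p)) (∈-targets p) m))))

    ∈-initClause : ∀ {i c} → i ≤ T → c ∈ₗ initClause T W px i → c ∈ₗ clauses T W px
    ∈-initClause i≤ m = ∈-++⁺ʳ (stepClauses T) (∈-++⁺ˡ (∈-gather (initClause T W px) (∈-downFrom (s≤s i≤)) m))

    ∈-last : ∀ {c} → c ∈ₗ (pos (4 + T) 0 0 (aState (start V)) ∷ []) ∷ endClauses T → c ∈ₗ clauses T W px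
    ∈-last m = ∈-++⁺ʳ (stepClauses T) (∈-++⁺ʳ (gather (initClause T W px) (downFrom (suc T))) m)

    false-leq : ∀ {m n} → n < m → leq m n ≡ false
    false-leq {m} {n} h with leq m n in e
    ... | true = ⊥-elim (<⇒≱ h (leq-true m n e))
    ... | false = refl

    IsClause⇒∈ : ∀ {c} → IsClause c → c ∈ₗ clauses T W px
    -- The positions of this schema and the next are fixed, so every index yields the same clause
    -- and 0 serves.
    IsClause⇒∈ (reads t≤ q s) = ∈-stepClauses t≤ z≤n (∈-schemata q s (here refl))
    IsClause⇒∈ (states t≤ q s) = ∈-stepClauses t≤ z≤n (∈-schemata q s (there (here refl)))
    IsClause⇒∈ (writes t≤ i≤ q s d p {w} e) = ∈-stepClauses t≤ i≤ (∈-moves q s d p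
      (subst (λ z → writeSchema q s d p w ∈ₗ moveSchemata q s d p z) (sym e) (here refl)))
    IsClause⇒∈ (copies t≤ i≤ q s d p {d′} {p′} e w) = ∈-stepClauses t≤ i≤ (∈-moves q s d p
      (subst (λ z → copySchema q s d p d′ p′ w ∈ₗ moveSchemata q s d p z) (sym e)
        (∈-gather (λ w → copySchema q s d p d′ p′ w ∷ []) (∈-allFin w) (here refl))))
    IsClause⇒∈ starts = ∈-last (here refl)
    IsClause⇒∈ (lefts i≤) = ∈-initClause i≤ (here refl)
    IsClause⇒∈ (inputs {i} i≤ i<) = ∈-initClause i≤ member
      where
      member : (pos (4 + T) 0 i (aCell rightOf (encBit (bitAt px i))) ∷ []) ∈ₗ initClause T W px i
      member rewrite true-leq i< = there (here (cong (λ z → (false , vr (4 + T) 0 i z) ∷ []) (sym (bitCode (bitAt px i)))))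
    IsClause⇒∈ (guesses {i} i≤ a≤ i<) = ∈-initClause i≤ member
      where
      member : _ ∈ₗ initClause T W px i
      member rewrite false-leq (s≤s a≤) | true-leq i< = there (here refl)
    IsClause⇒∈ (blanks {i} i≤ a≤ i<) = ∈-initClause i≤ member
      where
      member : _ ∈ₗ initClause T W px i
      member rewrite false-leq (s≤s a≤) | true-leq i< = there (there (here refl))
    IsClause⇒∈ (ends {i} i≤ h) = ∈-initClause i≤ member
      where
      member : _ ∈ₗ initClause T W px i
      member rewrite false-leq (s≤s (≤-trans (m≤m+n a W) h)) | false-leq (s≤s h) = there (here refl)
    IsClause⇒∈ (rejects {s} ¬e) = ∈-last (there (∈-gather _ (∈-gather _ (∈-allFin s) (∈-reject ¬e)) (here refl)))

    moveSchemata-IsClause : ∀ {t i} → t ≤ T → i ≤ T → ∀ q s d p z → source q s d p ≡ z → ∀ {c} → c ∈ₗ moveSchemata q s d p z → IsClause (instClause T t i c)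
    moveSchemata-IsClause t≤ i≤ q s d p (const w) e (here refl) = writes t≤ i≤ q s d p e
    moveSchemata-IsClause t≤ i≤ q s d p (cell d′ p′) e m with gather-∈ (λ w → copySchema q s d p d′ p′ w ∷ []) (allFin (3 + nΓ V)) m
    ... | w , _ , here refl = copies t≤ i≤ q s d p e w

    schemataFor-IsClause : ∀ {t i} → t ≤ T → i ≤ T → ∀ q s {c} → c ∈ₗ schemataFor q s → IsClause (instClause T t i c)
    schemataFor-IsClause t≤ i≤ q s (here refl) = reads t≤ q s
    schemataFor-IsClause t≤ i≤ q s (there (here refl)) = states t≤ q s
    schemataFor-IsClause t≤ i≤ q s (there (there m)) =
      gather-elim (λ d → gather (λ p → moveSchemata q s d p (source q s d p)) targets) sides m λ d _ m →
      gather-elim (λ p → moveSchemata q s d p (source q s d p)) targets m λ p _ m →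
      moveSchemata-IsClause t≤ i≤ q s d p (source q s d p) refl m

    schemata-IsClause : ∀ {t i} → t ≤ T → i ≤ T → ∀ {c} → c ∈ₗ schemata → IsClause (instClause T t i c)
    schemata-IsClause t≤ i≤ m =
      gather-elim (λ q → gather (schemataFor q) (allFin (3 + nΓ V))) (allFin (nQ V)) m λ q _ m →
      gather-elim (schemataFor q) (allFin (3 + nΓ V)) m λ s _ m →
      schemataFor-IsClause t≤ i≤ q s m

    leq-dec : ∀ m n → (m ≤ n × leq m n ≡ true) ⊎ (n < m × leq m n ≡ false)
    leq-dec m n with m ≤? n
    ... | yes h = inj₁ (h , true-leq h)
    ... | no h = inj₂ (≰⇒> h , false-leq (≰⇒> h))

    initClause-IsClause : ∀ {i} → i ≤ T → ∀ {c} → c ∈ₗ initClause T W px i → IsClause c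
    initClause-IsClause i≤ (here refl) = lefts i≤
    initClause-IsClause {i} i≤ {c} (there m) with leq-dec (suc i) (length px)
    ... | inj₁ (h , e) rewrite e with m
    ... | here refl rewrite bitCode (bitAt px i) = inputs i≤ h
    initClause-IsClause {i} i≤ {c} (there m) | inj₂ (h , e) rewrite e with leq-dec (suc i) (length px + W)
    ... | inj₂ (h′ , e′) rewrite e′ with m
    ... | here refl = ends i≤ (≤-pred h′)
    initClause-IsClause {i} i≤ {c} (there m) | inj₂ (h , e) | inj₁ (h′ , e′) rewrite e′ with m
    ... | here refl = guesses i≤ (≤-pred h) h′
    ... | there (here refl) = blanks i≤ (≤-pred h) h′

    stepClauses-IsClause : ∀ {c} → c ∈ₗ stepClauses T → IsClause c
    stepClauses-IsClause m =
      gather-elim (λ t → gather (λ i → gather (λ c → instClause T t i c ∷ []) schemata) (downFrom (suc T))) (downFrom (suc T)) m λ t t∈ m →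
      gather-elim (λ i → gather (λ c → instClause T t i c ∷ []) schemata) (downFrom (suc T)) m λ i i∈ m →
      gather-elim (λ c → instClause T t i c ∷ []) schemata m
        λ { c c∈ (here refl) → schemata-IsClause (≤-pred (downFrom-∈ _ t∈)) (≤-pred (downFrom-∈ _ i∈)) c∈ }

    initClauses-IsClause : ∀ {c} → c ∈ₗ gather (initClause T W px) (downFrom (suc T)) → IsClause c
    initClauses-IsClause m = gather-elim (initClause T W px) (downFrom (suc T)) m
      λ i i∈ m → initClause-IsClause (≤-pred (downFrom-∈ _ i∈)) m

    endClauses-IsClause : ∀ {c} → c ∈ₗ endClauses T → IsClause c
    endClauses-IsClause m = gather-elim (λ z → ((true , vr (4 + T) T 0 z) ∷ []) ∷ []) rejectCodes m
      λ { z z∈ (here refl) → gather-elim (λ s → if does (s FP.≟ accepting) then [] else zc (aCell rightOf s) ∷ []) (allFin (3 + nΓ V)) z∈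
        λ s _ m → reject s (reject-∈ s m) }
      where
      reject : ∀ s {z} → z ≡ zc (aCell rightOf s) × ¬ s ≡ accepting → IsClause ((true , vr (4 + T) T 0 z) ∷ [])
      reject s (refl , ¬e) = rejects ¬e

    lastClauses-IsClause : ∀ {c} → c ∈ₗ (pos (4 + T) 0 0 (aState (start V)) ∷ []) ∷ endClauses T → IsClause c
    lastClauses-IsClause (here refl) = starts
    lastClauses-IsClause (there m) = endClauses-IsClause m

    ∈⇒IsClause : ∀ {c} → c ∈ₗ clauses T W px → IsClause c
    ∈⇒IsClause m = [ stepClauses-IsClause , [ initClauses-IsClause , lastClauses-IsClause ]′
      ∘ ∈-++⁻ (gather (initClause T W px) (downFrom (suc T))) ]′ (∈-++⁻ (stepClauses T) m)

hd-decodeOut : ∀ {g} (r : List (Sym g)) → decodeOut r ≡ true ∷ [] → hd r ≡ encBit true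
hd-decodeOut [] ()
hd-decodeOut (F.zero ∷ r) ()
hd-decodeOut (F.suc F.zero ∷ r) ()
hd-decodeOut (F.suc (F.suc F.zero) ∷ r) e = refl
hd-decodeOut (F.suc (F.suc (F.suc _)) ∷ r) ()

-- The output of a verifier is known to be a single bit, so the scanned symbol alone decides
-- acceptance.
decodeOut-hd : ∀ {g} (r : List (Sym g)) {b} → decodeOut r ≡ b ∷ [] → hd r ≡ encBit true → b ≡ true
decodeOut-hd (F.suc (F.suc F.zero) ∷ r) e _ = sym (∷-injectiveˡ e)

-- Four-stack machines

module Machine (G : TM) where

  -- tO and tI serve as bits and as the tokens of serialised trees; the other
  -- tokens let two of the stacks hold the tape, and a third the state, of G.
  data Tok : Set where
    tO tI : Tok
    tSym  : Sym (nΓ G) → Tok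
    tSt   : Fin (nQ G) → Tok

  fin-Tok : Finite Tok
  fin-Tok = retract (fin-⊎ (fin-Fin 2) (fin-⊎ (fin-Fin _) (fin-Fin _))) f h hf
    where
    f : Tok → Fin 2 ⊎ (Sym (nΓ G) ⊎ Fin (nQ G))
    f tO = inj₁ F.zero
    f tI = inj₁ (F.suc F.zero)
    f (tSym s) = inj₂ (inj₁ s)
    f (tSt q) = inj₂ (inj₂ q)
    h : Fin 2 ⊎ (Sym (nΓ G) ⊎ Fin (nQ G)) → Tok
    h (inj₁ F.zero) = tO
    h (inj₁ (F.suc _)) = tI
    h (inj₂ (inj₁ s)) = tSym s
    h (inj₂ (inj₂ q)) = tSt q
    hf : ∀ x → h (f x) ≡ x
    hf tO = refl
    hf tI = refl
    hf (tSym s) = refl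
    hf (tSt q) = refl

  bitTok : Bool → Tok
  bitTok false = tO
  bitTok true = tI

  Stk : Set
  Stk = Vec (List Tok) 4

  top : List Tok → Maybe Tok
  top [] = nothing
  top (a ∷ _) = just a

  -- Tests consume the token they inspect, and `loop` also discards the token on which it exits.
  -- Branching is over all tokens and the empty stack, a finite set that becomes part of the
  -- compiled control.
  data Cmd : Set where
    skip : Cmd
    push : Fin 4 → Tok → Cmd
    _⨾_  : Cmd → Cmd → Cmd
    case : Fin 4 → (Maybe Tok → Cmd) → Cmd
    loop : Fin 4 → (Maybe Tok → Maybe Cmd) → Cmd

  infixr 5 _⨾_

  data _⊢_⇓[_]_ : Cmd → Stk → ℕ → Stk → Set where
    ⇓skip : ∀ {S} → skip ⊢ S ⇓[ 1 ] S
    ⇓push : ∀ {i a S} → push i a ⊢ S ⇓[ 1 ] (S [ i ]≔ (a ∷ lookup S i))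
    ⇓seq  : ∀ {c d S t S′ u S″} → c ⊢ S ⇓[ t ] S′ → d ⊢ S′ ⇓[ u ] S″ → (c ⨾ d) ⊢ S ⇓[ t + u ] S″
    ⇓case : ∀ {i f S t S′} → f (top (lookup S i)) ⊢ S [ i ]≔ tl (lookup S i) ⇓[ t ] S′ →
      case i f ⊢ S ⇓[ suc t ] S′
    ⇓exit : ∀ {i f S} → f (top (lookup S i)) ≡ nothing →
      loop i f ⊢ S ⇓[ 1 ] (S [ i ]≔ tl (lookup S i))
    ⇓loop : ∀ {i f S c t S′ u S″} → f (top (lookup S i)) ≡ just c →
      c ⊢ S [ i ]≔ tl (lookup S i) ⇓[ t ] S′ → loop i f ⊢ S′ ⇓[ u ] S″ →
      loop i f ⊢ S ⇓[ suc t + u ] S″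

  length-update : ∀ (S : Stk) i j xs k → length xs ≤ length (lookup S i) + k →
    length (lookup (S [ i ]≔ xs) j) ≤ length (lookup S j) + k
  length-update S i j xs k h with i FP.≟ j
  ... | yes refl rewrite lookup∘update i S xs = h
  ... | no ¬e rewrite lookup∘update′ (¬e ∘ sym) S xs = m≤m+n _ k

  length-tl : ∀ (xs : List Tok) → length (tl xs) ≤ length xs
  length-tl [] = z≤n
  length-tl (_ ∷ xs) = n≤1+n _

  length-pop : ∀ (S : Stk) i j → length (lookup (S [ i ]≔ tl (lookup S i)) j) ≤ length (lookup S j)
  length-pop S i j = ≤-trans
    (length-update S i j _ 0 (≤-trans (length-tl (lookup S i)) (m≤m+n _ 0)))
    (≤-reflexive (+-identityʳ _))

  -- Only `push` lengthens a stack, by one token and at the price of one step. This bounds both the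
  -- tape space of the simulation and the size of computed values.
  ⇓-length : ∀ {c S t S′} → c ⊢ S ⇓[ t ] S′ → ∀ j → length (lookup S′ j) ≤ length (lookup S j) + t
  ⇓-length ⇓skip j = m≤m+n _ 1
  ⇓-length {S = S} (⇓push {i} {a}) j =
    length-update S i j (a ∷ lookup S i) 1 (≤-reflexive (+-comm 1 _))
  ⇓-length {S = S} (⇓seq {t = t} {u = u} p q) j = ≤-trans (⇓-length q j)
    (≤-trans (+-monoˡ-≤ u (⇓-length p j)) (≤-reflexive (+-assoc _ t u)))
  ⇓-length {S = S} (⇓case {i} {t = t} p) j = ≤-trans (⇓-length p j)
    (+-mono-≤ (length-pop S i j) (n≤1+n t))
  ⇓-length {S = S} (⇓exit {i} _) j = ≤-trans (length-pop S i j) (m≤m+n _ 1)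
  ⇓-length {S = S} (⇓loop {i} {t = t} {u = u} _ p q) j = ≤-trans (⇓-length q j)
    (≤-trans (+-monoˡ-≤ u (≤-trans (⇓-length p j) (+-mono-≤ (length-pop S i j) (n≤1+n t))))
      (≤-reflexive (+-assoc _ (suc t) u)))

  -- Each stack occupies one track of the tape, bottom next to a marker cell on
  -- which the head rests between commands.
  Cell : Set
  Cell = Vec (Maybe Tok) 4

  fin-Cell : Finite Cell
  fin-Cell = fin-Vec (fin-Maybe fin-Tok) 4

  g′ : ℕ
  g′ = suc (size fin-Cell)

  emptyCell : Cell
  emptyCell = replicate 4 nothing

  bitCell : Bool → Cell
  bitCell b = emptyCell [ F.zero ]≔ just (bitTok b)

  mark : Sym g′
  mark = F.suc (F.suc (F.suc F.zero))

  -- The three symbols fixed by the input convention denote cells with nothing outside track 0, and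
  -- `enc` prefers them. An input tape is thus already a track, and an output track is already an
  -- output tape.
  dec : Sym g′ → Maybe Cell
  dec F.zero = just emptyCell
  dec (F.suc F.zero) = just (bitCell false)
  dec (F.suc (F.suc F.zero)) = just (bitCell true)
  dec (F.suc (F.suc (F.suc F.zero))) = nothing
  dec (F.suc (F.suc (F.suc (F.suc i)))) = just (from fin-Cell i)

  opaque
    enc : Cell → Sym g′
    enc c with finite-≟ fin-Cell c emptyCell | finite-≟ fin-Cell c (bitCell false) | finite-≟ fin-Cell c (bitCell true)
    ... | yes _ | _ | _ = F.zero
    ... | no _ | yes _ | _ = F.suc F.zero
    ... | no _ | no _ | yes _ = F.suc (F.suc F.zero)
    ... | no _ | no _ | no _ = F.suc (F.suc (F.suc (F.suc (to fin-Cell c))))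

    dec-enc : ∀ c → dec (enc c) ≡ just c
    dec-enc c with finite-≟ fin-Cell c emptyCell | finite-≟ fin-Cell c (bitCell false) | finite-≟ fin-Cell c (bitCell true)
    ... | yes refl | _ | _ = refl
    ... | no _ | yes refl | _ = refl
    ... | no _ | no _ | yes refl = refl
    ... | no _ | no _ | no _ = cong just (from-to fin-Cell c)

    enc-empty : enc emptyCell ≡ blank
    enc-empty with finite-≟ fin-Cell emptyCell emptyCell
    ... | yes _ = refl
    ... | no n = ⊥-elim (n refl)

    enc-bit : ∀ b → enc (bitCell b) ≡ encBit b
    enc-bit b with finite-≟ fin-Cell (bitCell b) emptyCell | finite-≟ fin-Cell (bitCell b) (bitCell false) | finite-≟ fin-Cell (bitCell b) (bitCell true)
    enc-bit false | yes () | _ | _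
    enc-bit false | no _ | yes _ | _ = refl
    enc-bit false | no _ | no n | _ = ⊥-elim (n refl)
    enc-bit true | yes () | _ | _
    enc-bit true | no _ | yes () | _
    enc-bit true | no _ | no _ | yes _ = refl
    enc-bit true | no _ | no _ | no n = ⊥-elim (n refl)

  -- Tokens are listed from the bottom of the stack. `done` requires the track to be empty from
  -- there on, so the first free cell lies just beyond the top.
  data Track (i : Fin 4) : List Cell → List Tok → Set where
    done : ∀ {cs} → All (λ c → lookup c i ≡ nothing) cs → Track i cs []
    more : ∀ {c cs a bs} → lookup c i ≡ just a → Track i cs bs → Track i (c ∷ cs) (a ∷ bs)

  private
    encs : List Cell → List (Sym g′)
    encs = map enc

    readTrack : Fin 4 → Sym g′ → Maybe (Maybe Tok)
    readTrack i s = Data.Maybe.map (λ c → lookup c i) (dec s)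

  lookup-empty : ∀ j → lookup emptyCell j ≡ nothing
  lookup-empty F.zero = refl
  lookup-empty (F.suc F.zero) = refl
  lookup-empty (F.suc (F.suc F.zero)) = refl
  lookup-empty (F.suc (F.suc (F.suc F.zero))) = refl

  module _ (i : Fin 4) where
    Others : List Cell → List Cell → Set
    Others cs cs′ = ∀ j → ¬ j ≡ i → ∀ bs → Track j cs bs → Track j cs′ bs

    update-other : ∀ {x : Maybe Tok} (c : Cell) j → ¬ j ≡ i → lookup (c [ i ]≔ x) j ≡ lookup c j
    update-other {x} c j n = lookup∘update′ n c x

    others-update : ∀ {x : Maybe Tok} (c : Cell) cs → Others (c ∷ cs) ((c [ i ]≔ x) ∷ cs)
    others-update c cs j n _ (done (p ∷ ps)) = done (trans (update-other c j n) p ∷ ps)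
    others-update c cs j n _ (more p t) = more (trans (update-other c j n) p) t

    others-∷ : ∀ c {cs cs′} → Others cs cs′ → Others (c ∷ cs) (c ∷ cs′)
    others-∷ c {cs} {cs′} o j n _ (done (p ∷ ps)) with o j n [] (done ps)
    ... | done ps′ = done (p ∷ ps′)
    others-∷ c o j n _ (more p t) = more p (o j n _ t)

    others-[] : ∀ {cs} → Others (emptyCell ∷ []) cs → Others [] cs
    others-[] o j n _ (done []) = o j n [] (done (lookup-empty j ∷ []))

  data PushQ : Set where
    scan ret : PushQ

  module _ (i : Fin 4) (a : Tok) where
    pushScan : Sym g′ → Maybe Cell → (PushQ ⊎ ⊤) × Sym g′ × Move
    pushScan′ : Sym g′ → Cell → Maybe Tok → (PushQ ⊎ ⊤) × Sym g′ × Move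
    pushScan s nothing = inj₁ scan , s , moveR
    pushScan s (just c) = pushScan′ s c (lookup c i)
    pushScan′ s c (just _) = inj₁ scan , s , moveR
    pushScan′ s c nothing = inj₁ ret , enc (c [ i ]≔ just a) , moveL

    pushRet : Sym g′ → Maybe Cell → (PushQ ⊎ ⊤) × Sym g′ × Move
    pushRet s nothing = inj₂ tt , s , stay
    pushRet s (just _) = inj₁ ret , s , moveL

    pushF : Frag g′ ⊤
    Q pushF = PushQ
    fin pushF = retract (fin-Fin 2) (λ { scan → F.zero ; ret → F.suc F.zero })
      (λ { F.zero → scan ; (F.suc _) → ret }) (λ { scan → refl ; ret → refl })
    entry pushF = scan
    next pushF scan s = pushScan s (dec s)
    next pushF ret s = pushRet s (dec s)

    pushScan-just : ∀ {c b} → lookup c i ≡ just b → next pushF scan (enc c) ≡ (inj₁ scan , enc c , moveR)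
    pushScan-just {c} e rewrite dec-enc c | e = refl

    pushScan-nothing : ∀ {c} → lookup c i ≡ nothing →
      next pushF scan (enc c) ≡ (inj₁ ret , enc (c [ i ]≔ just a) , moveL)
    pushScan-nothing {c} e rewrite dec-enc c | e = refl

    pushRet-just : ∀ c → next pushF ret (enc c) ≡ (inj₁ ret , enc c , moveL)
    pushRet-just c rewrite dec-enc c = refl

    -- Stated with a continuation: any run that goes home from the cell to the left extends to a run
    -- of the whole scan. The induction on the cells then wraps one step right and one step left
    -- around the inner run.
    push-run : ∀ cs bs → Track i cs bs → Σ (List Cell) λ cs′ →
      Track i cs′ (bs ∷ʳ a) × Others i cs cs′ ×
      (∀ {l x n tp} → Run pushF ret (l , x ∷ encs cs′) n tt tp →
        Run pushF scan (x ∷ l , encs cs) (suc (length bs + (length bs + n))) tt tp)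
    push-run [] _ (done []) =
      (emptyCell [ i ]≔ just a) ∷ [] , more (lookup∘update i emptyCell (just a)) (done []) ,
      others-[] i (others-update i emptyCell []) ,
      cont (trans (cong (next pushF scan) (sym enc-empty)) (pushScan-nothing (lookup-empty i)))
    push-run (c ∷ cs) _ (done (p ∷ ps)) =
      (c [ i ]≔ just a) ∷ cs , more (lookup∘update i c (just a)) (done ps) ,
      others-update i c cs , cont (pushScan-nothing p)
    push-run (c ∷ cs) (b ∷ bs) (more p t) with push-run cs bs t
    ... | cs′ , t′ , o , r = c ∷ cs′ , more p t′ , others-∷ i c o , λ {l} {x} {n} {tp} rn →
      cont (pushScan-just p) (subst (λ k → Run pushF scan (enc c ∷ x ∷ l , encs cs) k tt tp)
        (cong suc (cong (length bs +_) (+-suc (length bs) n)))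
        (r (cont (pushRet-just c) rn)))

  data PopQ : Set where
    scan take : PopQ
    ret : Tok → PopQ

  module _ (i : Fin 4) where
    popScan : Sym g′ → Maybe (Maybe Tok) → (PopQ ⊎ Maybe Tok) × Sym g′ × Move
    popScan s nothing = inj₁ scan , s , moveR
    popScan s (just (just _)) = inj₁ scan , s , moveR
    popScan s (just nothing) = inj₁ take , s , moveL

    popTake : Sym g′ → Maybe Cell → (PopQ ⊎ Maybe Tok) × Sym g′ × Move
    popTake′ : Sym g′ → Cell → Maybe Tok → (PopQ ⊎ Maybe Tok) × Sym g′ × Move
    popTake s nothing = inj₂ nothing , s , stay
    popTake s (just c) = popTake′ s c (lookup c i)
    popTake′ s c (just a) = inj₁ (ret a) , enc (c [ i ]≔ nothing) , moveL
    popTake′ s c nothing = inj₂ nothing , s , stay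

    popRet : Tok → Sym g′ → Maybe Cell → (PopQ ⊎ Maybe Tok) × Sym g′ × Move
    popRet a s nothing = inj₂ (just a) , s , stay
    popRet a s (just _) = inj₁ (ret a) , s , moveL

    -- The top is recognised by the free cell behind it, so the head overshoots by one and steps
    -- back; the token travels home in the state. On an empty track the step back meets the marker,
    -- which signals the empty stack.
    popF : Frag g′ (Maybe Tok)
    Q popF = PopQ
    fin popF = retract (fin-⊎ (fin-Fin 2) fin-Tok)
      (λ { scan → inj₁ F.zero ; take → inj₁ (F.suc F.zero) ; (ret a) → inj₂ a })
      (λ { (inj₁ F.zero) → scan ; (inj₁ (F.suc _)) → take ; (inj₂ a) → ret a })
      (λ { scan → refl ; take → refl ; (ret a) → refl })
    entry popF = scan
    next popF scan s = popScan s (readTrack i s)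
    next popF take s = popTake s (dec s)
    next popF (ret a) s = popRet a s (dec s)

    popScan-just : ∀ {c b} → lookup c i ≡ just b → next popF scan (enc c) ≡ (inj₁ scan , enc c , moveR)
    popScan-just {c} e rewrite dec-enc c | e = refl

    popScan-nothing : ∀ {c} → lookup c i ≡ nothing → next popF scan (enc c) ≡ (inj₁ take , enc c , moveL)
    popScan-nothing {c} e rewrite dec-enc c | e = refl

    popTake-just : ∀ {c b} → lookup c i ≡ just b →
      next popF take (enc c) ≡ (inj₁ (ret b) , enc (c [ i ]≔ nothing) , moveL)
    popTake-just {c} e rewrite dec-enc c | e = refl

    popRet-just : ∀ a c → next popF (ret a) (enc c) ≡ (inj₁ (ret a) , enc c , moveL)
    popRet-just a c rewrite dec-enc c = refl

    -- Scanning past the end of the used tape materialises one blank cell.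
    pad : List Cell → List Cell
    pad [] = emptyCell ∷ []
    pad (c ∷ cs) = c ∷ cs

    pad-track : ∀ {cs} j bs → Track j cs bs → Track j (pad cs) bs
    pad-track {[]} j _ (done []) = done (lookup-empty j ∷ [])
    pad-track {c ∷ cs} j bs t = t

    pad-done : ∀ {cs} → All (λ c → lookup c i ≡ nothing) cs → ∀ {l x n e tp} →
      Run popF take (l , x ∷ encs (pad cs)) n e tp → Run popF scan (x ∷ l , encs cs) (suc n) e tp
    pad-done {[]} _ {x = x} r = cont (trans (cong (next popF scan) (sym enc-empty))
      (popScan-nothing (lookup-empty i))) r
    pad-done {c ∷ cs} (p ∷ _) r = cont (popScan-nothing p) r

    pop-run : ∀ {c cs b bs} → lookup c i ≡ just b → Track i cs bs →
      Σ Tok λ a → Σ (List Tok) λ bs′ → Σ Cell λ c′ → Σ (List Cell) λ cs′ →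
        b ∷ bs ≡ bs′ ∷ʳ a × Track i (c′ ∷ cs′) bs′ × Others i (c ∷ cs) (c′ ∷ cs′) ×
        (∀ {l x n tp} → Run popF (ret a) (l , x ∷ enc c′ ∷ encs cs′) n (just a) tp →
          Run popF scan (enc c ∷ x ∷ l , encs cs) (suc (suc (length bs + (length bs + n)))) (just a) tp)
    pop-run {c} {cs} {b} p (done ps) = b , [] , c [ i ]≔ nothing , pad cs , refl ,
      done (lookup∘update i c nothing ∷ all-pad cs ps) ,
      (λ j n bs t → others-update i c (pad cs) j n bs (pad-∷ j bs t)) ,
      λ r → pad-done ps (cont (popTake-just p) r)
      where
      all-pad : ∀ cs → All (λ c → lookup c i ≡ nothing) cs → All (λ c → lookup c i ≡ nothing) (pad cs)
      all-pad [] _ = lookup-empty i ∷ []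
      all-pad (_ ∷ _) ps = ps
      pad-∷ : ∀ j bs → Track j (c ∷ cs) bs → Track j (c ∷ pad cs) bs
      pad-∷ j _ (done (q ∷ qs)) with pad-track j [] (done qs)
      ... | done qs′ = done (q ∷ qs′)
      pad-∷ j _ (more q t) = more q (pad-track j _ t)
    pop-run {c} {c₂ ∷ cs} {b} {b₂ ∷ bs} p (more q t) with pop-run q t
    ... | a , bs′ , c′ , cs′ , e , t′ , o , r =
      a , b ∷ bs′ , c , c′ ∷ cs′ , cong (b ∷_) e , more p t′ , others-∷ i c o ,
      λ {l} {x} {n} {tp} rn → subst (λ k → Run popF scan (enc c ∷ x ∷ l , encs (c₂ ∷ cs)) k (just a) tp)
        (cong (λ k → 3 + (length bs + k)) (+-suc (length bs) n)) (cont (popScan-just q) (r (cont (popRet-just a c) rn)))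

  -- Compilation of stack programs

  compile : Cmd → Frag g′ ⊤
  compileBody : Maybe Cmd → Frag g′ Bool
  compile skip = retF tt
  compile (push i a) = pushF i a
  compile (c ⨾ d) = bindF (compile c) fin-⊤ (λ _ → compile d)
  compile (case i f) = bindF (popF i) (fin-Maybe fin-Tok) (λ a → compile (f a))
  compile (loop i f) = loopF (bindF (popF i) (fin-Maybe fin-Tok) (λ a → compileBody (f a)))
  compileBody nothing = retF false
  compileBody (just c) = bindF (compile c) fin-⊤ (λ _ → retF true)

  home : List Cell → Tape g′
  home cs = [] , mark ∷ map enc cs

  Rep : List Cell → Stk → Set
  Rep cs S = ∀ j → Track j cs (reverse (lookup S j))

  rep-update : ∀ {cs cs′} S i xs → Rep cs S → Others i cs cs′ → Track i cs′ (reverse xs) →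
    Rep cs′ (S [ i ]≔ xs)
  rep-update S i xs R o t j with j FP.≟ i
  ... | yes refl = subst (λ z → Track i _ (reverse z)) (sym (lookup∘update i S xs)) t
  ... | no ¬e = subst (λ z → Track j _ (reverse z)) (sym (lookup∘update′ ¬e S xs)) (o j ¬e _ (R j))

  push-home : ∀ {cs} S i a → Rep cs S → Σ (List Cell) λ cs′ → Σ ℕ λ n →
    Run (pushF i a) scan (home cs) n tt (home cs′) × Rep cs′ (S [ i ]≔ (a ∷ lookup S i)) ×
    n ≤ 2 * length (lookup S i) + 3
  push-home {cs} S i a R with push-run i a cs _ (R i)
  ... | cs′ , t , o , r = cs′ , _ , cont refl (r (exit refl)) ,
    rep-update S i (a ∷ lookup S i) R o (subst (Track i cs′) (sym (unfold-reverse a (lookup S i))) t) ,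
    ≤-reflexive (trans (cong (λ k → suc (suc (k + (k + 1)))) (length-reverse (lookup S i))) (eq (length (lookup S i))))
    where
    eq : ∀ k → suc (suc (k + (k + 1))) ≡ 2 * k + 3
    eq = solve-∀

  pop-home-∷ : ∀ {cs} i bs {xs a} → Track i cs bs → bs ≡ xs ∷ʳ a → Σ (List Cell) λ cs′ → Σ ℕ λ n →
    Run (popF i) scan (home cs) n (just a) (home cs′) × Track i cs′ xs × Others i cs cs′ ×
    n ≤ 2 * length xs + 5
  pop-home-∷ i [] {[]} _ ()
  pop-home-∷ i [] {_ ∷ _} _ ()
  pop-home-∷ {c ∷ cs} i (b ∷ bs) {xs} {a} (more p t) e with pop-run i p t
  ... | a′ , bs′ , c′ , cs′ , e′ , t′ , o , r with ∷ʳ-injective bs′ xs (trans (sym e′) e)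
  ... | refl , refl = c′ ∷ cs′ , _ , cont refl (cont (popScan-just i p) (r (exit refl))) , t′ , o ,
    ≤-reflexive (trans (cong (λ k → 4 + (k + (k + 1))) len) (eq (length bs′)))
    where
    len : length bs ≡ length bs′
    len = suc-injective (trans (cong length e′) (trans (length-++ bs′) (+-comm (length bs′) 1)))
    eq : ∀ k → 4 + (k + (k + 1)) ≡ 2 * k + 5
    eq = solve-∀

  pop-home : ∀ {cs} S i → Rep cs S → Σ (List Cell) λ cs′ → Σ ℕ λ n →
    Run (popF i) scan (home cs) n (top (lookup S i)) (home cs′) ×
    Rep cs′ (S [ i ]≔ tl (lookup S i)) × n ≤ 2 * length (lookup S i) + 3
  pop-home {cs} S i R with lookup S i in eq | R i
  ... | [] | done ps = pad i cs , _ , cont refl (pad-done i ps (exit refl)) ,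
    rep-update S i [] R (λ j _ → pad-track i j) (pad-track i i [] (done ps)) , ≤-refl
  ... | a ∷ xs | t with pop-home-∷ i _ t (unfold-reverse a xs)
  ... | cs′ , n , r , t′ , o , h = cs′ , n , r , rep-update S i xs R o t′ ,
    ≤-trans h (≤-reflexive (trans (cong (λ k → 2 * k + 5) (length-reverse xs)) (arith (length xs))))
    where
    arith : ∀ k → 2 * k + 5 ≡ 2 * suc k + 3
    arith = solve-∀

  -- A stack of height `h` is accessed in at most `2 * h + 3` steps; the surplus also covers the
  -- step by which a loop body reports back to its loop.
  opCost : ℕ → ℕ
  opCost U = 2 * U + 6

  pop-cost : ∀ {n k t U} → n ≤ 2 * k + 3 → k + suc t ≤ U → 2 + n ≤ opCost U
  pop-cost {n} {k} {t} {U} h u = begin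
    2 + n           ≤⟨ +-monoʳ-≤ 2 h ⟩
    2 + (2 * k + 3) ≤⟨ ≤-by 1 (eq k) ⟩
    2 * k + 6       ≤⟨ +-monoˡ-≤ 6 (*-monoʳ-≤ 2 (≤-trans (m≤m+n k _) u)) ⟩
    2 * U + 6 ∎
    where
    open ≤-Reasoning
    eq : ∀ k → 2 + (2 * k + 3) + 1 ≡ 2 * k + 6
    eq = solve-∀

  -- `U` bounds height plus remaining time. Since heights grow no faster than time passes, the same
  -- `U` is valid for every later part of the execution, and each counted step costs at most
  -- `opCost U`.
  simulate : ∀ {c S t S′} → c ⊢ S ⇓[ t ] S′ → ∀ cs U → Rep cs S →
    (∀ j → length (lookup S j) + t ≤ U) → Σ (List Cell) λ cs′ → Σ ℕ λ n →
    Run (compile c) (entry (compile c)) (home cs) n tt (home cs′) × Rep cs′ S′ × n ≤ t * opCost U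
  simulate ⇓skip cs U R h = cs , 1 , exit refl , R ,
    ≤-trans (≤-trans (m≤n+m 1 (2 * U + 5)) (≤-reflexive (eq U))) (m≤m+n _ 0)
    where
    eq : ∀ U → 2 * U + 5 + 1 ≡ 2 * U + 6
    eq = solve-∀
  simulate {S = S} (⇓push {i} {a}) cs U R h with push-home S i a R
  ... | cs′ , n , r , R′ , b = cs′ , n , r , R′ ,
    ≤-trans (≤-trans (m≤n+m n 2) (pop-cost b (h i))) (m≤m+n _ 0)
  simulate {S = S} (⇓seq {t = t} {u = u} p q) cs U R h
    with simulate p cs U R (λ j → ≤-trans (+-monoʳ-≤ _ (m≤m+n t u)) (h j))
  ... | cs₁ , n₁ , r₁ , R₁ , b₁
    with simulate q cs₁ U R₁ (λ j → ≤-trans (+-monoˡ-≤ u (⇓-length p j))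
           (≤-trans (≤-reflexive (+-assoc _ t u)) (h j)))
  ... | cs₂ , n₂ , r₂ , R₂ , b₂ = cs₂ , _ , run-bind _ _ _ r₁ r₂ , R₂ ,
    ≤-trans (+-mono-≤ b₁ b₂) (≤-reflexive (sym (*-distribʳ-+ (opCost U) t u)))
  simulate {S = S} (⇓case {i} {f} {t = t} p) cs U R h with pop-home S i R
  ... | cs₁ , n₁ , r₁ , R₁ , b₁
    with simulate p cs₁ U R₁ (λ j → ≤-trans (+-mono-≤ (length-pop S i j) (n≤1+n t)) (h j))
  ... | cs₂ , n₂ , r₂ , R₂ , b₂ = cs₂ , _ , run-bind _ _ _ r₁ r₂ , R₂ ,
    +-mono-≤ (≤-trans (m≤n+m n₁ 2) (pop-cost b₁ (h i))) b₂
  simulate {S = S} (⇓exit {i} {f} e) cs U R h with pop-home S i R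
  ... | cs₁ , n₁ , r₁ , R₁ , b₁ = cs₁ , _ ,
    run-loop-exit _ (run-bind _ _ _ r₁ (exits (f (top (lookup S i))) e)) , R₁ ,
    ≤-trans (≤-trans (≤-reflexive (+-comm n₁ 1)) (≤-trans (n≤1+n (suc n₁)) (pop-cost b₁ (h i)))) (m≤m+n _ 0)
    where
    exits : ∀ m → m ≡ nothing →
      Run (compileBody m) (entry (compileBody m)) (home cs₁) 1 false (home cs₁)
    exits nothing _ = exit refl
  simulate {S = S} (⇓loop {i} {f} {c = c} {t = t} {u = u} e p q) cs U R h with pop-home S i R
  ... | cs₁ , n₁ , r₁ , R₁ , b₁
    with simulate p cs₁ U R₁ (λ j → ≤-trans (+-mono-≤ (length-pop S i j) (≤-trans (m≤m+n t u) (n≤1+n (t + u)))) (h j))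
  ... | cs₂ , n₂ , r₂ , R₂ , b₂
    with simulate q cs₂ U R₂ (λ j → ≤-trans (+-monoˡ-≤ u (≤-trans (⇓-length p j)
             (+-mono-≤ (length-pop S i j) (n≤1+n t))))
           (≤-trans (≤-reflexive (+-assoc _ (suc t) u)) (h j)))
  ... | cs₃ , n₃ , r₃ , R₃ , b₃ = cs₃ , _ ,
    run-loop-again _ (run-bind _ _ _ r₁ (again (f (top (lookup S i))) e)) r₃ , R₃ , cost
    where
    again : ∀ m → m ≡ just c →
      Run (compileBody m) (entry (compileBody m)) (home cs₁) (n₂ + 1) true (home cs₂)
    again (just _) refl = run-bind _ _ _ r₂ (exit refl)
    w = opCost U
    open ≤-Reasoning
    eq₁ : ∀ a b c → a + (b + 1) + c + 1 ≡ 2 + a + (b + c)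
    eq₁ = solve-∀
    eq₂ : ∀ w t u → w + (t * w + u * w) ≡ (1 + (t + u)) * w
    eq₂ = solve-∀
    cost : n₁ + (n₂ + 1) + n₃ ≤ (suc t + u) * w
    cost = begin
      n₁ + (n₂ + 1) + n₃   ≤⟨ ≤-by 1 (eq₁ n₁ n₂ n₃) ⟩
      2 + n₁ + (n₂ + n₃)   ≤⟨ +-mono-≤ (pop-cost b₁ (h i)) (+-mono-≤ b₂ b₃) ⟩
      w + (t * w + u * w)  ≡⟨ eq₂ w t u ⟩
      (suc t + u) * w ∎

  -- A left move at the left end creates a fresh cell, which becomes the marker. It also writes back
  -- the scanned cell, so an empty input leaves one explicit blank, as in `initCells`.
  initF : Frag g′ ⊤
  Q initF = Fin 2
  fin initF = fin-Fin 2
  entry initF = F.zero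
  next initF F.zero s = inj₁ (F.suc F.zero) , s , moveL
  next initF (F.suc _) s = inj₂ tt , mark , stay

  finalF : Frag g′ ⊤
  Q finalF = ⊤
  fin finalF = fin-⊤
  entry finalF = tt
  next finalF _ s = inj₂ tt , s , moveR

  initCells : List Bool → List Cell
  initCells [] = emptyCell ∷ []
  initCells (b ∷ x) = bitCell b ∷ map bitCell x

  inputStk : List Bool → Stk
  inputStk x = reverse (map bitTok x) ∷ᵥ [] ∷ᵥ [] ∷ᵥ [] ∷ᵥ []ᵥ

  enc-initCells : ∀ x → map enc (initCells x) ≡ hd (map encBit x) ∷ tl (map encBit x)
  enc-initCells [] = cong (_∷ []) enc-empty
  enc-initCells (b ∷ x) = cong₂ _∷_ (enc-bit b) (rest x)
    where
    rest : ∀ x → map enc (map bitCell x) ≡ map encBit x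
    rest [] = refl
    rest (b ∷ x) = cong₂ _∷_ (enc-bit b) (rest x)

  rep-initCells : ∀ x → Rep (initCells x) (inputStk x)
  rep-initCells x F.zero rewrite reverse-involutive (map bitTok x) = cells x
    where
    onBits : ∀ x → Track F.zero (map bitCell x) (map bitTok x)
    onBits [] = done []
    onBits (b ∷ x) = more refl (onBits x)
    cells : ∀ x → Track F.zero (initCells x) (map bitTok x)
    cells [] = done (refl ∷ [])
    cells (b ∷ x) = onBits (b ∷ x)
  rep-initCells x (F.suc j) = subst (Track (F.suc j) (initCells x)) (cong reverse (sym (lookup-nil j))) (done (cells x))
    where
    lookup-nil : ∀ j → lookup (inputStk x) (F.suc j) ≡ []
    lookup-nil F.zero = refl
    lookup-nil (F.suc F.zero) = refl
    lookup-nil (F.suc (F.suc F.zero)) = refl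
    cell : ∀ b → lookup (bitCell b) (F.suc j) ≡ nothing
    cell b = lookup-empty (F.suc j)
    onBits : ∀ x → All (λ c → lookup c (F.suc j) ≡ nothing) (map bitCell x)
    onBits [] = []
    onBits (b ∷ x) = cell b ∷ onBits x
    cells : ∀ x → All (λ c → lookup c (F.suc j) ≡ nothing) (initCells x)
    cells [] = lookup-empty (F.suc j) ∷ []
    cells (b ∷ x) = onBits (b ∷ x)

  decodeOut-bit : ∀ b (r : List (Sym g′)) → decodeOut (encBit b ∷ r) ≡ b ∷ decodeOut r
  decodeOut-bit false r = refl
  decodeOut-bit true r = refl

  -- With the other three tracks empty, each used cell is exactly a `bitCell` and the next one
  -- exactly empty, so `enc` yields the symbols that `decodeOut` understands.
  decode-cells : ∀ cs y → Track F.zero cs (map bitTok y) →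
    (∀ j → Track (F.suc j) cs []) → decodeOut (map enc cs) ≡ y
  decode-cells [] [] _ _ = refl
  decode-cells (c ∷ cs) [] (done (p ∷ _)) ts = cong (λ s → decodeOut (s ∷ map enc cs)) (trans (cong enc c-empty) enc-empty)
    where
    head : ∀ j → lookup c (F.suc j) ≡ nothing
    head j with ts j
    ... | done (q ∷ _) = q
    c-empty : c ≡ emptyCell
    c-empty = ext c p (head F.zero) (head (F.suc F.zero)) (head (F.suc (F.suc F.zero)))
      where
      ext : ∀ (c : Cell) → lookup c F.zero ≡ nothing → lookup c (F.suc F.zero) ≡ nothing →
        lookup c (F.suc (F.suc F.zero)) ≡ nothing → lookup c (F.suc (F.suc (F.suc F.zero))) ≡ nothing → c ≡ emptyCell
      ext (_ ∷ᵥ _ ∷ᵥ _ ∷ᵥ _ ∷ᵥ []ᵥ) refl refl refl refl = refl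
  decode-cells (c ∷ cs) (b ∷ y) (more p t) ts = trans
    (cong (λ s → decodeOut (s ∷ map enc cs)) (trans (cong enc c-bit) (enc-bit b)))
    (trans (decodeOut-bit b (map enc cs)) (cong (b ∷_) (decode-cells cs y t rest)))
    where
    head : ∀ j → lookup c (F.suc j) ≡ nothing
    head j with ts j
    ... | done (q ∷ _) = q
    rest : ∀ j → Track (F.suc j) cs []
    rest j with ts j
    ... | done (_ ∷ qs) = done qs
    c-bit : c ≡ bitCell b
    c-bit = ext c p (head F.zero) (head (F.suc F.zero)) (head (F.suc (F.suc F.zero)))
      where
      ext : ∀ (c : Cell) → lookup c F.zero ≡ just (bitTok b) → lookup c (F.suc F.zero) ≡ nothing →
        lookup c (F.suc (F.suc F.zero)) ≡ nothing → lookup c (F.suc (F.suc (F.suc F.zero))) ≡ nothing → c ≡ bitCell b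
      ext (_ ∷ᵥ _ ∷ᵥ _ ∷ᵥ _ ∷ᵥ []ᵥ) refl refl refl refl = refl

  stack-PolyTime : ∀ c (p : Pol) f →
    (∀ x → Σ ℕ λ t → t ≤ fn p (length x) × c ⊢ inputStk x ⇓[ t ] inputStk (f x)) → PolyTime f
  stack-PolyTime c p f ex = toTM whole , proj₁ (toPolyBound cost) , computes
    where
    main whole : Frag g′ ⊤
    main = bindF (compile c) fin-⊤ (λ _ → finalF)
    whole = bindF initF fin-⊤ (λ _ → main)
    cost : Pol
    -- Two steps set the marker and one leaves it; in between there are `p` commands at `opCost` of
    -- input length plus time.
    cost = K 3 ⊕ p ⊗ (K 2 ⊗ (X ⊕ p) ⊕ K 6)
    height : ∀ x t → t ≤ fn p (length x) → ∀ j →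
      length (lookup (inputStk x) j) + t ≤ length x + fn p (length x)
    height x t h F.zero = +-mono-≤ (≤-reflexive (trans (length-reverse (map bitTok x)) (length-map bitTok x))) h
    height x t h (F.suc F.zero) = +-mono-≤ {0} z≤n h
    height x t h (F.suc (F.suc F.zero)) = +-mono-≤ {0} z≤n h
    height x t h (F.suc (F.suc (F.suc F.zero))) = +-mono-≤ {0} z≤n h
    computes : ComputesIn (toTM whole) f (polyBound (proj₁ (toPolyBound cost)))
    computes x with ex x
    ... | t , t≤ , p⇓ with simulate p⇓ (initCells x) (length x + fn p (length x)) (rep-initCells x) (height x t t≤)
    ... | cs , n , r , R , b with toTM-run whole (run-bind initF fin-⊤ (λ _ → main)
        (cont refl (exit refl)) (subst (λ z → Run main _ ([] , mark ∷ z) (n + 1) tt (mark ∷ [] , map enc cs))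
          (enc-initCells x) (run-bind (compile c) fin-⊤ (λ _ → finalF) r (exit refl))))
    ... | h , halts , e = 2 + (n + 1) ,
      ≤-trans bound (proj₂ (toPolyBound cost) (length x)) ,
      trans (cong (λ z → halting (toTM whole) (state z)) e) halts ,
      trans (cong (decodeOut ∘ right) e) (decode-cells cs (f x)
        (subst (Track F.zero cs) (reverse-involutive (map bitTok (f x))) (R F.zero))
        λ { F.zero → R (F.suc F.zero) ; (F.suc F.zero) → R (F.suc (F.suc F.zero))
          ; (F.suc (F.suc F.zero)) → R (F.suc (F.suc (F.suc F.zero))) })
      where
      open ≤-Reasoning
      U = length x + fn p (length x)
      bound : 2 + (n + 1) ≤ fn cost (length x)
      bound = begin
        2 + (n + 1)                          ≡⟨ eq n ⟩
        3 + n                                ≤⟨ +-monoʳ-≤ 3 b ⟩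
        3 + t * opCost U                     ≤⟨ +-monoʳ-≤ 3 (*-monoˡ-≤ (opCost U) t≤) ⟩
        3 + fn p (length x) * opCost U ∎
        where
        eq : ∀ n → 2 + (n + 1) ≡ 3 + n
        eq = solve-∀

  -- Executions with cost bounds and the handling of serialised trees

  _⊢_⇓≤[_]_ : Cmd → Stk → ℕ → Stk → Set
  c ⊢ S ⇓≤[ n ] S′ = Σ ℕ λ t → t ≤ n × c ⊢ S ⇓[ t ] S′

  weak≤ : ∀ {c S n m S′} → n ≤ m → c ⊢ S ⇓≤[ n ] S′ → c ⊢ S ⇓≤[ m ] S′
  weak≤ h (t , t≤ , r) = t , ≤-trans t≤ h , r

  cast≤ : ∀ {c S n m S′ S″} → n ≡ m → S′ ≡ S″ → c ⊢ S ⇓≤[ n ] S′ → c ⊢ S ⇓≤[ m ] S″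
  cast≤ refl refl r = r

  skip≤ : ∀ {S} → skip ⊢ S ⇓≤[ 1 ] S
  skip≤ = 1 , ≤-refl , ⇓skip

  push≤ : ∀ {i a S} → push i a ⊢ S ⇓≤[ 1 ] (S [ i ]≔ (a ∷ lookup S i))
  push≤ = 1 , ≤-refl , ⇓push

  seq≤ : ∀ {c d S n S′ m S″} → c ⊢ S ⇓≤[ n ] S′ → d ⊢ S′ ⇓≤[ m ] S″ → (c ⨾ d) ⊢ S ⇓≤[ n + m ] S″
  seq≤ (t , t≤ , r) (u , u≤ , s) = t + u , +-mono-≤ t≤ u≤ , ⇓seq r s

  case≤ : ∀ {i f S n S′} → f (top (lookup S i)) ⊢ S [ i ]≔ tl (lookup S i) ⇓≤[ n ] S′ →
    case i f ⊢ S ⇓≤[ suc n ] S′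
  case≤ (t , t≤ , r) = suc t , s≤s t≤ , ⇓case r

  exit≤ : ∀ {i f S} → f (top (lookup S i)) ≡ nothing → loop i f ⊢ S ⇓≤[ 1 ] (S [ i ]≔ tl (lookup S i))
  exit≤ e = 1 , ≤-refl , ⇓exit e

  loop≤ : ∀ {i f S c n S′ m S″} → f (top (lookup S i)) ≡ just c →
    c ⊢ S [ i ]≔ tl (lookup S i) ⇓≤[ n ] S′ → loop i f ⊢ S′ ⇓≤[ m ] S″ → loop i f ⊢ S ⇓≤[ suc n + m ] S″
  loop≤ e (t , t≤ , r) (u , u≤ , s) = suc t + u , s≤s (+-mono-≤ t≤ u≤) , ⇓loop e r s

  sM sC : Fin 4
  sM = F.zero
  sC = F.suc F.zero

  aux : Bool → Fin 4
  aux false = F.suc (F.suc F.zero)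
  aux true = F.suc (F.suc (F.suc F.zero))

  -- The third list is always the stack `aux b`. Each program is thus stated once for both auxiliary
  -- stacks, though its proof splits on `b` to let the stack updates reduce.
  st : Bool → (m c x y : List Tok) → Stk
  st false m c x y = m ∷ᵥ c ∷ᵥ x ∷ᵥ y ∷ᵥ []ᵥ
  st true m c x y = m ∷ᵥ c ∷ᵥ y ∷ᵥ x ∷ᵥ []ᵥ

  main : (m c : List Tok) → Stk
  main m c = m ∷ᵥ c ∷ᵥ [] ∷ᵥ [] ∷ᵥ []ᵥ

  -- Preorder is self-delimiting: the topmost tree can be separated from what lies below it without
  -- an end mark.
  tok : D → List Tok → List Tok
  tok nil m = tO ∷ m
  tok (x · y) m = tI ∷ tok x (tok y m)

  revtok : D → List Tok → List Tok
  revtok nil x = tO ∷ x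
  revtok (d · e) x = revtok e (revtok d (tI ∷ x))

  length-tok : ∀ d m → length (tok d m) ≡ sz d + length m
  length-tok nil m = refl
  length-tok (d · e) m = cong suc (trans (length-tok d (tok e m))
    (trans (cong (sz d +_) (length-tok e m)) (sym (+-assoc (sz d) (sz e) (length m)))))

  length-revtok : ∀ d x → length (revtok d x) ≡ sz d + length x
  length-revtok nil x = refl
  length-revtok (d · e) x = trans (length-revtok e _) (trans (cong (sz e +_) (length-revtok d _)) (eq (sz d) (sz e) (length x)))
    where
    eq : ∀ d e n → e + (d + suc n) ≡ suc (d + e + n)
    eq = solve-∀

  length-tok-[] : ∀ d → length (tok d []) ≡ sz d
  length-tok-[] d = trans (length-tok d []) (+-identityʳ (sz d))

  length-revtok-[] : ∀ d → length (revtok d []) ≡ sz d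
  length-revtok-[] d = trans (length-revtok d []) (+-identityʳ (sz d))

  revtok-ʳ++ : ∀ d x m → revtok d x ʳ++ m ≡ x ʳ++ tok d m
  revtok-ʳ++ nil x m = refl
  revtok-ʳ++ (d · e) x m = trans (revtok-ʳ++ e _ m) (revtok-ʳ++ d _ (tok e m))

  tok-ʳ++ : ∀ d m x → tok d m ʳ++ x ≡ m ʳ++ revtok d x
  tok-ʳ++ nil m x = refl
  tok-ʳ++ (d · e) m x = trans (tok-ʳ++ d (tok e m) _) (tok-ʳ++ e m _)

  -- The number of pending subtrees is kept in unary on the counter stack.
  grabTok : Bool → Maybe Tok → Cmd
  grabTok b (just tO) = push (aux b) tO
  grabTok b (just tI) = push (aux b) tI ⨾ push sC tI ⨾ push sC tI
  grabTok b _ = skip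

  grabBody : Bool → Maybe Tok → Maybe Cmd
  grabBody b (just tI) = just (case sM (grabTok b))
  grabBody b _ = nothing

  grabLoop grab : Bool → Cmd
  grabLoop b = loop sC (grabBody b)
  grab b = push sC tO ⨾ push sC tI ⨾ grabLoop b

  -- The continuation form permits induction on the tree: after one subtree the same loop goes on
  -- with the next pending one. An inner node costs one loop test, one pop and three pushes, hence
  -- the 5.
  grab-tree : ∀ b d {m c x y n S′} → grabLoop b ⊢ st b m c (revtok d x) y ⇓≤[ n ] S′ →
    grabLoop b ⊢ st b (tok d m) (tI ∷ c) x y ⇓≤[ 5 * sz d + n ] S′
  grab-tree false nil r = weak≤ (m≤n+m _ 2) (loop≤ refl (case≤ push≤) r)
  grab-tree true nil r = weak≤ (m≤n+m _ 2) (loop≤ refl (case≤ push≤) r)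
  grab-tree b (d · e) {n = n} r = weak≤ (≤-reflexive (eq (sz d) (sz e) n)) (node b r)
    where
    eq : ∀ d e n → 5 + (5 * d + (5 * e + n)) ≡ 5 * suc (d + e) + n
    eq = solve-∀
    node : ∀ b {m c x y S′} → grabLoop b ⊢ st b m c (revtok (d · e) x) y ⇓≤[ n ] S′ →
      grabLoop b ⊢ st b (tok (d · e) m) (tI ∷ c) x y ⇓≤[ 5 + (5 * sz d + (5 * sz e + n)) ] S′
    node false r = loop≤ refl (case≤ (seq≤ push≤ (seq≤ push≤ push≤))) (grab-tree false d (grab-tree false e r))
    node true r = loop≤ refl (case≤ (seq≤ push≤ (seq≤ push≤ push≤))) (grab-tree true d (grab-tree true e r))

  grab-run : ∀ b d {m c x y} → grab b ⊢ st b (tok d m) c x y ⇓≤[ 5 * sz d + 3 ] st b m c (revtok d x) y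
  grab-run b d = weak≤ (≤-reflexive (eq (5 * sz d))) (steps b)
    where
    eq : ∀ k → 1 + (1 + (k + 1)) ≡ k + 3
    eq = solve-∀
    steps : ∀ b {m c x y} → grab b ⊢ st b (tok d m) c x y ⇓≤[ 1 + (1 + (5 * sz d + 1)) ] st b m c (revtok d x) y
    steps false = seq≤ push≤ (seq≤ push≤ (grab-tree false d (exit≤ refl)))
    steps true = seq≤ push≤ (seq≤ push≤ (grab-tree true d (exit≤ refl)))

  eachBody : (Tok → Cmd) → Maybe Tok → Maybe Cmd
  eachBody f nothing = nothing
  eachBody f (just a) = just (f a)

  each : Fin 4 → (Tok → Cmd) → Cmd
  each i f = loop i (eachBody f)

  pour : Fin 4 → Fin 4 → Cmd
  pour i j = each i (push j)

  loop-cost : ∀ k n → suc k + (suc k * n + 1) ≡ suc k * suc n + 1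
  loop-cost = solve-∀

  pourM-run : ∀ b x {m c y} → pour (aux b) sM ⊢ st b m c x y ⇓≤[ 2 * length x + 1 ] st b (x ʳ++ m) c [] y
  pourM-run false [] = exit≤ refl
  pourM-run true [] = exit≤ refl
  pourM-run false (a ∷ x) = weak≤ (≤-reflexive (loop-cost 1 (length x))) (loop≤ refl push≤ (pourM-run false x))
  pourM-run true (a ∷ x) = weak≤ (≤-reflexive (loop-cost 1 (length x))) (loop≤ refl push≤ (pourM-run true x))

  pourX-run : ∀ b x {m c y} → pour (aux b) (aux (not b)) ⊢ st b m c x y ⇓≤[ 2 * length x + 1 ] st b m c [] (x ʳ++ y)
  pourX-run false [] = exit≤ refl
  pourX-run true [] = exit≤ refl
  pourX-run false (a ∷ x) = weak≤ (≤-reflexive (loop-cost 1 (length x))) (loop≤ refl push≤ (pourX-run false x))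
  pourX-run true (a ∷ x) = weak≤ (≤-reflexive (loop-cost 1 (length x))) (loop≤ refl push≤ (pourX-run true x))

  clear : Bool → Cmd
  clear b = each (aux b) (λ _ → skip)

  clear-run : ∀ b x {m c y} → clear b ⊢ st b m c x y ⇓≤[ 2 * length x + 1 ] st b m c [] y
  clear-run false [] = exit≤ refl
  clear-run true [] = exit≤ refl
  clear-run false (a ∷ x) = weak≤ (≤-reflexive (loop-cost 1 (length x))) (loop≤ refl skip≤ (clear-run false x))
  clear-run true (a ∷ x) = weak≤ (≤-reflexive (loop-cost 1 (length x))) (loop≤ refl skip≤ (clear-run true x))

  unloadM-run : ∀ b d {m c y} → pour (aux b) sM ⊢ st b m c (revtok d []) y ⇓≤[ 2 * sz d + 1 ] st b (tok d m) c [] y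
  unloadM-run b d {m} {c} {y} = cast≤ (cong (λ k → 2 * k + 1) (length-revtok-[] d))
    (cong (λ z → st b z c [] y) (revtok-ʳ++ d [] m)) (pourM-run b (revtok d []))

  clearTree-run : ∀ b d {m c y} → clear b ⊢ st b m c (revtok d []) y ⇓≤[ 2 * sz d + 1 ] st b m c [] y
  clearTree-run b d = cast≤ (cong (λ k → 2 * k + 1) (length-revtok-[] d)) refl (clear-run b (revtok d []))

  swap : Cmd
  swap = grab false ⨾ grab true ⨾ pour (aux false) sM ⨾ pour (aux true) sM

  swap-run : ∀ d e {m c} → swap ⊢ main (tok d (tok e m)) c ⇓≤[ 8 * (sz d + sz e) + 8 ] main (tok e (tok d m)) c
  swap-run d e {m} {c} = weak≤ (≤-by (sz d + sz e) (eq (sz d) (sz e)))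
    (seq≤ (grab-run false d) (seq≤ (grab-run true e)
      (seq≤ (unloadM-run false d) (unloadM-run true e))))
    where
    eq : ∀ d e → 5 * d + 3 + (5 * e + 3 + (2 * d + 1 + (2 * e + 1))) + (d + e) ≡ 8 * (d + e) + 8
    eq = solve-∀

  drop : Cmd
  drop = grab false ⨾ clear false

  drop-run : ∀ d {m c} → drop ⊢ main (tok d m) c ⇓≤[ 8 * sz d + 4 ] main m c
  drop-run d = weak≤ (≤-by (sz d) (eq (sz d))) (seq≤ (grab-run false d) (clearTree-run false d))
    where
    eq : ∀ d → 5 * d + 3 + (2 * d + 1) + d ≡ 8 * d + 4
    eq = solve-∀

  nip : Cmd
  nip = grab false ⨾ grab true ⨾ clear true ⨾ pour (aux false) sM

  nip-run : ∀ d e {m c} → nip ⊢ main (tok d (tok e m)) c ⇓≤[ 8 * (sz d + sz e) + 8 ] main (tok d m) c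
  nip-run d e {m} {c} = weak≤ (≤-by (sz d + sz e) (eq (sz d) (sz e)))
    (seq≤ (grab-run false d) (seq≤ (grab-run true e)
      (seq≤ (clearTree-run true e) (unloadM-run false d))))
    where
    eq : ∀ d e → 5 * d + 3 + (5 * e + 3 + (2 * e + 1 + (2 * d + 1))) + (d + e) ≡ 8 * (d + e) + 8
    eq = solve-∀

  fork : Cmd
  fork = each (aux false) (λ a → push sM a ⨾ push (aux true) a)

  fork-run : ∀ x {m c y} → fork ⊢ st false m c x y ⇓≤[ 3 * length x + 1 ] st false (x ʳ++ m) c [] (x ʳ++ y)
  fork-run [] = exit≤ refl
  fork-run (a ∷ x) = weak≤ (≤-reflexive (loop-cost 2 (length x))) (loop≤ refl (seq≤ push≤ push≤) (fork-run x))

  -- Grabbing reverses the tokens. `fork` restores one copy on the main stack and leaves another in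
  -- forward order, which has to be reversed once more before it can be poured back.
  dup : Cmd
  dup = grab false ⨾ fork ⨾ pour (aux true) (aux false) ⨾ pour (aux false) sM

  dup-run : ∀ d {m c} → dup ⊢ main (tok d m) c ⇓≤[ 12 * sz d + 6 ] main (tok d (tok d m)) c
  dup-run d {m} {c} = weak≤ (≤-reflexive (eq (sz d)))
    (seq≤ (grab-run false d) (seq≤ fork-tree (seq≤ back-tree (unloadM-run false d))))
    where
    eq : ∀ d → 5 * d + 3 + (3 * d + 1 + (2 * d + 1 + (2 * d + 1))) ≡ 12 * d + 6
    eq = solve-∀
    fork-tree : fork ⊢ st false m c (revtok d []) [] ⇓≤[ 3 * sz d + 1 ] st false (tok d m) c [] (tok d [])
    fork-tree = cast≤ (cong (λ k → 3 * k + 1) (length-revtok-[] d))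
      (cong₂ (λ z w → st false z c [] w) (revtok-ʳ++ d [] m) (revtok-ʳ++ d [] [])) (fork-run (revtok d []))
    back-tree : pour (aux true) (aux false) ⊢ st true (tok d m) c (tok d []) [] ⇓≤[ 2 * sz d + 1 ] st true (tok d m) c [] (revtok d [])
    back-tree = cast≤ (cong (λ k → 2 * k + 1) (length-tok-[] d))
      (cong (st true (tok d m) c []) (tok-ʳ++ d [] [])) (pourX-run true (tok d []))

  -- Polynomial-time functions

  -- A frame property: whatever lies below the argument and on the counter stack is preserved and
  -- does not affect the cost. This is what allows programs to be nested in pairs and loops.
  record PT (a b : Ty) (f : ⟦ a ⟧ → ⟦ b ⟧) : Set where
    field
      cmd : Cmd
      pol : Pol
      exe : ∀ x m c → cmd ⊢ main (tok (toD a x) m) c ⇓≤[ fn pol (size′ a x) ] main (tok (toD b (f x)) m) c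

  open PT

  outP : ∀ {a b f} → PT a b f → Pol
  outP P = X ⊕ pol P

  -- Running on otherwise empty stacks, the result is a stack whose length is bounded by input size
  -- plus time. No separate size analysis is needed for compositions.
  out-size : ∀ {a b f} (P : PT a b f) x → size′ b (f x) ≤ fn (outP P) (size′ a x)
  out-size {a} {b} {f} P x with exe P x [] []
  ... | t , t≤ , r = begin
    sz (toD b (f x))                    ≡⟨ length-tok-[] (toD b (f x)) ⟨
    length (tok (toD b (f x)) [])       ≤⟨ ⇓-length r F.zero ⟩
    length (tok (toD a x) []) + t       ≤⟨ +-mono-≤ (≤-reflexive (length-tok-[] (toD a x))) t≤ ⟩
    fn (outP P) (size′ a x) ∎
    where open ≤-Reasoning

  pt-ext : ∀ {a b f g} → PT a b f → (∀ x → f x ≡ g x) → PT a b g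
  cmd (pt-ext P e) = cmd P
  pol (pt-ext P e) = pol P
  exe (pt-ext {b = b} P e) x m c = cast≤ refl (cong (λ z → main (tok (toD b z) m) c) (e x)) (exe P x m c)

  pt-id : ∀ {a} → PT a a id
  cmd pt-id = skip
  pol pt-id = K 1
  exe pt-id x m c = skip≤

  _⊙_ : ∀ {a b d f g} → PT b d g → PT a b f → PT a d (λ x → g (f x))
  cmd (Q ⊙ P) = cmd P ⨾ cmd Q
  pol (Q ⊙ P) = pol P ⊕ (pol Q ⊚ outP P)
  exe (Q ⊙ P) x m c = seq≤ (exe P x m c) (weak≤ (mono (pol Q) (out-size P x)) (exe Q _ m c))

  infixr 9 _⊙_

  pt-pair : ∀ {a b d f g} → PT a b f → PT a d g → PT a (b ⊠ d) (λ x → f x , g x)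
  cmd (pt-pair P Q) = dup ⨾ cmd P ⨾ swap ⨾ cmd Q ⨾ swap ⨾ push sM tI
  pol (pt-pair P Q) = K 12 ⊗ X ⊕ K 6 ⊕ (pol P ⊕ (K 8 ⊗ (outP P ⊕ X) ⊕ K 8 ⊕ (pol Q ⊕ (K 8 ⊗ (outP Q ⊕ outP P) ⊕ K 8 ⊕ K 1))))
  exe (pt-pair {a} {b} {d} {f} {g} P Q) x m c =
    seq≤ (dup-run (toD a x)) (seq≤ (exe P x _ c) (seq≤
      (weak≤ (+-monoˡ-≤ 8 (*-monoʳ-≤ 8 (+-monoˡ-≤ (size′ a x) (out-size P x)))) (swap-run (toD b (f x)) (toD a x)))
      (seq≤ (exe Q x _ c) (seq≤
        (weak≤ (+-monoˡ-≤ 8 (*-monoʳ-≤ 8 (+-mono-≤ (out-size Q x) (out-size P x)))) (swap-run (toD d (g x)) (toD b (f x))))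
        push≤))))

  pt-fst : ∀ {a b} → PT (a ⊠ b) a proj₁
  cmd pt-fst = case sM (λ _ → nip)
  pol pt-fst = K 8 ⊗ X ⊕ K 1
  exe (pt-fst {a} {b}) (x , y) m c = weak≤ (≤-reflexive (eq (size′ a x + size′ b y))) (case≤ (nip-run (toD a x) (toD b y)))
    where
    eq : ∀ n → suc (8 * n + 8) ≡ 8 * suc n + 1
    eq = solve-∀

  pt-snd : ∀ {a b} → PT (a ⊠ b) b proj₂
  cmd pt-snd = case sM (λ _ → drop)
  pol pt-snd = K 8 ⊗ X
  exe (pt-snd {a} {b}) (x , y) m c = weak≤ (≤-by (8 * size′ b y + 3) (eq (size′ a x) (size′ b y))) (case≤ (drop-run (toD a x)))
    where
    eq : ∀ n k → suc (8 * n + 4) + (8 * k + 3) ≡ 8 * suc (n + k)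
    eq = solve-∀

  pushTree : D → Cmd
  pushTree nil = push sM tO
  pushTree (d · e) = pushTree e ⨾ pushTree d ⨾ push sM tI

  pushTree-run : ∀ d {m c} → pushTree d ⊢ main m c ⇓≤[ sz d ] main (tok d m) c
  pushTree-run nil = push≤
  pushTree-run (d · e) = weak≤ (≤-reflexive (eq (sz d) (sz e)))
    (seq≤ (pushTree-run e) (seq≤ (pushTree-run d) push≤))
    where
    eq : ∀ d e → e + (d + 1) ≡ suc (d + e)
    eq = solve-∀

  pt-const : ∀ {a} b (v : ⟦ b ⟧) → PT a b (λ _ → v)
  cmd (pt-const b v) = drop ⨾ pushTree (toD b v)
  pol (pt-const b v) = K 8 ⊗ X ⊕ K 4 ⊕ K (size′ b v)
  exe (pt-const {a} b v) x m c = seq≤ (drop-run (toD a x)) (pushTree-run (toD b v))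

  pt-cons : ∀ {a} → PT (a ⊠ list a) (list a) (λ p → proj₁ p ∷ proj₂ p)
  cmd pt-cons = skip
  pol pt-cons = K 1
  exe pt-cons x m c = skip≤

  pt-suc : PT nat nat suc
  cmd pt-suc = push sM tO ⨾ push sM tI
  pol pt-suc = K 2
  exe pt-suc x m c = seq≤ push≤ push≤

  caseLCmd : Cmd → Cmd → Maybe Tok → Cmd
  caseLCmd z s (just tI) = push sM tI ⨾ push sM tI ⨾ s
  caseLCmd z s _ = z

  pt-caseL : ∀ {a b d z s} → PT b d z → PT ((a ⊠ list a) ⊠ b) d s → PT (list a ⊠ b) d (caseL z s)
  cmd (pt-caseL Z S) = case sM (λ _ → case sM (caseLCmd (cmd Z) (cmd S)))
  pol (pt-caseL Z S) = K 4 ⊕ (pol Z ⊕ pol S)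
  exe (pt-caseL {a} {b} Z S) ([] , y) m c = weak≤
    (+-mono-≤ {2} {4} (s≤s (s≤s z≤n)) (≤-trans (mono (pol Z) (≤-trans (n≤1+n _) (n≤1+n _))) (m≤m+n _ _)))
    (case≤ (case≤ (exe Z y m c)))
  exe (pt-caseL {a} {b} Z S) (x ∷ xs , y) m c = weak≤
    (+-monoʳ-≤ 4 (m≤n+m _ (fn (pol Z) _)))
    (case≤ (case≤ (seq≤ push≤ (seq≤ push≤ (exe S ((x , xs) , y) m c)))))

  caseNCmd : Cmd → Cmd → Maybe Tok → Cmd
  caseNCmd z s (just tI) = case sM (λ _ → push sM tI ⨾ s)
  caseNCmd z s _ = z

  pt-caseN : ∀ {b d z s} → PT b d z → PT (nat ⊠ b) d s → PT (nat ⊠ b) d (caseN z s)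
  cmd (pt-caseN Z S) = case sM (λ _ → case sM (caseNCmd (cmd Z) (cmd S)))
  pol (pt-caseN Z S) = K 4 ⊕ (pol Z ⊕ pol S)
  exe (pt-caseN {b} Z S) (zero , y) m c = weak≤
    (+-mono-≤ {2} {4} (s≤s (s≤s z≤n)) (≤-trans (mono (pol Z) (≤-trans (n≤1+n _) (n≤1+n _))) (m≤m+n _ _)))
    (case≤ (case≤ (exe Z y m c)))
  exe (pt-caseN {b} Z S) (suc n , y) m c = weak≤
    (+-monoʳ-≤ 4 (≤-trans (mono (pol S) (≤-by 2 (eq (size′ nat n) (size′ b y)))) (m≤n+m _ (fn (pol Z) _))))
    -- The third pop removes the leaf that a successor carries in front of its predecessor.
    (case≤ (case≤ (case≤ (seq≤ push≤ (exe S (n , y) m c)))))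
    where
    eq : ∀ n k → suc (n + k) + 2 ≡ suc (suc (1 + n) + k)
    eq = solve-∀

  caseBCmd : Cmd → Cmd → Maybe Tok → Cmd
  caseBCmd f g (just tI) = case sM (λ _ → case sM (λ _ → f))
  caseBCmd f g _ = g

  pt-caseB : ∀ {b d f g} → PT b d f → PT b d g → PT (bool ⊠ b) d (λ p → if proj₁ p then f (proj₂ p) else g (proj₂ p))
  cmd (pt-caseB P Q) = case sM (λ _ → case sM (caseBCmd (cmd P) (cmd Q)))
  pol (pt-caseB P Q) = K 4 ⊕ (pol P ⊕ pol Q)
  exe (pt-caseB {b} P Q) (true , y) m c = weak≤
    (+-monoʳ-≤ 4 (≤-trans (mono (pol P) (m≤n+m (size′ b y) 4)) (m≤m+n _ _)))
    (case≤ (case≤ (case≤ (case≤ (exe P y m c)))))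
  exe (pt-caseB {b} P Q) (false , y) m c = weak≤
    (+-mono-≤ {2} {4} (s≤s (s≤s z≤n)) (≤-trans (mono (pol Q) (m≤n+m (size′ b y) 2)) (m≤n+m _ (fn (pol P) _))))
    (case≤ (case≤ (exe Q y m c)))

  unaryBody : Maybe Tok → Maybe Cmd
  unaryBody (just tI) = just (case sM (λ _ → push sC tI))
  unaryBody _ = nothing

  iterBody : Cmd → Maybe Tok → Maybe Cmd
  iterBody c (just tI) = just c
  iterBody c _ = nothing

  ones : ℕ → List Tok → List Tok
  ones zero c = c
  ones (suc n) c = tI ∷ ones n c

  ones-tI : ∀ n c → ones n (tI ∷ c) ≡ tI ∷ ones n c
  ones-tI zero c = refl
  ones-tI (suc n) c = cong (tI ∷_) (ones-tI n c)

  unary-run : ∀ n {m c} → loop sM unaryBody ⊢ main (tok (toD nat n) m) c ⇓≤[ 3 * n + 1 ] main m (ones n c)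
  unary-run zero = exit≤ refl
  unary-run (suc n) {m} {c} = weak≤ (≤-reflexive (loop-cost 2 n)) (loop≤ refl (case≤ push≤)
    (cast≤ refl (cong (main m) (ones-tI n c)) (unary-run n)))

  iter-run : ∀ {a f} (P : PT a a f) n x W {m c} → (∀ i → i ≤ n → size′ a (iter f i x) ≤ W) →
    loop sC (iterBody (cmd P)) ⊢ main (tok (toD a x) m) (ones n (tO ∷ c)) ⇓≤[ n * suc (fn (pol P) W) + 1 ]
      main (tok (toD a (iter f n x)) m) c
  iter-run P zero x W h = exit≤ refl
  iter-run {f = f} P (suc n) x W h = weak≤ (≤-reflexive (eq n (fn (pol P) W)))
    (loop≤ refl (weak≤ (mono (pol P) (h 0 z≤n)) (exe P x _ _)) (iter-run P n (f x) W (λ i i≤n → h (suc i) (s≤s i≤n))))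
    where
    eq : ∀ n k → suc k + (n * suc k + 1) ≡ suc n * suc k + 1
    eq = solve-∀

  n≤size : ∀ n → n ≤ size′ nat n
  n≤size zero = z≤n
  n≤size (suc n) = s≤s (≤-trans (n≤size n) (n≤1+n _))

  -- Repeated squaring of sizes is excluded by the bound `B` on all intermediate values. The count
  -- moves in unary onto the counter stack above a fresh `tO`, which separates it from the counters
  -- of enclosing loops.
  pt-iter : ∀ {a f} → PT a a f → (B : Pol) →
    (∀ n x i → i ≤ n → size′ a (iter f i x) ≤ fn B (size′ (nat ⊠ a) (n , x))) →
    PT (nat ⊠ a) a (λ p → iter f (proj₁ p) (proj₂ p))
  cmd (pt-iter P B h) = case sM (λ _ → push sC tO ⨾ loop sM unaryBody ⨾ loop sC (iterBody (cmd P)))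
  pol (pt-iter P B h) = K 2 ⊕ ((K 3 ⊗ X ⊕ K 1) ⊕ (X ⊗ (K 1 ⊕ (pol P ⊚ B)) ⊕ K 1))
  exe (pt-iter {a} P B h) (n , x) m c = weak≤
    (+-monoʳ-≤ 2 (+-mono-≤ (+-monoˡ-≤ 1 (*-monoʳ-≤ 3 n≤)) (+-monoˡ-≤ 1 (*-monoˡ-≤ (suc (fn (pol P) W)) n≤))))
    (case≤ (seq≤ push≤ (seq≤ (unary-run n) (iter-run P n x W (h n x)))))
    where
    W = fn B (size′ (nat ⊠ a) (n , x))
    n≤ : n ≤ size′ (nat ⊠ a) (n , x)
    n≤ = ≤-trans (n≤size n) (≤-trans (m≤m+n _ _) (n≤1+n _))

  tally : Cmd
  tally = each (aux false) (λ _ → push sM tO ⨾ push sM tI)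

  tally-run : ∀ x n {m c} → tally ⊢ st false (tok (toD nat n) m) c x [] ⇓≤[ 3 * length x + 1 ] main (tok (toD nat (length x + n)) m) c
  tally-run [] n = exit≤ refl
  tally-run (a ∷ x) n {m} {c} = weak≤ (≤-reflexive (loop-cost 2 (length x))) (loop≤ refl (seq≤ push≤ push≤)
    (cast≤ refl (cong (λ k → main (tok (toD nat k) m) c) (+-suc (length x) n)) (tally-run x (suc n))))

  -- Supplies the clock of `pt-fold`: the size of a value bounds the length of every list inside it.
  pt-size : ∀ {a} → PT a nat (size′ a)
  cmd pt-size = grab false ⨾ push sM tO ⨾ tally
  pol pt-size = K 5 ⊗ X ⊕ K 3 ⊕ (K 1 ⊕ (K 3 ⊗ X ⊕ K 1))
  exe (pt-size {a}) x m c = seq≤ (grab-run false d) (seq≤ push≤ (cast≤ (cong (λ k → 3 * k + 1) (length-revtok-[] d))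
    (cong (λ k → main (tok (toD nat k) m) c) (trans (+-identityʳ _) (length-revtok-[] d))) (tally-run (revtok d []) 0)))
    where
    d = toD a x

  -- Conversion between raw bit strings and trees

  unlistBit : Maybe Tok → Cmd
  unlistBit (just tI) = case sM (λ _ → case sM (λ _ → push (aux false) tI))
  unlistBit _ = push (aux false) tO

  unlistBody : Maybe Tok → Maybe Cmd
  unlistBody (just tI) = just (case sM unlistBit)
  unlistBody _ = nothing

  unlist : Cmd
  unlist = loop sM unlistBody

  unlist-run : ∀ x {m c a b} → unlist ⊢ st false (tok (toD bits x) m) c a b ⇓≤[ 5 * length x + 1 ]
    st false m c (map bitTok x ʳ++ a) b
  unlist-run [] = exit≤ refl
  unlist-run (false ∷ x) = weak≤ (≤-by 2 (eq (length x)))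
    (loop≤ refl (case≤ push≤) (unlist-run x))
    where
    eq : ∀ n → suc 2 + (5 * n + 1) + 2 ≡ 5 * suc n + 1
    eq = solve-∀
  unlist-run (true ∷ x) = weak≤ (≤-reflexive (eq (length x)))
    (loop≤ refl (case≤ (case≤ (case≤ push≤))) (unlist-run x))
    where
    eq : ∀ n → suc 4 + (5 * n + 1) ≡ 5 * suc n + 1
    eq = solve-∀

  relistBody : Maybe Tok → Maybe Cmd
  relistBody (just tO) = just (push sM tO ⨾ push sM tI)
  relistBody (just tI) = just (push sM tO ⨾ push sM tO ⨾ push sM tI ⨾ push sM tI)
  relistBody _ = nothing

  relistLoop relist : Cmd
  relistLoop = loop (aux false) relistBody
  relist = push sM tO ⨾ relistLoop

  relistLoop-run : ∀ y x {m c} → relistLoop ⊢ st false (tok (toD bits x) m) c (map bitTok y) [] ⇓≤[ 5 * length y + 1 ]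
    main (tok (toD bits (y ʳ++ x)) m) c
  relistLoop-run [] x = exit≤ refl
  relistLoop-run (false ∷ y) x = weak≤ (≤-by 2 (eq (length y)))
    (loop≤ refl (seq≤ push≤ push≤) (relistLoop-run y (false ∷ x)))
    where
    eq : ∀ n → suc 2 + (5 * n + 1) + 2 ≡ 5 * suc n + 1
    eq = solve-∀
  relistLoop-run (true ∷ y) x = weak≤ (≤-reflexive (eq (length y)))
    (loop≤ refl (seq≤ push≤ (seq≤ push≤ (seq≤ push≤ push≤))) (relistLoop-run y (true ∷ x)))
    where
    eq : ∀ n → suc 4 + (5 * n + 1) ≡ 5 * suc n + 1
    eq = solve-∀

  relist-run : ∀ x {m c} → relist ⊢ st false m c (map bitTok (reverse x)) [] ⇓≤[ 5 * length x + 2 ] main (tok (toD bits x) m) c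
  relist-run x {m} {c} = cast≤ (trans (cong (λ k → 1 + (5 * k + 1)) (length-reverse x)) (eq (length x)))
    (cong (λ z → main (tok (toD bits z) m) c) (trans (ʳ++-defn (reverse x)) (trans (++-identityʳ _) (reverse-involutive x))))
    (seq≤ push≤ (relistLoop-run (reverse x) []))
    where
    eq : ∀ n → 1 + (5 * n + 1) ≡ 5 * n + 2
    eq = solve-∀

  map-ʳ++-[] : ∀ (x : List Bool) → map bitTok x ʳ++ [] ≡ map bitTok (reverse x)
  map-ʳ++-[] x = sym (reverse-map bitTok x)

  reverse-bits-ʳ++ : ∀ x → reverse (map bitTok x) ʳ++ [] ≡ map bitTok x
  reverse-bits-ʳ++ x = trans (ʳ++-defn (reverse (map bitTok x))) (trans (++-identityʳ _) (reverse-involutive _))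

  pourMX : Cmd
  pourMX = pour sM (aux true)

  pourMX-run : ∀ x {c b} → pourMX ⊢ (x ∷ᵥ c ∷ᵥ [] ∷ᵥ b ∷ᵥ []ᵥ) ⇓≤[ 2 * length x + 1 ] ([] ∷ᵥ c ∷ᵥ [] ∷ᵥ (x ʳ++ b) ∷ᵥ []ᵥ)
  pourMX-run [] = exit≤ refl
  pourMX-run (a ∷ x) = weak≤ (≤-reflexive (loop-cost 1 (length x))) (loop≤ refl push≤ (pourMX-run x))

  -- The last input bit is initially on top. The first transfer frees the main stack but reverses
  -- the word; the second restores the order, since `relist` builds a list from its last element.
  readInput : Cmd
  readInput = pourMX ⨾ pour (aux true) (aux false) ⨾ relist

  readInput-run : ∀ x → readInput ⊢ inputStk x ⇓≤[ 9 * length x + 4 ] main (tok (toD bits x) []) []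
  readInput-run x = weak≤ (≤-reflexive (eq (length x)))
    (seq≤ first (seq≤ second (relist-run x)))
    where
    eq : ∀ n → 2 * n + 1 + (2 * n + 1 + (5 * n + 2)) ≡ 9 * n + 4
    eq = solve-∀
    first : pourMX ⊢ inputStk x ⇓≤[ 2 * length x + 1 ] st true [] [] (map bitTok x) []
    first = cast≤ (cong (λ k → 2 * k + 1) (trans (length-reverse (map bitTok x)) (length-map bitTok x)))
      (cong (λ z → st true [] [] z []) (reverse-bits-ʳ++ x)) (pourMX-run (reverse (map bitTok x)))
    second : pour (aux true) (aux false) ⊢ st true [] [] (map bitTok x) [] ⇓≤[ 2 * length x + 1 ] st false [] [] (map bitTok (reverse x)) []
    second = cast≤ (cong (λ k → 2 * k + 1) (length-map bitTok x))
      (cong (λ z → st false [] [] z []) (map-ʳ++-[] x)) (pourX-run true (map bitTok x))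

  writeOutput : Cmd
  writeOutput = unlist ⨾ pour (aux false) (aux true) ⨾ pour (aux true) sM

  writeOutput-run : ∀ y → writeOutput ⊢ main (tok (toD bits y) []) [] ⇓≤[ 9 * length y + 3 ] inputStk y
  writeOutput-run y = weak≤ (≤-reflexive (eq (length y)))
    (seq≤ (unlist-run y) (seq≤ second third))
    where
    eq : ∀ n → 5 * n + 1 + (2 * n + 1 + (2 * n + 1)) ≡ 9 * n + 3
    eq = solve-∀
    second : pour (aux false) (aux true) ⊢ st false [] [] (map bitTok y ʳ++ []) [] ⇓≤[ 2 * length y + 1 ] st false [] [] [] (map bitTok y)
    second = cast≤ (cong (λ k → 2 * k + 1) (trans (length-reverse (map bitTok y)) (length-map bitTok y)))
      (cong (st false [] [] []) (reverse-bits-ʳ++ y)) (pourX-run false (map bitTok y ʳ++ []))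
    third : pour (aux true) sM ⊢ st true [] [] (map bitTok y) [] ⇓≤[ 2 * length y + 1 ] inputStk y
    third = cast≤ (cong (λ k → 2 * k + 1) (length-map bitTok y)) refl (pourM-run true (map bitTok y))

  PT⇒PolyTime : ∀ {f} → PT bits bits f → PolyTime f
  PT⇒PolyTime {f} P = stack-PolyTime (readInput ⨾ cmd P ⨾ writeOutput)
    (K 9 ⊗ X ⊕ K 4 ⊕ ((pol P ⊚ S) ⊕ (K 9 ⊗ (outP P ⊚ S) ⊕ K 3))) f λ x →
      seq≤ (readInput-run x) (seq≤ (weak≤ (mono (pol P) (bits-size x)) (exe P x [] []))
        (weak≤ (+-monoˡ-≤ 3 (*-monoʳ-≤ 9 (≤-trans (size-bits (f x)) (≤-trans (out-size P x) (mono (outP P) (bits-size x))))))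
          (writeOutput-run (f x))))
    where
    S : Pol
    -- A bit takes at most three nodes plus one for its cons cell, and the list ends in a leaf.
    S = K 4 ⊗ X ⊕ K 1

  -- Calling the given machine

  loadSym : Maybe Tok → Maybe Cmd
  loadSym (just tO) = just (push (aux true) (tSym (encBit false)))
  loadSym (just tI) = just (push (aux true) (tSym (encBit true)))
  loadSym _ = nothing

  load : Cmd
  load = loop (aux false) loadSym

  load-run : ∀ x {m c b} → load ⊢ st false m c (map bitTok x) b ⇓≤[ 2 * length x + 1 ]
    st false m c [] (map (tSym ∘ encBit) x ʳ++ b)
  load-run [] = exit≤ refl
  load-run (false ∷ x) = weak≤ (≤-reflexive (loop-cost 1 (length x))) (loop≤ refl push≤ (load-run x))
  load-run (true ∷ x) = weak≤ (≤-reflexive (loop-cost 1 (length x))) (loop≤ refl push≤ (load-run x))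

  symOf : Maybe Tok → Sym (nΓ G)
  symOf (just (tSym s)) = s
  symOf _ = blank

  act : Fin (nQ G) × Sym (nΓ G) × Move → Cmd
  act (q , w , moveR) = push (aux false) (tSym w) ⨾ push sC (tSt q)
  act (q , w , stay) = push (aux true) (tSym w) ⨾ push sC (tSt q)
  act (q , w , moveL) = push (aux true) (tSym w) ⨾ case (aux false) (λ a → push (aux true) (tSym (symOf a))) ⨾ push sC (tSt q)

  stepBody : Maybe Tok → Maybe Cmd
  stepBody (just (tSt q)) = if halting G q then nothing else just (case (aux true) (λ a → act (δ G q (symOf a))))
  stepBody _ = nothing

  simLoop : Cmd
  simLoop = loop sC stepBody

  syms : List (Sym (nΓ G)) → List Tok
  syms = map tSym

  simStk : List Tok → List Tok → Config G → Stk
  simStk m c (cfg q l r) = st false m c (syms l) (syms r)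

  symOf-top : ∀ r → symOf (top (syms r)) ≡ hd r
  symOf-top [] = refl
  symOf-top (s ∷ r) = refl

  tl-syms : ∀ r → tl (syms r) ≡ syms (tl r)
  tl-syms [] = refl
  tl-syms (s ∷ r) = refl

  act-run : ∀ d l r {m c} → act d ⊢ st false m c (syms l) (syms (tl r)) ⇓≤[ 4 ]
    st false m (tSt (proj₁ d) ∷ c) (syms (proj₁ (move (proj₁ (proj₂ d)) (proj₂ (proj₂ d)) (l , r))))
      (syms (proj₂ (move (proj₁ (proj₂ d)) (proj₂ (proj₂ d)) (l , r))))
  act-run (q , w , moveL) [] r = seq≤ push≤ (seq≤ (case≤ push≤) push≤)
  act-run (q , w , moveL) (x ∷ l) r = seq≤ push≤ (seq≤ (case≤ push≤) push≤)
  act-run (q , w , moveR) l r = weak≤ (s≤s (s≤s z≤n)) (seq≤ push≤ push≤)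
  act-run (q , w , stay) l r = weak≤ (s≤s (s≤s z≤n)) (seq≤ push≤ push≤)

  -- The loop stops at the first halting state, possibly before time `t`; the configuration no
  -- longer changes after that, so the claim about time `t` still holds.
  sim-run : ∀ t q l r {m c} → halting G (state (run G t (cfg q l r))) ≡ true →
    simLoop ⊢ st false m (tSt q ∷ c) (syms l) (syms r) ⇓≤[ 6 * t + 1 ] simStk m c (run G t (cfg q l r))
  sim-run zero q l r h = exit≤ (halted (halting G q) h)
    where
    halted : ∀ b {c : Cmd} → b ≡ true → (if b then nothing else just c) ≡ nothing {A = Cmd}
    halted true refl = refl
  sim-run (suc t) q l r {m} {c} h = by-halting (halting G q) refl
    where
    q′ = proj₁ (δ G q (hd r))
    tp′ = move (proj₁ (proj₂ (δ G q (hd r)))) (proj₂ (proj₂ (δ G q (hd r)))) (l , r)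
    l′ = proj₁ tp′
    r′ = proj₂ tp′
    halted : ∀ b {c : Cmd} → b ≡ true → (if b then nothing else just c) ≡ nothing {A = Cmd}
    halted true refl = refl
    running : ∀ b {c : Cmd} → b ≡ false → (if b then nothing else just c) ≡ just {A = Cmd} c
    running false refl = refl
    cost : ∀ t → suc 5 + (6 * t + 1) ≡ 6 * suc t + 1
    cost = solve-∀
    by-halting : ∀ b → halting G q ≡ b → simLoop ⊢ st false m (tSt q ∷ c) (syms l) (syms r) ⇓≤[ 6 * suc t + 1 ]
      simStk m c (run G (suc t) (cfg q l r))
    by-halting true eq = weak≤ (m≤n+m 1 (6 * suc t))
      (cast≤ refl (cong (simStk m c) (sym (run-halted G (suc t) (cfg q l r) eq))) (exit≤ (halted (halting G q) eq)))
    by-halting false eq = weak≤ (≤-reflexive (cost t)) (loop≤ (running (halting G q) eq)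
      (case≤ (subst₂ (λ z w → act (δ G q z) ⊢ st false m c (syms l) w ⇓≤[ 4 ] st false m (tSt q′ ∷ c) (syms l′) (syms r′))
        (sym (symOf-top r)) (sym (tl-syms r)) (act-run (δ G q (hd r)) l r)))
      (cast≤ refl (cong (simStk m c ∘ run G t) (sym stepped)) (sim-run t q′ l′ r′ (trans (cong (λ z → halting G (state (run G t z))) (sym stepped)) h))))
      where
      stepped : step G (cfg q l r) ≡ cfg q′ l′ r′
      stepped = step-running G q l r eq refl

  outSym : Sym (nΓ G) → Maybe Cmd
  outSym F.zero = nothing
  outSym (F.suc F.zero) = just (push (aux false) tO)
  outSym (F.suc (F.suc F.zero)) = just (push (aux false) tI)
  outSym (F.suc (F.suc (F.suc _))) = nothing

  outBody : Maybe Tok → Maybe Cmd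
  outBody (just (tSym s)) = outSym s
  outBody _ = nothing

  unload : Cmd
  unload = loop (aux true) outBody

  -- Like `decodeOut`, the loop ends at the first symbol that is not a bit. The rest `b` of the tape
  -- stays behind and is cleared afterwards, at a cost bounded by its length.
  unload-run : ∀ r {m c a} → Σ (List Tok) λ b → length b ≤ length r ×
    unload ⊢ st false m c a (syms r) ⇓≤[ 2 * length r + 1 ] st false m c (map bitTok (decodeOut r) ʳ++ a) b
  unload-run [] = [] , z≤n , exit≤ refl
  unload-run (F.zero ∷ r) = syms r , ≤-trans (≤-reflexive (length-map tSym r)) (n≤1+n _) ,
    weak≤ (m≤n+m 1 (2 * suc (length r))) (exit≤ refl)
  unload-run (F.suc F.zero ∷ r) with unload-run r
  ... | b , b≤ , u = b , ≤-trans b≤ (n≤1+n _) ,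
    weak≤ (≤-reflexive (loop-cost 1 (length r))) (loop≤ refl push≤ u)
  unload-run (F.suc (F.suc F.zero) ∷ r) with unload-run r
  ... | b , b≤ , u = b , ≤-trans b≤ (n≤1+n _) ,
    weak≤ (≤-reflexive (loop-cost 1 (length r))) (loop≤ refl push≤ u)
  unload-run (F.suc (F.suc (F.suc _)) ∷ r) = syms r , ≤-trans (≤-reflexive (length-map tSym r)) (n≤1+n _) ,
    weak≤ (m≤n+m 1 (2 * suc (length r))) (exit≤ refl)

  length-decodeOut : ∀ (r : List (Sym (nΓ G))) → length (decodeOut r) ≤ length r
  length-decodeOut [] = z≤n
  length-decodeOut (F.zero ∷ r) = z≤n
  length-decodeOut (F.suc F.zero ∷ r) = s≤s (length-decodeOut r)
  length-decodeOut (F.suc (F.suc F.zero) ∷ r) = s≤s (length-decodeOut r)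
  length-decodeOut (F.suc (F.suc (F.suc _)) ∷ r) = z≤n

  callG : Cmd
  callG = unlist ⨾ load ⨾ push sC (tSt (start G)) ⨾ simLoop ⨾ clear false ⨾ unload ⨾ clear true ⨾ relist

  simP : Pol → Pol
  simP T = K 6 ⊗ T ⊕ K 1

  pt-call : ∀ {f} (T : Pol) → ComputesIn G f (fn T) → PT bits bits f
  cmd (pt-call T h) = callG
  pol (pt-call T h) = (K 5 ⊗ X ⊕ K 1) ⊕ ((K 2 ⊗ X ⊕ K 1) ⊕ (K 1 ⊕ (simP T ⊕ ((K 2 ⊗ (X ⊕ simP T) ⊕ K 1)
    ⊕ ((K 2 ⊗ (X ⊕ simP T) ⊕ K 1) ⊕ ((K 2 ⊗ (X ⊕ simP T) ⊕ K 1) ⊕ (K 5 ⊗ (X ⊕ simP T) ⊕ K 2)))))))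
  exe (pt-call {f} T h) x m c with h x
  ... | t , t≤ , halts , out = go (run G t (initial G x)) refl
    where
    N = size′ bits x
    W = N + fn (simP T) N
    bd* : ∀ a b {k} → k ≤ W → a * k + b ≤ a * W + b
    bd* a b h = +-monoˡ-≤ b (*-monoʳ-≤ a h)
    loaded : load ⊢ st false m c (map bitTok x ʳ++ []) [] ⇓≤[ 2 * N + 1 ] st false m c [] (syms (map encBit x))
    loaded = weak≤ (+-monoˡ-≤ 1 (*-monoʳ-≤ 2 (≤-trans (≤-reflexive (length-reverse x)) (size-bits x))))
      (subst₂ (λ z w → load ⊢ st false m c z [] ⇓≤[ 2 * length (reverse x) + 1 ] st false m c [] w)
        (sym (map-ʳ++-[] x)) back (load-run (reverse x)))
      where
      back : map (tSym ∘ encBit) (reverse x) ʳ++ [] ≡ syms (map encBit x)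
      back = trans (ʳ++-defn (map (tSym ∘ encBit) (reverse x))) (trans (++-identityʳ _)
        (trans (sym (reverse-map (tSym ∘ encBit) (reverse x)))
          (trans (cong (map (tSym ∘ encBit)) (reverse-involutive x)) (map-∘ x))))
    simmed : simLoop ⊢ st false m (tSt (start G) ∷ c) [] (syms (map encBit x)) ⇓≤[ fn (simP T) N ] simStk m c (run G t (initial G x))
    simmed = weak≤ (+-monoˡ-≤ 1 (*-monoʳ-≤ 6 (≤-trans t≤ (mono T (size-bits x))))) (sim-run t (start G) [] (map encBit x) halts)
    go : ∀ k → run G t (initial G x) ≡ k → callG ⊢ main (tok (toD bits x) m) c ⇓≤[ _ ] main (tok (toD bits (f x)) m) c
    go (cfg q l r) e with unload-run r {m} {c} {[]}
    ... | b , b≤ , u = seq≤ (weak≤ (+-monoˡ-≤ 1 (*-monoʳ-≤ 5 (size-bits x))) (unlist-run x)) (seq≤ loaded (seq≤ push≤ (seq≤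
        (cast≤ refl (cong (simStk m c) e) simmed)
        (seq≤ (weak≤ (bd* 2 1 l≤) (clear-run false (syms l)))
        (seq≤ (weak≤ (bd* 2 1 r≤) u)
        (seq≤ (weak≤ (bd* 2 1 (≤-trans b≤ r≤)) (clear-run true b))
          (subst₂ (λ z w → relist ⊢ st false m c z [] ⇓≤[ 5 * W + 2 ] main (tok (toD bits w) m) c)
            (sym (map-ʳ++-[] (decodeOut r))) out′
            (weak≤ (bd* 5 2 (≤-trans (length-decodeOut r) r≤)) (relist-run (decodeOut r))))))))))
      where
      out′ : decodeOut r ≡ f x
      out′ = trans (cong (decodeOut ∘ right) (sym e)) out
      simT = proj₁ simmed
      sim⇓ : simLoop ⊢ st false m (tSt (start G) ∷ c) [] (syms (map encBit x)) ⇓[ simT ] st false m c (syms l) (syms r)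
      sim⇓ = subst (λ z → simLoop ⊢ _ ⇓[ simT ] simStk m c z) e (proj₂ (proj₂ simmed))
      -- The final tape halves are bounded through the cost of the simulation that produced them.
      l≤ : length (syms l) ≤ W
      l≤ = ≤-trans (⇓-length sim⇓ (aux false)) (≤-trans (proj₁ (proj₂ simmed)) (m≤n+m _ N))
      r≤ : length r ≤ W
      r≤ = ≤-trans (≤-reflexive (sym (length-map tSym r))) (≤-trans (⇓-length sim⇓ (aux true))
        (+-mono-≤ (≤-trans (≤-reflexive (trans (length-map tSym (map encBit x)) (length-map encBit x))) (size-bits x)) (proj₁ (proj₂ simmed))))

  -- Folds, arithmetic and operations on words

  pt₂ : ∀ {a b c d f g h} → PT (b ⊠ c) d h → PT a b f → PT a c g → PT a d (λ x → h (f x , g x))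
  pt₂ H P Q = H ⊙ pt-pair P Q

  private
    module Fold {γ a b : Ty} {s : ⟦ γ ⊠ b ⊠ a ⟧ → ⟦ b ⟧} (P : PT (γ ⊠ b ⊠ a) b s) (q : Pol)
        (grow : ∀ g y x → size′ b (s (g , y , x)) ≤ size′ b y + fn q (size′ γ g + size′ a x)) where

      S : Ty
      S = γ ⊠ b ⊠ list a

      z : ⟦ γ ⊠ b ⟧ → ⟦ S ⟧
      z (g , y) = g , y , []

      c : ⟦ (a ⊠ list a) ⊠ γ ⊠ b ⟧ → ⟦ S ⟧
      c ((x , xs) , g , y) = g , s (g , y , x) , xs

      stp : ⟦ S ⟧ → ⟦ S ⟧
      stp (g , y , xs) = caseL z c (xs , g , y)

      pt-stp : PT S S stp
      pt-stp = pt-caseL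
        (pt-pair pt-fst (pt-pair pt-snd (pt-const (list a) [])))
        (pt-pair (pt-fst ⊙ pt-snd) (pt-pair
          (P ⊙ pt-pair (pt-fst ⊙ pt-snd) (pt-pair (pt-snd ⊙ pt-snd) (pt-fst ⊙ pt-fst)))
          (pt-snd ⊙ pt-fst)))
        ⊙ pt-pair (pt-snd ⊙ pt-snd) (pt-pair pt-fst (pt-fst ⊙ pt-snd))

      stp-size : ∀ i g y xs Q → fn q (size′ γ g + size′ (list a) xs) ≤ Q →
        size′ S (iter stp i (g , y , xs)) ≤ size′ S (g , y , xs) + i * Q
      stp-size zero g y xs Q h = m≤m+n _ 0
      stp-size (suc i) g y [] Q h = ≤-trans (stp-size i g y [] Q h) (+-monoʳ-≤ (size′ S (g , y , [])) (m≤n+m (i * Q) Q))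
      stp-size (suc i) g y (x ∷ xs) Q h = ≤-trans (stp-size i g (s (g , y , x)) xs Q
          (≤-trans (mono q (+-monoʳ-≤ (size′ γ g) (≤-trans (m≤n+m _ (size′ a x)) (n≤1+n _)))) h)) (≤-trans
        (+-monoˡ-≤ (i * Q) (s≤s (+-monoʳ-≤ (size′ γ g) (s≤s (+-monoˡ-≤ (size′ (list a) xs) (≤-trans (grow g y x)
          (+-monoʳ-≤ (size′ b y) (≤-trans (mono q (+-monoʳ-≤ (size′ γ g) (≤-trans (m≤m+n (size′ a x) _) (n≤1+n _)))) h))))))))
        (≤-by (suc (size′ a x)) (eq (size′ γ g) (size′ b y) (size′ a x) (size′ (list a) xs) Q (i * Q))))
        where
        eq : ∀ g y x xs Q iQ → suc (g + suc ((y + Q) + xs)) + iQ + suc x ≡ suc (g + suc (y + suc (x + xs))) + (Q + iQ)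
        eq = solve-∀

      stp-iter : ∀ n g y xs → length xs ≤ n →
        proj₁ (proj₂ (iter stp n (g , y , xs))) ≡ foldl (λ y x → s (g , y , x)) y xs
      stp-iter zero g y [] h = refl
      stp-iter (suc n) g y [] h = stp-iter n g y [] z≤n
      stp-iter (suc n) g y (x ∷ xs) (s≤s h) = stp-iter n g (s (g , y , x)) xs h

      length≤size : ∀ xs → length xs ≤ size′ (list a) xs
      length≤size [] = z≤n
      length≤size (x ∷ xs) = s≤s (≤-trans (length≤size xs) (m≤n+m _ (size′ a x)))

      pt-fold : PT S b (λ p → foldl (λ y x → s (proj₁ p , y , x)) (proj₁ (proj₂ p)) (proj₂ (proj₂ p)))
      -- The size of the whole state serves as the number of rounds: it is at least the length of
      -- the list, and `stp` idles on the empty list.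
      pt-fold = pt-ext ((pt-fst ⊙ pt-snd) ⊙ pt-iter pt-stp (X ⊕ X ⊗ q) bound ⊙ pt-pair pt-size pt-id)
        λ { (g , y , xs) → stp-iter (size′ S (g , y , xs)) g y xs (≤-trans (length≤size xs)
              (≤-trans (m≤n+m _ (size′ b y)) (≤-trans (n≤1+n _) (≤-trans (m≤n+m _ (size′ γ g)) (n≤1+n _))))) }
        where
        bound : ∀ n p i → i ≤ n → size′ S (iter stp i p) ≤ fn (X ⊕ X ⊗ q) (size′ (nat ⊠ S) (n , p))
        bound n (g , y , xs) i i≤n = ≤-trans
          (stp-size i g y xs _ (mono q (+-monoʳ-≤ (size′ γ g) (≤-trans (m≤n+m _ (size′ b y)) (n≤1+n _)))))
          (+-mono-≤ (≤-trans (m≤n+m _ (size′ nat n)) (n≤1+n _))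
            (*-mono-≤ (≤-trans i≤n (≤-trans (n≤size n) (≤-trans (m≤m+n _ _) (n≤1+n _))))
              (mono q (≤-trans (n≤1+n _) (≤-trans (m≤n+m _ (size′ nat n)) (n≤1+n _))))))

  -- The increment in the growth condition depends on the environment and the element but not on the
  -- accumulator. The total growth is then at most rounds times a fixed amount, whereas a step
  -- doubling its accumulator would grow exponentially.
  pt-fold : ∀ {γ a b s} → PT (γ ⊠ b ⊠ a) b s → (q : Pol) →
    (∀ g y x → size′ b (s (g , y , x)) ≤ size′ b y + fn q (size′ γ g + size′ a x)) →
    PT (γ ⊠ b ⊠ list a) b (λ p → foldl (λ y x → s (proj₁ p , y , x)) (proj₁ (proj₂ p)) (proj₂ (proj₂ p)))
  pt-fold P q grow = Fold.pt-fold P q grow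

  -- The environment of a fold that needs none.
  unit : ∀ {a} → PT a nat (λ _ → 0)
  unit = pt-const nat 0

  pt-reverse : ∀ {a} → PT (list a) (list a) reverse
  pt-reverse {a} = pt-fold {γ = nat} (pt-cons ⊙ pt-pair (pt-snd ⊙ pt-snd) (pt-fst ⊙ pt-snd)) (K 1 ⊕ X)
    (λ g y x → ≤-by (size′ nat g) (eq (size′ nat g) (size′ (list a) y) (size′ a x)))
    ⊙ pt-pair unit (pt-pair (pt-const (list a) []) pt-id)
    where
    eq : ∀ g y x → suc (x + y) + g ≡ y + (1 + (g + x))
    eq = solve-∀

  pt-append : ∀ {a} → PT (list a ⊠ list a) (list a) (λ p → proj₁ p ++ proj₂ p)
  pt-append {a} = pt-ext (pt-fold {γ = nat} (pt-cons ⊙ pt-pair (pt-snd ⊙ pt-snd) (pt-fst ⊙ pt-snd)) (K 1 ⊕ X)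
    (λ g y x → ≤-by (size′ nat g) (eq (size′ nat g) (size′ (list a) y) (size′ a x)))
    ⊙ pt-pair unit (pt-pair pt-snd (pt-reverse ⊙ pt-fst)))
    λ p → trans (ʳ++-defn (reverse (proj₁ p))) (cong (_++ proj₂ p) (reverse-involutive (proj₁ p)))
    where
    eq : ∀ g y x → suc (x + y) + g ≡ y + (1 + (g + x))
    eq = solve-∀

  -- Each step conses the counter itself, so the increment grows with the state. Hence a direct
  -- iteration with a quadratic bound: after `j` rounds there are `j` new numbers below `i + j`.
  pt-downFrom : PT nat (list nat) downFrom
  pt-downFrom = pt-ext (pt-snd ⊙ pt-iter {nat ⊠ list nat} {countStep} (pt-pair (pt-suc ⊙ pt-fst) pt-cons)
      (K 2 ⊕ K 2 ⊗ X ⊕ X ⊕ X ⊗ (K 2 ⊕ K 3 ⊗ X)) bound ⊙ pt-pair pt-id (pt-const (nat ⊠ list nat) (0 , [])))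
    λ n → cong proj₂ (trans (countStep-iter n 0) (cong (λ k → k , downFrom k) (+-identityʳ n)))
    where
    T = nat ⊠ list nat
    iter-size : ∀ j i l → size′ T (iter countStep j (i , l)) ≤ size′ T (i , l) + 2 * j + j * (2 * (i + j) + 2)
    iter-size zero i l = ≤-reflexive (eq (size′ T (i , l)))
      where
      eq : ∀ n → n ≡ n + 2 * 0 + 0
      eq = solve-∀
    iter-size (suc j) i l = ≤-trans (iter-size j (suc i) (i ∷ l))
        (≤-trans (≤-reflexive (cong (λ k → suc (suc (suc k) + suc (k + size′ (list nat) l)) + 2 * j + j * (2 * (suc i + j) + 2)) (size-nat i)))
        (≤-trans (≤-by (2 + 2 * j) (eq i j (size′ (list nat) l))) (≤-reflexive (cong (λ k → suc (k + size′ (list nat) l) + 2 * suc j + suc j * (2 * (i + suc j) + 2)) (sym (size-nat i))))))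
      where
      eq : ∀ i j l → suc (suc (suc (2 * i + 1)) + suc ((2 * i + 1) + l)) + 2 * j + j * (2 * (suc i + j) + 2) + (2 + 2 * j)
        ≡ suc ((2 * i + 1) + l) + 2 * suc j + suc j * (2 * (i + suc j) + 2)
      eq = solve-∀
    bound : ∀ n x i → i ≤ n → size′ T (iter countStep i x) ≤ fn (K 2 ⊕ K 2 ⊗ X ⊕ X ⊕ X ⊗ (K 2 ⊕ K 3 ⊗ X)) (size′ (nat ⊠ T) (n , x))
    bound n (k , l) i i≤n = ≤-trans (iter-size i k l) (≤-trans
      (+-mono-≤ (+-mono-≤ s≤N (*-monoʳ-≤ 2 i≤N)) (*-mono-≤ i≤N (+-monoˡ-≤ 2 (≤-trans (≤-reflexive (*-distribˡ-+ 2 k i)) (+-mono-≤ 2k≤N (*-monoʳ-≤ 2 i≤N))))))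
      (≤-by 2 (eq N)))
      where
      N = size′ (nat ⊠ T) (n , k , l)
      s≤N : size′ T (k , l) ≤ N
      s≤N = ≤-trans (m≤n+m _ (size′ nat n)) (n≤1+n _)
      i≤N : i ≤ N
      i≤N = ≤-trans i≤n (≤-trans (n≤size n) (≤-trans (m≤m+n _ _) (n≤1+n _)))
      2k≤N : 2 * k ≤ N
      2k≤N = ≤-trans (≤-trans (m≤m+n (2 * k) 1) (≤-reflexive (sym (size-nat k)))) (≤-trans (≤-trans (m≤m+n _ _) (n≤1+n _)) s≤N)
      eq : ∀ N → N + 2 * N + N * (N + 2 * N + 2) + 2 ≡ 2 + 2 * N + N + N * (2 + 3 * N)
      eq = solve-∀

  pt-nfold : ∀ {γ b s} → PT (γ ⊠ b) b s → (q : Pol) →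
    (∀ g y → size′ b (s (g , y)) ≤ size′ b y + fn q (size′ γ g)) →
    PT (γ ⊠ b ⊠ nat) b (λ p → iter (λ y → s (proj₁ p , y)) (proj₂ (proj₂ p)) (proj₁ (proj₂ p)))
  pt-nfold {γ} {b} {s} P q grow = pt-ext
    (pt-fold {a = nat} (P ⊙ pt-pair pt-fst (pt-fst ⊙ pt-snd)) q
      (λ g y x → ≤-trans (grow g y) (+-monoʳ-≤ (size′ b y) (mono q (m≤m+n _ _))))
      ⊙ pt-pair pt-fst (pt-pair (pt-fst ⊙ pt-snd) (pt-downFrom ⊙ pt-snd ⊙ pt-snd)))
    λ { (g , y , n) → trans (foldl-const (λ y → s (g , y)) (downFrom n) y)
      (cong (λ k → iter (λ y → s (g , y)) k y) (length-downFrom n)) }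

  pt-if : ∀ {a d f g h} → PT a bool h → PT a d f → PT a d g → PT a d (λ x → if h x then f x else g x)
  pt-if H P Q = pt-caseB P Q ⊙ pt-pair H pt-id

  pt-not : ∀ {a f} → PT a bool f → PT a bool (λ x → not (f x))
  pt-not {f = f} P = pt-ext (pt-if P (pt-const bool false) (pt-const bool true)) λ x → eq (f x)
    where
    eq : ∀ b → (if b then false else true) ≡ not b
    eq false = refl
    eq true = refl

  pt-and : ∀ {a f g} → PT a bool f → PT a bool g → PT a bool (λ x → f x ∧ g x)
  pt-and {f = f} {g} P Q = pt-ext (pt-if P Q (pt-const bool false)) λ x → eq (f x) (g x)
    where
    eq : ∀ b c → (if b then c else false) ≡ b ∧ c
    eq false c = refl
    eq true c = refl

  pt-or : ∀ {a f g} → PT a bool f → PT a bool g → PT a bool (λ x → f x ∨ g x)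
  pt-or {f = f} {g} P Q = pt-ext (pt-if P (pt-const bool true) Q) λ x → eq (f x) (g x)
    where
    eq : ∀ b c → (if b then true else c) ≡ b ∨ c
    eq false c = refl
    eq true c = refl

  size-bool-any : ∀ b y k → size′ bool b ≤ y + (3 + k)
  size-bool-any b y k = ≤-trans (size-bool b) (≤-trans (m≤m+n 3 k) (m≤n+m (3 + k) y))

  pt-any : ∀ {γ a p} → PT (γ ⊠ a) bool p → PT (γ ⊠ list a) bool (λ x → any (λ y → p (proj₁ x , y)) (proj₂ x))
  pt-any {γ} {a} {p} P = pt-ext (pt-fold {s = λ x → proj₁ (proj₂ x) ∨ p (proj₁ x , proj₂ (proj₂ x))}
      (pt-or (pt-fst ⊙ pt-snd) (P ⊙ pt-pair pt-fst (pt-snd ⊙ pt-snd))) (K 3 ⊕ X)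
      (λ g y x → size-bool-any (y ∨ p (g , x)) (size′ bool y) _)
      ⊙ pt-pair pt-fst (pt-pair (pt-const bool false) pt-snd))
    λ { (g , xs) → eq (λ y → p (g , y)) false xs }
    where
    ∨-assoc′ : ∀ a b c → (a ∨ b) ∨ c ≡ a ∨ (b ∨ c)
    ∨-assoc′ false b c = refl
    ∨-assoc′ true b c = refl
    ∨-false : ∀ b → b ≡ b ∨ false
    ∨-false false = refl
    ∨-false true = refl
    eq : ∀ (f : ⟦ a ⟧ → Bool) b xs → foldl (λ y x → y ∨ f x) b xs ≡ b ∨ any f xs
    eq f b [] = ∨-false b
    eq f b (x ∷ xs) = trans (eq f (b ∨ f x) xs) (∨-assoc′ b (f x) (any f xs))

  pt-all : ∀ {γ a p} → PT (γ ⊠ a) bool p → PT (γ ⊠ list a) bool (λ x → all (λ y → p (proj₁ x , y)) (proj₂ x))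
  pt-all {γ} {a} {p} P = pt-ext (pt-not (pt-any (pt-not P))) λ { (g , xs) → eq (λ y → p (g , y)) xs }
    where
    eq : ∀ (f : ⟦ a ⟧ → Bool) xs → not (any (λ y → not (f y)) xs) ≡ all f xs
    eq f [] = refl
    eq f (x ∷ xs) with f x
    ... | true = eq f xs
    ... | false = refl

  pt-gather : ∀ {γ a b h} → PT (γ ⊠ a) (list b) h → PT (γ ⊠ list a) (list b) (λ x → gather (λ y → h (proj₁ x , y)) (proj₂ x))
  pt-gather {γ} {a} {b} {h} P = pt-fold
      (pt₂ pt-append (P ⊙ pt-pair pt-fst (pt-snd ⊙ pt-snd)) (pt-fst ⊙ pt-snd)) (outP P ⊚ (K 1 ⊕ X))
      (λ g y x → ≤-trans (size-++ b (h (g , x)) y) (+-monoʳ-≤ (size′ (list b) y) (out-size P (g , x))))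
    ⊙ pt-pair pt-fst (pt-pair (pt-const (list b) []) pt-snd)

  pt-tabulateDown : ∀ {γ a f} → PT (γ ⊠ nat) a f → PT (γ ⊠ nat) (list a) (λ x → tabulateDown (λ i → f (proj₁ x , i)) (proj₂ x))
  pt-tabulateDown {γ} {a} {f} P = pt-fold {γ}
      (pt₂ pt-cons (P ⊙ pt-pair pt-fst (pt-snd ⊙ pt-snd)) (pt-fst ⊙ pt-snd)) (K 1 ⊕ (outP P ⊚ (K 1 ⊕ X)))
      (λ g y x → ≤-trans (s≤s (≤-trans (≤-reflexive (+-comm _ (size′ (list a) y))) (+-monoʳ-≤ (size′ (list a) y) (out-size P (g , x)))))
        (≤-reflexive (sym (+-suc _ _))))
    ⊙ pt-pair pt-fst (pt-pair (pt-const (list a) []) (pt-downFrom ⊙ pt-snd))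

  pt-add : PT (nat ⊠ nat) nat (λ p → proj₁ p + proj₂ p)
  pt-add = pt-ext (pt-nfold {nat} (pt-suc ⊙ pt-snd) (K 2) (λ g y → ≤-reflexive (+-comm 2 _))
      ⊙ pt-pair unit (pt-pair pt-snd pt-fst))
    λ { (m , n) → eq m n }
    where
    eq : ∀ m n → iter suc m n ≡ m + n
    eq zero n = refl
    eq (suc m) n = trans (eq m (suc n)) (+-suc m n)

  pt-plus : ∀ {a f g} → PT a nat f → PT a nat g → PT a nat (λ x → f x + g x)
  pt-plus P Q = pt₂ pt-add P Q

  size-+ : ∀ m n → size′ nat (m + n) ≤ size′ nat n + size′ nat m
  size-+ m n rewrite size-nat (m + n) | size-nat n | size-nat m = ≤-by 1 (eq m n)
    where
    eq : ∀ m n → 2 * (m + n) + 1 + 1 ≡ 2 * n + 1 + (2 * m + 1)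
    eq = solve-∀

  pt-sumTo : ∀ {γ h} → PT (γ ⊠ nat) nat h → PT (γ ⊠ nat) nat (λ p → sumTo (λ i → h (proj₁ p , i)) (proj₂ p))
  pt-sumTo {γ} {h} P = pt-ext (pt-fold {γ}
      (pt-plus (P ⊙ pt-pair pt-fst (pt-snd ⊙ pt-snd)) (pt-fst ⊙ pt-snd)) (outP P ⊚ (K 1 ⊕ X))
      (λ g y x → ≤-trans (size-+ (h (g , x)) y) (+-monoʳ-≤ (size′ nat y) (out-size P (g , x))))
      ⊙ pt-pair pt-fst (pt-pair unit (pt-downFrom ⊙ pt-snd)))
    λ { (g , n) → trans (eq (λ i → h (g , i)) n 0) (+-identityʳ _) }
    where
    eq : ∀ f n y → foldl (λ y i → f i + y) y (downFrom n) ≡ sumTo f n + y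
    eq f zero y = refl
    eq f (suc n) y = trans (eq f n (f n + y)) (arith (sumTo f n) (f n) y)
      where
      arith : ∀ s f y → s + (f + y) ≡ f + s + y
      arith = solve-∀

  pt-times : ∀ {a f g} → PT a nat f → PT a nat g → PT a nat (λ x → f x * g x)
  pt-times {f = f} {g} P Q = pt-ext (pt-sumTo {h = proj₁} pt-fst ⊙ pt-pair Q P) λ x → eq (g x) (f x)
    where
    eq : ∀ m n → sumTo (λ _ → m) n ≡ n * m
    eq m zero = refl
    eq m (suc n) = cong (m +_) (eq m n)

  pt-pow : ∀ c → PT nat nat (_^ c)
  pt-pow zero = pt-const nat 1
  pt-pow (suc c) = pt-times pt-id (pt-pow c)

  pt-polyBound : ∀ c → PT nat nat (polyBound c)
  pt-polyBound c = pt-plus (pt-times (pt-const nat c) (pt-pow c)) (pt-const nat c)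

  pt-length : ∀ {a} → PT (list a) nat length
  pt-length {a} = pt-ext (pt-fold {nat} {a} (pt-suc ⊙ pt-fst ⊙ pt-snd) (K 2) (λ g y x → ≤-reflexive (+-comm 2 _))
      ⊙ pt-pair unit (pt-pair unit pt-id))
    λ xs → trans (foldl-const suc xs 0) (trans (eq (length xs) 0) (+-identityʳ _))
    where
    eq : ∀ m n → iter suc m n ≡ m + n
    eq zero n = refl
    eq (suc m) n = trans (eq m (suc n)) (+-suc m n)

  pt-pred : PT nat nat pred
  pt-pred = pt-ext (pt-caseN {nat} unit pt-fst ⊙ pt-pair pt-id unit) λ { zero → refl ; (suc n) → refl }

  pt-isZero : PT nat bool isZero
  pt-isZero = pt-ext (pt-caseN {nat} (pt-const bool true) (pt-const bool false) ⊙ pt-pair pt-id unit)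
    λ { zero → refl ; (suc n) → refl }

  pt-∸ : PT (nat ⊠ nat) nat (λ p → proj₁ p ∸ proj₂ p)
  pt-∸ = pt-ext (pt-nfold {nat} (pt-pred ⊙ pt-snd) (K 0) (λ g y → grow y) ⊙ pt-pair unit pt-id)
    λ { (m , n) → eq m n }
    where
    grow : ∀ y → size′ nat (pred y) ≤ size′ nat y + 0
    grow zero = ≤-refl
    grow (suc y) = ≤-trans (≤-trans (n≤1+n _) (n≤1+n _)) (m≤m+n _ 0)
    eq : ∀ m n → iter pred n m ≡ m ∸ n
    eq m zero = refl
    eq zero (suc n) = trans (eq zero n) (0∸n≡0 n)
    eq (suc m) (suc n) = eq m n

  pt-leq : ∀ {a f g} → PT a nat f → PT a nat g → PT a bool (λ x → leq (f x) (g x))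
  pt-leq P Q = pt-isZero ⊙ pt₂ pt-∸ P Q

  pt-bitAt : PT (bits ⊠ nat) bool (λ p → bitAt (proj₁ p) (proj₂ p))
  pt-bitAt = pt-ext (pt-head ⊙ pt-nfold {nat} (pt-tl ⊙ pt-snd) (K 0) (λ g y → grow y) ⊙ pt-pair unit pt-id)
    λ { (xs , n) → eq n xs }
    where
    pt-tl : PT bits bits tl
    pt-tl = pt-ext (pt-caseL {b = nat} (pt-const bits []) (pt-snd ⊙ pt-fst) ⊙ pt-pair pt-id unit)
      λ { [] → refl ; (x ∷ xs) → refl }
    pt-head : PT bits bool headBit
    pt-head = pt-ext (pt-caseL {b = nat} (pt-const bool false) (pt-fst ⊙ pt-fst) ⊙ pt-pair pt-id unit)
      λ { [] → refl ; (x ∷ xs) → refl }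
    grow : ∀ y → size′ bits (tl y) ≤ size′ bits y + 0
    grow [] = ≤-refl
    grow (b ∷ y) = ≤-trans (≤-trans (m≤n+m _ (size′ bool b)) (n≤1+n _)) (m≤m+n _ 0)
    eq : ∀ n xs → headBit (iter tl n xs) ≡ bitAt xs n
    eq zero [] = refl
    eq zero (x ∷ xs) = refl
    eq (suc n) [] = empty n
      where
      empty : ∀ n → headBit (iter tl n []) ≡ false
      empty zero = refl
      empty (suc n) = empty n
    eq (suc n) (x ∷ xs) = eq n xs

  pt-eqBits : PT (bits ⊠ bits) bool (λ p → eqBits (proj₁ p) (proj₂ p))
  pt-eqBits = pt-if pt-fst (pt-null ⊙ pt-snd) (pt-const bool false)
    ⊙ pt-fold {nat} (pt-eqStep ⊙ pt-snd) (K 2) (λ g y x → grow y x)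
    ⊙ pt-pair unit (pt-pair (pt-pair (pt-const bool true) pt-snd) pt-fst)
    where
    pt-null : PT bits bool null
    pt-null = pt-ext (pt-caseL {b = nat} (pt-const bool true) (pt-const bool false) ⊙ pt-pair pt-id unit)
      λ { [] → refl ; (x ∷ xs) → refl }
    pt-eqBool : PT (bool ⊠ bool) bool (λ p → eqBool (proj₁ p) (proj₂ p))
    pt-eqBool = pt-if pt-fst pt-snd (pt-not pt-snd)
    pt-eqStep : PT ((bool ⊠ bits) ⊠ bool) (bool ⊠ bits) (λ p → eqStep (proj₁ p) (proj₂ p))
    pt-eqStep = pt-ext (pt-caseL {b = bool ⊠ bool} (pt-pair (pt-const bool false) (pt-const bits []))
        (pt-pair (pt-if (pt-fst ⊙ pt-snd) (pt-eqBool ⊙ pt-pair (pt-snd ⊙ pt-snd) (pt-fst ⊙ pt-fst)) (pt-const bool false)) (pt-snd ⊙ pt-fst))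
        ⊙ pt-pair (pt-snd ⊙ pt-fst) (pt-pair (pt-fst ⊙ pt-fst) pt-snd))
      λ { ((ok , []) , x) → refl ; ((ok , y ∷ ys) , x) → refl }
    grow : ∀ s x → size′ (bool ⊠ bits) (eqStep s x) ≤ size′ (bool ⊠ bits) s + 2
    grow (ok , []) x = ≤-trans (s≤s (+-monoˡ-≤ 1 (1≤sz (toD bool ok)))) (m≤m+n _ 2)
    grow (ok , y ∷ ys) x = ≤-trans (s≤s (+-mono-≤ (size-bool (if ok then eqBool x y else false)) (m≤n+m (size′ bits ys) (suc (size′ bool y)))))
      (≤-trans (≤-trans (≤-reflexive (eq (suc (size′ bool y) + size′ bits ys)))
        (s≤s (+-monoˡ-≤ 2 (+-monoˡ-≤ _ (1≤sz (toD bool ok)))))) ≤-refl)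
      where
      eq : ∀ n → suc (3 + n) ≡ suc (1 + n + 2)
      eq = solve-∀

  pt-memb : PT (bits ⊠ list bits) bool (λ p → memb (proj₁ p) (proj₂ p))
  pt-memb = pt-any pt-eqBits

  pt-halfOdd : PT nat (nat ⊠ bool) halfOdd
  pt-halfOdd = pt-nfold {nat} {nat ⊠ bool} (pt-halfStep ⊙ pt-snd) (K 2) (λ g y → grow y)
    ⊙ pt-pair unit (pt-pair (pt-const (nat ⊠ bool) (0 , false)) pt-id)
    where
    pt-halfStep : PT (nat ⊠ bool) (nat ⊠ bool) halfStep
    pt-halfStep = pt-if pt-snd (pt-pair (pt-suc ⊙ pt-fst) (pt-const bool false)) (pt-pair pt-fst (pt-const bool true))
    grow : ∀ s → size′ (nat ⊠ bool) (halfStep s) ≤ size′ (nat ⊠ bool) s + 2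
    grow (h , false) = ≤-reflexive (eq (size′ nat h))
      where
      eq : ∀ n → suc (n + 3) ≡ suc (n + 1) + 2
      eq = solve-∀
    grow (h , true) = ≤-by 2 (eq (size′ nat h))
      where
      eq : ∀ n → suc (suc (1 + n) + 1) + 2 ≡ suc (n + 3) + 2
      eq = solve-∀

  pt-bin : PT nat bits bin
  pt-bin = pt-ext (pt-snd ⊙ pt-nfold {nat} {nat ⊠ bits} (pt-binStep ⊙ pt-snd) (K 4) (λ g y → grow y)
      ⊙ pt-pair unit (pt-pair (pt-pair pt-id (pt-const bits [])) pt-id)) fastBin-≡
    where
    pt-binStep : PT (nat ⊠ bits) (nat ⊠ bits) binStep
    pt-binStep = pt-ext (pt-caseN (pt-pair unit pt-id)
        (pt-pair (pt-fst ⊙ pt-halfOdd ⊙ pt-suc ⊙ pt-fst) (pt-cons ⊙ pt-pair (pt-snd ⊙ pt-halfOdd ⊙ pt-suc ⊙ pt-fst) pt-snd)))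
      λ { (zero , acc) → refl ; (suc n , acc) → refl }
    size-nat-mono : ∀ {m n} → m ≤ n → size′ nat m ≤ size′ nat n
    size-nat-mono {m} {n} h rewrite size-nat m | size-nat n = +-monoˡ-≤ 1 (*-monoʳ-≤ 2 h)
    grow : ∀ s → size′ (nat ⊠ bits) (binStep s) ≤ size′ (nat ⊠ bits) s + 4
    grow (zero , acc) = m≤m+n _ 4
    grow (suc n , acc) = ≤-trans (s≤s (+-mono-≤ (size-nat-mono (halfOdd-≤ (suc n)))
        (s≤s (+-monoˡ-≤ (size′ bits acc) (size-bool (proj₂ (halfOdd (suc n))))))))
      (≤-reflexive (eq (size′ nat (suc n)) (size′ bits acc)))
      where
      eq : ∀ n a → suc (n + suc (3 + a)) ≡ suc (n + a) + 4
      eq = solve-∀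

  pt-rbin : PT nat bits rbin
  pt-rbin = pt-reverse ⊙ pt-bin

  pt-parseStep : PT (ParseTy ⊠ bool) ParseTy (λ p → parseStep (proj₁ p) (proj₂ p))
  pt-parseStep = pt-ext (pt-caseL {b = (bits ⊠ list bits) ⊠ bool}
      (pt-pair (pt-pair (pt-cons ⊙ pt-pair pt-snd (pt-const bits [])) (pt-fst ⊙ pt-fst)) (pt-snd ⊙ pt-fst))
      (pt-if (pt-if (pt-fst ⊙ pt-fst) (pt-not (pt-snd ⊙ pt-snd)) (pt-const bool false))
        (pt-pair (pt-const (bits ⊠ bits) ([] , [])) (pt-cons ⊙ pt-fst ⊙ pt-snd))
        (pt-pair (pt-pair (pt-const bits []) (pt-cons ⊙ pt-pair (pt-fst ⊙ pt-fst) (pt-fst ⊙ pt-fst ⊙ pt-snd))) (pt-snd ⊙ pt-fst ⊙ pt-snd)))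
      ⊙ pt-pair (pt-fst ⊙ pt-fst ⊙ pt-fst) (pt-pair (pt-pair (pt-snd ⊙ pt-fst ⊙ pt-fst) (pt-snd ⊙ pt-fst)) pt-snd))
    λ { ((([] , cur) , out) , b) → refl ; (((a ∷ _ , cur) , out) , b) → refl }

  pt-parse : PT bits (list bits) parse
  pt-parse = pt-snd ⊙ pt-fold {nat} {bool} {ParseTy} (pt-parseStep ⊙ pt-snd) (K 4 ⊕ X) parseStep-size
    ⊙ pt-pair unit (pt-pair (pt-const ParseTy (([] , []) , [])) pt-id)

  pt-triangle : PT nat nat triangle
  pt-triangle = pt-sumTo {nat} {proj₂} pt-snd ⊙ pt-pair unit pt-id

  pt-tetrahedral : PT nat nat tetrahedral
  pt-tetrahedral = pt-sumTo {nat} (pt-triangle ⊙ pt-snd) ⊙ pt-pair unit pt-id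

  pt-nd : PT nat nat nd
  pt-nd = pt-ext (pt-plus (pt-plus pt-dbl (pt-triangle ⊙ pt-dbl)) (pt-tetrahedral ⊙ pt-dbl)) (λ k → sym (nd-≡ k))
    where
    pt-dbl : PT nat nat (λ k → k + k)
    pt-dbl = pt-plus pt-id pt-id

-- Membership in NP

module Family (α : (k : ℕ) → Fin (nd k) → Clause k) (fam : AlphaFamily α) where

  α-surjective : ∀ k (s : Clause k) → 1 ≤ ∣ s ∣ → ∣ s ∣ ≤ 3 → Σ (Fin (nd k)) λ j → α k j ≡ s
  α-surjective = proj₁ (proj₂ (proj₂ fam))

  private
    computable = proj₂ (proj₂ (proj₂ (proj₂ fam)))

  g : List Bool → List Bool
  g = proj₁ computable

  G : TM
  G = proj₁ (proj₁ (proj₂ computable))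

  open Machine G

  pt-g : PT bits bits g
  pt-g = pt-call (polyBound-Pol (proj₁ (proj₂ (proj₁ (proj₂ computable))))) (proj₂ (proj₂ (proj₁ (proj₂ computable))))

  -- Descends to the least level that contains j, where g is specified.
  g-spec : ∀ k (j : Fin (nd k)) → g (bin (suc (toℕ j))) ≡ encClause {k} (α k j)
  g-spec zero ()
  g-spec (suc k) j with toℕ j <? nd k
  ... | yes h = trans (cong (λ i → g (bin (suc i))) (sym j₀-≡)) (trans (g-spec k j₀)
      (cong encNats (sym (proj₁ (proj₂ (proj₂ (proj₂ fam))) k j₀ j j₀-≡))))
    where
    j₀ = fromℕ< h
    j₀-≡ : toℕ j₀ ≡ toℕ j
    j₀-≡ = FP.toℕ-fromℕ< h
  ... | no h = proj₂ (proj₂ computable) (suc k) j λ k′ k′< → ≤-trans (nd-≤ (≤-pred k′<)) (≮⇒≥ h)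

  clauseAt : ℕ → List (List Bool)
  clauseAt j = parse (g (bin (suc j)))

  pt-clauseAt : PT nat (list bits) clauseAt
  pt-clauseAt = pt-parse ⊙ pt-g ⊙ pt-bin ⊙ pt-suc

  clauseAt-≡ : ∀ k (j : Fin (nd k)) → clauseAt (toℕ j) ≡ reverse (map rbin (members (α k j)))
  clauseAt-≡ k j = trans (cong parse (g-spec k j)) (parse-encNats (members (α k j)))

  ∈-clauseAt : ∀ k (j : Fin (nd k)) {m} → m ∈ₗ members (α k j) → rbin m ∈ₗ clauseAt (toℕ j)
  ∈-clauseAt k j m rewrite clauseAt-≡ k j = reverse⁺ (∈-map⁺ rbin m)

  clauseAt-∈ : ∀ k (j : Fin (nd k)) {w} → w ∈ₗ clauseAt (toℕ j) → Σ ℕ λ m → m ∈ₗ members (α k j) × w ≡ rbin m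
  clauseAt-∈ k j h rewrite clauseAt-≡ k j = ∈-map⁻ rbin (reverse⁻ h)

  -- Certificates are doubled assignments followed by 10.

  clauseOk : List (List Bool) → ℕ → Bool
  clauseOk lits j = any (λ w → memb w lits) (clauseAt j)

  -- The level is not computed: the assignment has one bit per variable, and the two inequalities
  -- single out its length as the level by `level-unique`.
  accepts : List Bool → List Bool → Bool
  accepts x a = leq (nd (length a)) (length x) ∧ (leq (suc (length x)) (nd (suc (length a))) ∧
    all (λ j → not (bitAt x j) ∨ clauseOk (trueLits a) j) (downFrom (nd (length a))))

  acceptsWords : List (List Bool) → Bool
  acceptsWords (a ∷ x ∷ []) = accepts (reverse x) (reverse a)
  acceptsWords _ = false

  verifier : List Bool → Bool
  verifier y = acceptsWords (parse y)

  pt-trueLits : PT bits (list bits) trueLits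
  pt-trueLits = pt-gather {bits} {nat} (pt-cons ⊙ pt-pair (pt-rbin ⊙
      pt-plus (pt-times (pt-const nat 2) pt-snd) (pt-if (pt-not pt-bitAt) (pt-const nat 1) (pt-const nat 0)))
      (pt-const (list bits) []))
    ⊙ pt-pair pt-id (pt-downFrom ⊙ pt-length)

  pt-clauseOk : PT (list bits ⊠ nat) bool (λ p → clauseOk (proj₁ p) (proj₂ p))
  pt-clauseOk = pt-any {list bits} {bits} (pt-memb ⊙ pt-pair pt-snd pt-fst) ⊙ pt-pair pt-fst (pt-clauseAt ⊙ pt-snd)

  pt-accepts : PT (bits ⊠ bits) bool (λ p → accepts (proj₁ p) (proj₂ p))
  pt-accepts = pt-and (pt-leq (pt-nd ⊙ pt-length ⊙ pt-snd) (pt-length ⊙ pt-fst))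
    (pt-and (pt-leq (pt-suc ⊙ pt-length ⊙ pt-fst) (pt-nd ⊙ pt-suc ⊙ pt-length ⊙ pt-snd))
      (pt-all {bits ⊠ list bits} {nat} (pt-or (pt-not (pt-bitAt ⊙ pt-pair (pt-fst ⊙ pt-fst) pt-snd))
          (pt-clauseOk ⊙ pt-pair (pt-snd ⊙ pt-fst) pt-snd))
        ⊙ pt-pair (pt-pair pt-fst (pt-trueLits ⊙ pt-snd)) (pt-downFrom ⊙ pt-nd ⊙ pt-length ⊙ pt-snd)))

  pt-acceptsWords : PT (list bits) bool acceptsWords
  pt-acceptsWords = pt-ext (pt-caseL {b = nat} (pt-const bool false)
      (pt-caseL {b = bits} (pt-const bool false)
        (pt-caseL {b = bits ⊠ bits} (pt-accepts ⊙ pt-pair (pt-reverse ⊙ pt-snd) (pt-reverse ⊙ pt-fst)) (pt-const bool false)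
          ⊙ pt-pair (pt-snd ⊙ pt-fst) (pt-pair pt-snd (pt-fst ⊙ pt-fst)))
        ⊙ pt-pair (pt-snd ⊙ pt-fst) (pt-fst ⊙ pt-fst))
      ⊙ pt-pair pt-id unit)
    λ { [] → refl ; (a ∷ []) → refl ; (a ∷ x ∷ []) → refl ; (a ∷ x ∷ z ∷ l) → refl }

  accepts-sound : ∀ x a → accepts x a ≡ true → ThreeSATC α x
  accepts-sound x a e with ≡true∧ {leq (nd (length a)) (length x)} e
  ... | lo , e′ with ≡true∧ {leq (suc (length x)) (nd (suc (length a)))} e′
  ... | hi , ok = subst (λ k → Sat α k x) (sym (level-unique (length a) (length x)
      (leq-true _ _ lo) (leq-true _ _ hi))) (σ , sat)
    where
    σ : Vec Bool (length a)
    σ = fromList a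
    sat : ∀ i → bitAt x (toℕ i) ≡ true → ClauseSat {length a} σ (α (length a) i)
    sat i b with all-true (downFrom (nd (length a))) ok (∈-downFrom (FP.toℕ<n i))
    ... | h rewrite b with any-true (clauseAt (toℕ i)) h
    ... | w , w∈ , wt with clauseAt-∈ (length a) i w∈
    ... | m , m∈ , refl with members-∈ (α (length a) i) m∈
    ... | p , p∈ , refl with trueLits-∈ σ {toℕ p} (subst (λ z → rbin (toℕ p) ∈ₗ trueLits z) (sym (toList∘fromList a)) (memb-true _ (trueLits a) wt))
    ... | q , q≡ , qt rewrite FP.toℕ-injective q≡ = p , p∈ , qt

  accepts-complete : ∀ x ((σ , _) : ThreeSATC α x) → accepts x (toList σ) ≡ true
  accepts-complete x (σ , sat) = subst (λ k → (leq (nd k) (length x) ∧ (leq (suc (length x)) (nd (suc k)) ∧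
      all (λ j → not (bitAt x j) ∨ clauseOk (trueLits (toList σ)) j) (downFrom (nd k)))) ≡ true)
    (sym (length-toList σ))
    (∧≡true (true-leq (proj₁ (level-spec (length x)))) (∧≡true (true-leq (proj₂ (level-spec (length x))))
      (true-all (downFrom (nd (level (length x)))) ok)))
    where
    ok : ∀ {j} → j ∈ₗ downFrom (nd (level (length x))) → (not (bitAt x j) ∨ clauseOk (trueLits (toList σ)) j) ≡ true
    ok {j} j∈ with bitAt x j in b
    ... | false = refl
    ... | true = good
      where
      j< = downFrom-∈ _ j∈
      i = fromℕ< j<
      i≡ : toℕ i ≡ j
      i≡ = FP.toℕ-fromℕ< j<
      good : clauseOk (trueLits (toList σ)) j ≡ true
      good with sat i (trans (cong (bitAt x) i≡) b)
      ... | p , p∈ , pt = true-any (subst (λ z → rbin (toℕ p) ∈ₗ clauseAt z) i≡ (∈-clauseAt (level (length x)) i (∈-members p∈)))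
        (true-memb (∈-trueLits σ (p , refl , pt)))

  length-double : ∀ a → length (double a) ≡ 2 * length a
  length-double [] = refl
  length-double (b ∷ a) = trans (cong (2 +_) (length-double a)) (eq (length a))
    where
    eq : ∀ n → 2 + 2 * n ≡ 2 * suc n
    eq = solve-∀

  3SATC-InNP : InNP (ThreeSATC α)
  3SATC-InNP = verifier , PT⇒PolyTime (pt-cons ⊙ pt-pair (pt-acceptsWords ⊙ pt-parse) (pt-const bits [])) ,
    proj₁ certBound , λ x → complete x , sound x
    where
    -- A doubled assignment with separator has length twice the level plus 2, and the level is at
    -- most the length of the instance.
    certBound = toPolyBound (K 2 ⊗ X ⊕ K 2)
    cert : List Bool → List Bool
    cert a = double a ++ true ∷ false ∷ []
    parse-pair : ∀ x w → parse (pair x w) ≡ proj₂ (foldl parseStep (([] , []) , reverse x ∷ []) w)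
    parse-pair x w = cong proj₂ (trans (cong (foldl parseStep _) (sym (++-assoc (double x) (true ∷ false ∷ []) w))) (parse-word x w))
    complete : ∀ x → ThreeSATC α x → Σ (List Bool) λ w → length w ≤ polyBound (proj₁ certBound) (length x) × verifier (pair x w) ≡ true
    complete x s@(σ , _) = cert (toList σ) , len , trans (cong acceptsWords words)
        (trans (cong₂ accepts (reverse-involutive x) (reverse-involutive (toList σ))) (accepts-complete x s))
      where
      words : parse (pair x (cert (toList σ))) ≡ reverse (toList σ) ∷ reverse x ∷ []
      words = trans (parse-pair x _) (cong proj₂ (parse-double (toList σ) (true ∷ false ∷ [])))
      len : length (cert (toList σ)) ≤ polyBound (proj₁ certBound) (length x)
      len = ≤-trans (≤-reflexive (trans (length-++ (double (toList σ))) (cong (_+ 2) (trans (length-double (toList σ)) (cong (2 *_) (length-toList σ))))))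
        (≤-trans (+-monoˡ-≤ 2 (*-monoʳ-≤ 2 (≤-trans (k≤nd (level (length x))) (proj₁ (level-spec (length x)))))) (proj₂ certBound (length x)))
    sound : ∀ x → Σ (List Bool) (λ w → length w ≤ polyBound (proj₁ certBound) (length x) × verifier (pair x w) ≡ true) → ThreeSATC α x
    sound x (w , _ , e) with parse (pair x w) | trans (parse-pair x w) (proj₂ (parse-suffix w _))
    ... | a ∷ r ∷ [] | s with split (proj₁ (parse-suffix w (([] , []) , reverse x ∷ []))) s
      where
      split : ∀ more → a ∷ r ∷ [] ≡ more ++ reverse x ∷ [] → r ≡ reverse x
      split (_ ∷ []) refl = refl
      split (_ ∷ _ ∷ []) ()
      split (_ ∷ _ ∷ _ ∷ _) ()
    ... | refl = subst (ThreeSATC α) (reverse-involutive x) (accepts-sound (reverse (reverse x)) (reverse a) e)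

  -- Selecting also the proper supersets of the clauses of f is harmless, as f implies them.
  selected : List (List (Bool × ℕ)) → ℕ → Bool
  selected f j = any (λ c → all (λ l → memb (rbin (litIndex l)) (clauseAt j)) c) f

  encode : List (List (Bool × ℕ)) → ℕ → List Bool
  encode f k = tabulateDown (selected f) (nd k)

  formula lit : Ty
  lit = bool ⊠ nat
  formula = list (list lit)

  pt-litIndex : PT lit nat litIndex
  pt-litIndex = pt-plus (pt-times (pt-const nat 2) pt-snd) (pt-if pt-fst (pt-const nat 1) (pt-const nat 0))

  pt-encode : PT (formula ⊠ nat) bits (λ p → encode (proj₁ p) (proj₂ p))
  pt-encode = pt-tabulateDown {formula} {bool}
      (pt-any {list bits} {list lit} (pt-all {list bits} {lit} (pt-memb ⊙ pt-pair (pt-rbin ⊙ pt-litIndex ⊙ pt-snd) pt-fst))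
        ⊙ pt-pair (pt-clauseAt ⊙ pt-snd) pt-fst)
    ⊙ pt-pair pt-fst (pt-nd ⊙ pt-snd)

  module _ (f : List (List (Bool × ℕ))) (k : ℕ)
      (small : ∀ {c} → c ∈ₗ f → 1 ≤ length c × length c ≤ 3 × All (λ l → proj₂ l < k) c) where

    level-encode : level (length (encode f k)) ≡ k
    level-encode rewrite length-tabulateDown (selected f) (nd k) = level-unique k (nd k) ≤-refl (nd-< {k} ≤-refl)

    bitAt-encode : ∀ (j : Fin (nd k)) → bitAt (encode f k) (toℕ j) ≡ selected f (toℕ j)
    bitAt-encode j = bitAt-tabulate (selected f) (nd k) [] (toℕ j) (FP.toℕ<n j)

    index-of : ∀ {c} (c∈ : c ∈ₗ f) → Σ (Fin (nd k)) λ j → α k j ≡ fromClause c (proj₂ (proj₂ (small c∈)))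
    index-of {c} c∈ = α-surjective k (fromClause c (proj₂ (proj₂ (small c∈)))) (fromClause-nonempty c _ (proj₁ (small c∈)))
      (≤-trans (fromClause-size c _) (proj₁ (proj₂ (small c∈))))

    module _ {c} (c∈ : c ∈ₗ f) (j : Fin (nd k)) (αj : α k j ≡ fromClause c (proj₂ (proj₂ (small c∈)))) where

      private
        vars = proj₂ (proj₂ (small c∈))

      index-selected : bitAt (encode f k) (toℕ j) ≡ true
      index-selected = trans (bitAt-encode j) (true-any c∈ (true-all c λ l∈ →
        true-memb (∈-clauseAt k j (subst (λ s → _ ∈ₗ members s) (sym αj) (fromClause-∋ c vars l∈)))))

      index-holds : ∀ {σ} → ClauseSat {k} σ (α k j) → ClauseHolds (bitAt (toList σ)) c
      index-holds {σ} (p , p∈ , e) = from-literal (fromClause-∈ c vars (subst (p ∈_) αj p∈))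
        where
        from-literal : (Σ (Bool × ℕ) λ l → l ∈ₗ c × toℕ p ≡ litIndex l) → ClauseHolds (bitAt (toList σ)) c
        from-literal (l , l∈ , p≡) = l , l∈ , litVal-Holds σ (All.lookup vars l∈) p p≡ e

    encode-sound : ThreeSATC α (encode f k) → Σ (ℕ → Bool) λ β → ∀ {c} → c ∈ₗ f → ClauseHolds β c
    encode-sound s = from-model (subst (λ l → Sat α l (encode f k)) level-encode s)
      where
      from-model : Sat α k (encode f k) → Σ (ℕ → Bool) λ β → ∀ {c} → c ∈ₗ f → ClauseHolds β c
      from-model (σ , sat) = bitAt (toList σ) , λ c∈ → let (j , αj) = index-of c∈ in
        index-holds c∈ j αj (sat j (index-selected c∈ j αj))

    encode-complete : (β : ℕ → Bool) → (∀ {c} → c ∈ₗ f → ClauseHolds β c) → ThreeSATC α (encode f k)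
    encode-complete β holds = subst (λ l → Sat α l (encode f k)) (sym level-encode) (σ , sat)
      where
      σ : Vec Bool k
      σ = Data.Vec.tabulate (β ∘ toℕ)
      σ-β : ∀ {v} → v < k → bitAt (toList σ) v ≡ β v
      σ-β v< = trans (cong (bitAt (toList σ)) (sym (FP.toℕ-fromℕ< v<))) (trans (bitAt-toList σ (fromℕ< v<))
        (trans (lookup∘tabulate (β ∘ toℕ) (fromℕ< v<)) (cong β (FP.toℕ-fromℕ< v<))))
      sat : ∀ j → bitAt (encode f k) (toℕ j) ≡ true → ClauseSat {k} σ (α k j)
      sat j e with any-true f (trans (sym (bitAt-encode j)) e)
      ... | c , c∈ , inside-j with holds c∈
      ... | l , l∈ , h with clauseAt-∈ k j (memb-true _ (clauseAt (toℕ j)) (all-true c inside-j l∈))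
      ... | m , m∈ , e′ with members-∈ (α k j) m∈
      ... | p , p∈ , p≡ = p , p∈ , Holds-litVal σ v< (trans (σ-β v<) h) p (trans p≡ (sym (rbin-injective e′)))
        where
        v< : proj₂ l < k
        v< = All.lookup (proj₂ (proj₂ (small c∈))) l∈

  -- NP-hardness: the reduction and its polynomial-time program

  module Hardness (V : TM) where
    open Tableau V

    private
      pos′ tlit : Ty
      pos′ = bool ⊠ nat
      tlit = bool ⊠ nat ⊠ pos′ ⊠ nat

    pt-vr : ∀ {a N t i z} → PT a nat N → PT a nat t → PT a nat i → PT a nat z → PT a nat (λ x → vr (N x) (t x) (i x) (z x))
    pt-vr N t i z = pt-plus (pt-times (pt-const nat zn) (pt-plus (pt-times N t) i)) z

    pt-N : ∀ {a T} → PT a nat T → PT a nat (λ x → 4 + T x)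
    pt-N T = pt-plus (pt-const nat 4) T

    pt-posAt : PT (pos′ ⊠ nat) nat (λ p → posAt (proj₁ p) (proj₂ p))
    pt-posAt = pt-if (pt-fst ⊙ pt-fst) (pt-plus (pt-snd ⊙ pt-fst) pt-snd) (pt-snd ⊙ pt-fst)

    pt-single : ∀ {a b f} → PT a b f → PT a (list b) (λ x → f x ∷ [])
    pt-single P = pt-cons ⊙ pt-pair P (pt-const _ [])

    pt-∷ : ∀ {a b f g} → PT a b f → PT a (list b) g → PT a (list b) (λ x → f x ∷ g x)
    pt-∷ P Q = pt-cons ⊙ pt-pair P Q

    pt-instLit : PT (((nat ⊠ nat) ⊠ nat) ⊠ tlit) lit
      (λ x → instLit (proj₁ (proj₁ (proj₁ x))) (proj₂ (proj₁ (proj₁ x))) (proj₂ (proj₁ x)) (proj₂ x))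
    pt-instLit = pt-pair (pt-fst ⊙ pt-snd) (pt-vr (pt-N (pt-fst ⊙ pt-fst ⊙ pt-fst))
      (pt-plus (pt-fst ⊙ pt-snd ⊙ pt-snd) (pt-snd ⊙ pt-fst ⊙ pt-fst))
      (pt-posAt ⊙ pt-pair (pt-fst ⊙ pt-snd ⊙ pt-snd ⊙ pt-snd) (pt-snd ⊙ pt-fst))
      (pt-snd ⊙ pt-snd ⊙ pt-snd ⊙ pt-snd))

    pt-instClause : PT (((nat ⊠ nat) ⊠ nat) ⊠ list tlit) (list lit)
      (λ x → instClause (proj₁ (proj₁ (proj₁ x))) (proj₂ (proj₁ (proj₁ x))) (proj₂ (proj₁ x)) (proj₂ x))
    pt-instClause = pt-gather (pt-single pt-instLit)

    pt-stepClauses : PT nat formula stepClauses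
    pt-stepClauses = pt-gather {nat} {nat} (pt-gather {nat ⊠ nat} {nat}
        (pt-gather {(nat ⊠ nat) ⊠ nat} {list tlit} (pt-single pt-instClause) ⊙ pt-pair pt-id (pt-const (list (list tlit)) schemata))
        ⊙ pt-pair pt-id (pt-downFrom ⊙ pt-suc ⊙ pt-fst))
      ⊙ pt-pair pt-id (pt-downFrom ⊙ pt-suc)

    pt-lit : ∀ {a T t i} (b : Bool) → PT a nat T → PT a nat t → PT a nat i → (z : ℕ) →
      PT a lit (λ x → b , vr (4 + T x) (t x) (i x) z)
    pt-lit b T t i z = pt-pair (pt-const bool b) (pt-vr (pt-N T) t i (pt-const nat z))

    pt-initClause : PT ((nat ⊠ nat ⊠ bits) ⊠ nat) formula
      (λ x → initClause (proj₁ (proj₁ x)) (proj₁ (proj₂ (proj₁ x))) (proj₂ (proj₂ (proj₁ x))) (proj₂ x))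
    pt-initClause = pt-∷ (pt-single (at false i (aCell leftOf blank)))
      (pt-if (pt-leq (pt-suc ⊙ i) (pt-length ⊙ px))
        (pt-single (pt-single (pt-pair (pt-const bool false) (pt-vr (pt-N T) zero′ i
          (pt-if (pt-bitAt ⊙ pt-pair px i) (pt-const nat (zc (aCell rightOf (encBit true)))) (pt-const nat (zc (aCell rightOf (encBit false)))))))))
        (pt-if (pt-leq (pt-suc ⊙ i) (pt-plus (pt-length ⊙ px) W))
          (pt-∷ (pt-∷ (at false i (aCell rightOf (encBit false))) (pt-∷ (at false i (aCell rightOf (encBit true))) (pt-single (at false i (aCell rightOf blank)))))
            (pt-single (pt-∷ (at true i (aCell rightOf blank)) (pt-single (at false (pt-suc ⊙ i) (aCell rightOf blank))))))
          (pt-single (pt-single (at false i (aCell rightOf blank))))))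
      where
      E = (nat ⊠ nat ⊠ bits) ⊠ nat
      T : PT E nat (λ x → proj₁ (proj₁ x))
      T = pt-fst ⊙ pt-fst
      W : PT E nat (λ x → proj₁ (proj₂ (proj₁ x)))
      W = pt-fst ⊙ pt-snd ⊙ pt-fst
      px : PT E bits (λ x → proj₂ (proj₂ (proj₁ x)))
      px = pt-snd ⊙ pt-snd ⊙ pt-fst
      i : PT E nat proj₂
      i = pt-snd
      zero′ : PT E nat (λ _ → 0)
      zero′ = pt-const nat 0
      at : ∀ {j} b → PT E nat j → (z : Atom) → PT E lit (λ x → b , vr (4 + proj₁ (proj₁ x)) 0 (j x) (zc z))
      at b j z = pt-lit b T zero′ j (zc z)

    pt-endClauses : PT nat formula endClauses
    pt-endClauses = pt-gather {nat} {nat} (pt-single (pt-single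
        (pt-pair (pt-const bool true) (pt-vr (pt-N pt-fst) pt-fst (pt-const nat 0) pt-snd))))
      ⊙ pt-pair pt-id (pt-const (list nat) rejectCodes)

    pt-clauses : PT (nat ⊠ nat ⊠ bits) formula (λ x → clauses (proj₁ x) (proj₁ (proj₂ x)) (proj₂ (proj₂ x)))
    pt-clauses = pt₂ pt-append (pt-stepClauses ⊙ pt-fst)
      (pt₂ pt-append (pt-gather pt-initClause ⊙ pt-pair pt-id (pt-downFrom ⊙ pt-suc ⊙ pt-fst))
        (pt-∷ (pt-single (pt-lit false pt-fst (pt-const nat 0) (pt-const nat 0) (zc (aState (start V))))) (pt-endClauses ⊙ pt-fst)))

    pt-double : PT bits bits double
    pt-double = pt-ext (pt-gather {nat} {bool} (pt-∷ pt-snd (pt-single pt-snd)) ⊙ pt-pair unit pt-reverse)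
      λ x → trans (reverse-foldl (λ acc b → b ∷ b ∷ acc) [] x) (eq x)
      where
      eq : ∀ x → Data.List.foldr (λ b acc → b ∷ b ∷ acc) [] x ≡ double x
      eq [] = refl
      eq (b ∷ x) = cong (λ l → b ∷ b ∷ l) (eq x)

    module _ (c₁ c₂ : ℕ) where

      prefix : List Bool → List Bool
      prefix x = double x ++ (true ∷ false ∷ [])

      certBound timeBound : List Bool → ℕ
      certBound x = polyBound c₂ (length x)
      -- The time allowed on the longest admissible pair; by monotonicity it suffices for every
      -- shorter certificate.
      timeBound x = polyBound c₁ (length (prefix x) + certBound x)

      tableau : List Bool → List (List Lit)
      tableau x = clauses (timeBound x) (certBound x) (prefix x)

      -- One variable for each time, position and atom. As `zn` is a constant of `V`, this number,
      -- and with it the instance length `nd` of it, is polynomial in the input length.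
      variables : List Bool → ℕ
      variables x = ((4 + timeBound x) * (4 + timeBound x)) * zn

      reduction : List Bool → List Bool
      reduction x = encode (tableau x) (variables x)

      pt-reduction : PT bits bits reduction
      pt-reduction = pt-encode ⊙ pt-pair (pt-clauses ⊙ pt-pair T (pt-pair W px))
          (pt-times (pt-times (pt-N T) (pt-N T)) (pt-const nat zn))
        where
        px : PT bits bits prefix
        px = pt₂ pt-append pt-double (pt-const bits (true ∷ false ∷ []))
        W : PT bits nat certBound
        W = pt-polyBound c₂ ⊙ pt-length
        T : PT bits nat timeBound
        T = pt-polyBound c₁ ⊙ pt-plus (pt-length ⊙ px) W

      reduction-PolyTime : PolyTime reduction
      reduction-PolyTime = PT⇒PolyTime pt-reduction

      module _ (v : List Bool → Bool) (computes : ComputesIn V (λ y → v y ∷ []) (polyBound c₁)) (x : List Bool) where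
        open Formula (timeBound x) (certBound x) (prefix x)

        small : ∀ {c} → c ∈ₗ tableau x → 1 ≤ length c × length c ≤ 3 × All (λ l → proj₂ l < variables x) c
        small m = IsClause-small (∈⇒IsClause (timeBound x) (certBound x) (prefix x) m)

        pair-≡ : ∀ w → prefix x ++ w ≡ pair x w
        pair-≡ w = ++-assoc (double x) (true ∷ false ∷ []) w

        final : List Bool → Config V
        final w = run V (timeBound x) (initial V (prefix x ++ w))

        -- The verifier halts at some time within `timeBound x` that varies with `w`; repeating the
        -- halted configuration extends the run to the fixed time of the tableau.
        output : ∀ w → length w ≤ certBound x → decodeOut (right (final w)) ≡ v (pair x w) ∷ []
        output w w≤ with computes (prefix x ++ w)
        ... | t , t≤ , h , out = trans (cong (decodeOut ∘ right) (trans (cong (λ k → run V k y) (sym (m+[n∸m]≡n t≤T)))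
            (trans (run-+ V t (timeBound x ∸ t) y) (run-halted V (timeBound x ∸ t) (run V t y) h))))
            (trans out (cong (λ z → v z ∷ []) (pair-≡ w)))
          where
          y = initial V (prefix x ++ w)
          t≤T : t ≤ timeBound x
          t≤T = ≤-trans t≤ (mono (polyBound-Pol c₁) (≤-trans (≤-reflexive (length-++ (prefix x))) (+-monoʳ-≤ (length (prefix x)) w≤)))

        reduction-sound : ThreeSATC α (reduction x) → Σ (List Bool) λ w → length w ≤ certBound x × v (pair x w) ≡ true
        reduction-sound s = from-model (encode-sound (tableau x) (variables x) small s)
          where
          from-model : (Σ (ℕ → Bool) λ β → ∀ {c} → c ∈ₗ tableau x → ClauseHolds β c) →
            Σ (List Bool) λ w → length w ≤ certBound x × v (pair x w) ≡ true
          from-model (β , sat) = w , w≤ , decodeOut-hd (right (final w)) (output w w≤) (Sound.ends-accepting β model)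
            where
            model : ∀ {c} → IsClause c → ClauseHolds β c
            model m = sat (IsClause⇒∈ (timeBound x) (certBound x) (prefix x) m)
            w : List Bool
            w = Sound.w β model
            w≤ : length w ≤ certBound x
            w≤ = Sound.witness-length β model (certBound x) a

        reduction-complete : ∀ w → length w ≤ certBound x → v (pair x w) ≡ true → ThreeSATC α (reduction x)
        reduction-complete w w≤ e = encode-complete (tableau x) (variables x) small (Complete.β w w≤ accepts′)
            (λ m → Complete.satisfied w w≤ accepts′ (∈⇒IsClause (timeBound x) (certBound x) (prefix x) m))
          where
          accepts′ : scanned (final w) ≡ accepting
          accepts′ = hd-decodeOut (right (final w)) (trans (output w w≤) (cong (_∷ []) e))

theorem6 : (α : (k : ℕ) → Fin (nd k) → Clause k) → AlphaFamily α → NPComplete (ThreeSATC α)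
theorem6 α fam = Family.3SATC-InNP α fam , hard
  where
  hard : ∀ L′ → InNP L′ → L′ ≤ₚ ThreeSATC α
  hard L′ (v , (V , c₁ , computes) , c₂ , spec) = Family.Hardness.reduction α fam V c₁ c₂ , Family.Hardness.reduction-PolyTime α fam V c₁ c₂ , λ x →
      (λ l → let (w , w≤ , e) = proj₁ (spec x) l in Family.Hardness.reduction-complete α fam V c₁ c₂ v computes x w w≤ e) ,
      (λ s → proj₂ (spec x) (Family.Hardness.reduction-sound α fam V c₁ c₂ v computes x s))
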